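{- Fix $g \in \mathcal{S}_d^n$, and let $f \in \mathcal{S}_d^n$ be given as a black box. Assuming unit-cost arithmetic operations, the minimum number of queries to $f$ needed to compute $g(\partial\mathbf{x})f$ is exactly $\mathbf{R}(g)$. That is, there is an algorithm which computes $g(\partial \mathbf{x})f$ for every $f\in\mathcal{S}_d^n$ using $\mathbf{R}(g)$ queries, and every algorithm (possibly querying $f$ adaptively) that computes $g(\partial\mathbf{x})f$ for every $f\in\mathcal{S}_d^n$ makes at least $\mathbf{R}(g)$ queries.
   Context: $\mathcal{S}_d^n = \mathbb{C}[x_1,\ldots,x_n]_d$ is the space of homogeneous degree-$d$ polynomials in $n$ variables over $\mathbb{C}$. The Waring rank $\mathbf{R}(g)$ of $g\in\mathcal{S}_d^n$ is the minimum $r$ such that $g=\ell_1^d+\cdots+\ell_r^d$ for some linear forms $\ell_1,\ldots,\ell_r\in\mathcal{S}_1^n$. $g(\partial\mathbf{x})$ denotes the partial differential operator $g(\partial/\partial x_1,\ldots,\partial/\partial x_n)$; for $f,g\in\mathcal{S}_d^n$, $g(\partial \mathbf{x})f\in\mathbb{C}$. Given $f$ as a black box, a query is the choice of a point $v\in\mathbb{C}^n$, to which the answer is $f(v)$. Arithmetic is exact over $\mathbb{C}$; only the number of queries is counted. The polynomial $g$ is known to the algorithm. -}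

module Defs where

open import Algebra.Bundles using (CommutativeRing; Semiring)
import Algebra.Consequences.Setoid as Consequences
import Algebra.Definitions.RawMonoid as RawMonoidOps
import Algebra.Definitions.RawSemiring as RawSemiringOps
import Algebra.Properties.AbelianGroup as AbelianGroupProperties
import Algebra.Properties.CommutativeSemigroup as CommutativeSemigroupProperties
import Algebra.Properties.Group as GroupProperties
import Algebra.Properties.Ring as RingProperties
import Algebra.Solver.Ring.NaturalCoefficients.Default as NaturalCoefficients
open import Data.Fin.Base using (Fin)
open import Data.List.Base as List using (List; []; _∷_; upTo; allFin; concatMap; cartesianProductWith)
open import Data.Nat.Base as ℕ using (ℕ; zero; suc; _∸_; _⊓_; _≤_)
import Data.Nat.GeneralisedArithmetic as ℕ using (fold)
import Data.Nat.Properties as ℕₚ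
open import Data.Product.Base using (_×_; _,_; ∃-syntax; Σ-syntax; uncurry)
open import Data.Rational.Base as ℚ using (ℚ; 0ℚ; 1ℚ; ½; ∣_∣; positive)
import Data.Rational.Properties as ℚₚ
open import Data.Vec.Base as Vec using (Vec; []; _∷_; lookup; replicate; _[_]%=_)
open import Data.Vec.Functional using (Vector)
open import Data.Vec.Relation.Binary.Pointwise.Inductive using (Pointwise)
open import Function.Base using (id)
open import Level using (Level; _⊔_; 0ℓ)
open import Relation.Binary.Bundles using (Setoid)
open import Relation.Binary.PropositionalEquality
  using (_≡_; _≢_; refl; sym; trans; cong; subst)
import Relation.Binary.Reasoning.Setoid as SetoidReasoning

private
  variable
    c ℓ : Level
    I : Set

------------------------------------------------------------------------
-- Identities about differences, proved over an abstract ring because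
-- conversion checking is slow on ℚ, whose operations normalise fractions.

private
  module Differences (R : CommutativeRing c ℓ) where
    open CommutativeRing R hiding (refl; sym; trans)
    private module R = CommutativeRing R
    open GroupProperties +-group
      using (//-rightDividesˡ; \\-leftDividesʳ; ⁻¹-anti-homo-//)
    open AbelianGroupProperties +-abelianGroup using (⁻¹-∙-comm)
    open CommutativeSemigroupProperties +-commutativeSemigroup using (interchange)
    open RingProperties ring using (-‿distribʳ-*)

    split : ∀ a b → a ≈ b + (a - b)
    split a b = R.sym (R.trans (+-comm b (a - b)) (//-rightDividesˡ b a))

    swap-diff : ∀ a b → - (a - b) ≈ b - a
    swap-diff = ⁻¹-anti-homo-//

    chain-diff : ∀ a b c → (a - b) + (b - c) ≈ a - c
    chain-diff a b c = R.trans (+-assoc a (- b) (b - c)) (+-congˡ (\\-leftDividesʳ b (- c)))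

    +-diff : ∀ a b a′ b′ → (a - a′) + (b - b′) ≈ (a + b) - (a′ + b′)
    +-diff a b a′ b′ = R.trans (interchange a (- a′) b (- b′)) (+-congˡ (⁻¹-∙-comm a′ b′))

    neg-diff : ∀ a a′ → - (a - a′) ≈ (- a) - (- a′)
    neg-diff a a′ = R.sym (⁻¹-∙-comm a (- a′))

    *-distribˡ-diff : ∀ a b c → a * (b - c) ≈ a * b - c * a
    *-distribˡ-diff a b c = R.trans (distribˡ a b (- c))
      (+-congˡ (R.trans (R.sym (-‿distribʳ-* a c)) (-‿cong (*-comm a c))))

    *-diff : ∀ a b a′ b′ → a * (b - b′) + b′ * (a - a′) ≈ a * b - a′ * b′
    *-diff a b a′ b′ = R.trans
      (+-cong (*-distribˡ-diff a b b′) (*-distribˡ-diff b′ a a′))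
      (chain-diff (a * b) (b′ * a) (a′ * b′))

  module ℚ-diff = Differences ℚₚ.+-*-commutativeRing

------------------------------------------------------------------------
-- The real numbers: Cauchy sequences of rationals, with equality
-- "the difference tends to 0".

-- x i → 0 as rank i → ∞. A record, because comparing unfolded inequalities
-- between rationals is slow.
record Vanishing {I : Set} (rank : I → ℕ) (x : I → ℚ) : Set where
  constructor vanishing
  field
    small : ∀ ε → 0ℚ ℚ.< ε → ∃[ N ] (∀ i → N ≤ rank i → ∣ x i ∣ ℚ.< ε)

open Vanishing public

Cauchy : (ℕ → ℚ) → Set
Cauchy x = Vanishing (uncurry _⊓_) (λ (m , n) → x m ℚ.- x n)

record ℝ : Set where
  constructor mkℝ
  field
    seq    : ℕ → ℚ
    cauchy : Cauchy seq

open ℝ public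

infix 4 _≈ℝ_

_≈ℝ_ : ℝ → ℝ → Set
x ≈ℝ y = Vanishing id (λ n → seq x n ℚ.- seq y n)

module _ {rank : I → ℕ} where

  Vanishing-resp : ∀ {x y} → (∀ i → x i ≡ y i) → Vanishing rank x → Vanishing rank y
  small (Vanishing-resp x≡y x→0) ε ε>0 with small x→0 ε ε>0
  ... | N , x<ε = N , λ i N≤i → subst (λ q → ∣ q ∣ ℚ.< ε) (x≡y i) (x<ε i N≤i)

  Vanishing-0 : ∀ {x} → (∀ i → x i ≡ 0ℚ) → Vanishing rank x
  small (Vanishing-0 x≡0) ε ε>0 = 0 , λ i _ → subst (λ q → ∣ q ∣ ℚ.< ε) (sym (x≡0 i)) ε>0

  Vanishing-+ : ∀ {x y} → Vanishing rank x → Vanishing rank y →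
                Vanishing rank (λ i → x i ℚ.+ y i)
  small (Vanishing-+ {x} {y} x→0 y→0) ε ε>0
    with small x→0 (½ ℚ.* ε) ½ε>0 | small y→0 (½ ℚ.* ε) ½ε>0
    where
    ½ε>0 : 0ℚ ℚ.< ½ ℚ.* ε
    ½ε>0 = ℚₚ.*-monoʳ-<-pos ½ ε>0
  ... | M , xs | N , ys = M ℕ.⊔ N , λ i p → begin-strict
    ∣ x i ℚ.+ y i ∣         ≤⟨ ℚₚ.∣p+q∣≤∣p∣+∣q∣ (x i) (y i) ⟩
    ∣ x i ∣ ℚ.+ ∣ y i ∣     <⟨ ℚₚ.+-mono-< (xs i (ℕₚ.≤-trans (ℕₚ.m≤m⊔n M N) p))
                                           (ys i (ℕₚ.≤-trans (ℕₚ.m≤n⊔m M N) p)) ⟩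
    ½ ℚ.* ε ℚ.+ ½ ℚ.* ε     ≡⟨ ℚₚ.*-distribʳ-+ ε ½ ½ ⟨
    1ℚ ℚ.* ε                ≡⟨ ℚₚ.*-identityˡ ε ⟩
    ε                       ∎
    where open ℚₚ.≤-Reasoning

  Vanishing-neg : ∀ {x} → Vanishing rank x → Vanishing rank (λ i → ℚ.- x i)
  small (Vanishing-neg {x} x→0) ε ε>0 with small x→0 ε ε>0
  ... | N , x<ε = N , λ i N≤i →
    subst (ℚ._< ε) (sym (ℚₚ.∣-p∣≡∣p∣ (x i))) (x<ε i N≤i)

  Bounded : (I → ℚ) → Set
  Bounded b = ∃[ B ] (0ℚ ℚ.< B) × ∃[ N ] (∀ i → N ≤ rank i → ∣ b i ∣ ℚ.≤ B)

  Vanishing-* : ∀ {b x} → Bounded b → Vanishing rank x →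
                Vanishing rank (λ i → b i ℚ.* x i)
  small (Vanishing-* {b} {x} (B , B>0 , M , b≤B) x→0) ε ε>0
    with small x→0 ((ℚ.1/ B) {{B≢0}} ℚ.* ε) B⁻¹ε>0
    where
    instance
      _ = positive B>0
      B≢0 = ℚₚ.pos⇒nonZero B
      _ = ℚₚ.1/pos⇒pos B
    B⁻¹ε>0 : 0ℚ ℚ.< ℚ.1/ B ℚ.* ε
    B⁻¹ε>0 = subst (ℚ._< ℚ.1/ B ℚ.* ε) (ℚₚ.*-zeroʳ (ℚ.1/ B))
               (ℚₚ.*-monoʳ-<-pos (ℚ.1/ B) ε>0)
  ... | N , x<δ = M ℕ.⊔ N , λ i p → begin-strict
    ∣ b i ℚ.* x i ∣         ≡⟨ ℚₚ.∣p*q∣≡∣p∣*∣q∣ (b i) (x i) ⟩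
    ∣ b i ∣ ℚ.* ∣ x i ∣     ≤⟨ ℚₚ.*-monoʳ-≤-nonNeg ∣ x i ∣ {{ℚₚ.∣-∣-nonNeg (x i)}}
                                 (b≤B i (ℕₚ.≤-trans (ℕₚ.m≤m⊔n M N) p)) ⟩
    B ℚ.* ∣ x i ∣           <⟨ ℚₚ.*-monoʳ-<-pos B (x<δ i (ℕₚ.≤-trans (ℕₚ.m≤n⊔m M N) p)) ⟩
    B ℚ.* (ℚ.1/ B ℚ.* ε)    ≡⟨ ℚₚ.*-assoc B (ℚ.1/ B) ε ⟨
    B ℚ.* ℚ.1/ B ℚ.* ε      ≡⟨ cong (ℚ._* ε) (ℚₚ.*-inverseʳ B) ⟩
    1ℚ ℚ.* ε                ≡⟨ ℚₚ.*-identityˡ ε ⟩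
    ε                       ∎
    where
    open ℚₚ.≤-Reasoning
    instance
      _ = positive B>0
      _ = ℚₚ.pos⇒nonZero B

cauchy⇒bounded : ∀ {x} → Cauchy x → Bounded {rank = id} x
cauchy⇒bounded {x} cx with small cx 1ℚ (ℚₚ.positive⁻¹ 1ℚ)
... | N , close = ∣ x N ∣ ℚ.+ 1ℚ , B>0 , N , λ n N≤n → begin
    ∣ x n ∣                          ≡⟨ cong ∣_∣ (ℚ-diff.split (x n) (x N)) ⟩
    ∣ x N ℚ.+ (x n ℚ.- x N) ∣        ≤⟨ ℚₚ.∣p+q∣≤∣p∣+∣q∣ (x N) _ ⟩
    ∣ x N ∣ ℚ.+ ∣ x n ℚ.- x N ∣      ≤⟨ ℚₚ.+-monoʳ-≤ ∣ x N ∣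
                                          (ℚₚ.<⇒≤ (close (n , N) (ℕₚ.⊓-glb N≤n ℕₚ.≤-refl))) ⟩
    ∣ x N ∣ ℚ.+ 1ℚ                   ∎
  where
  open ℚₚ.≤-Reasoning
  B>0 : 0ℚ ℚ.< ∣ x N ∣ ℚ.+ 1ℚ
  B>0 = ℚₚ.+-mono-≤-< (ℚₚ.0≤∣p∣ (x N)) (ℚₚ.positive⁻¹ 1ℚ)

infixl 6 _+ℝ_
infixl 7 _*ℝ_
infix  8 -ℝ_

fromℚ : ℚ → ℝ
seq    (fromℚ q) _ = q
cauchy (fromℚ q)   = Vanishing-0 (λ _ → ℚₚ.+-inverseʳ q)

_+ℝ_ : ℝ → ℝ → ℝ
seq    (x +ℝ y) n = seq x n ℚ.+ seq y n
cauchy (x +ℝ y)   = Vanishing-resp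
  (λ (m , n) → ℚ-diff.+-diff (seq x m) (seq y m) (seq x n) (seq y n))
  (Vanishing-+ (cauchy x) (cauchy y))

-ℝ_ : ℝ → ℝ
seq    (-ℝ x) n = ℚ.- seq x n
cauchy (-ℝ x)   = Vanishing-resp
  (λ (m , n) → ℚ-diff.neg-diff (seq x m) (seq x n)) (Vanishing-neg (cauchy x))

_*ℝ_ : ℝ → ℝ → ℝ
seq    (x *ℝ y) n = seq x n ℚ.* seq y n
cauchy (x *ℝ y) with cauchy⇒bounded (cauchy x) | cauchy⇒bounded (cauchy y)
... | B , B>0 , M , x≤B | C , C>0 , N , y≤C = Vanishing-resp
  (λ (m , n) → ℚ-diff.*-diff (seq x m) (seq y m) (seq x n) (seq y n))
  (Vanishing-+
    (Vanishing-* {b = λ (m , n) → seq x m} (B , B>0 , M , λ (m , n) p → x≤B m (ℕₚ.m≤n⊓o⇒m≤n m n p)) (cauchy y))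
    (Vanishing-* {b = λ (m , n) → seq y n} (C , C>0 , N , λ (m , n) p → y≤C n (ℕₚ.m≤n⊓o⇒m≤o m n p)) (cauchy x)))

≡⇒≈ℝ : ∀ {x y} → (∀ n → seq x n ≡ seq y n) → x ≈ℝ y
≡⇒≈ℝ {x} {y} x≡y = Vanishing-0 λ n →
  trans (cong (ℚ._- seq y n) (x≡y n)) (ℚₚ.+-inverseʳ (seq y n))

ℝ-commutativeRing : CommutativeRing 0ℓ 0ℓ
ℝ-commutativeRing = record
  { Carrier = ℝ ; _≈_ = _≈ℝ_ ; _+_ = _+ℝ_ ; _*_ = _*ℝ_ ; -_ = -ℝ_
  ; 0# = fromℚ 0ℚ ; 1# = fromℚ 1ℚ
  ; isCommutativeRing = record
    { isRing = record
      { +-isAbelianGroup = record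
        { isGroup = record
          { isMonoid = record
            { isSemigroup = record
              { isMagma = record
                { isEquivalence = record
                  { refl  = λ {x} → ≡⇒≈ℝ {x} {x} (λ _ → refl)
                  ; sym   = λ {x} {y} p → Vanishing-resp
                      (λ n → ℚ-diff.swap-diff (seq x n) (seq y n)) (Vanishing-neg p)
                  ; trans = λ {x} {y} {z} p q → Vanishing-resp
                      (λ n → ℚ-diff.chain-diff (seq x n) (seq y n) (seq z n)) (Vanishing-+ p q)
                  }
                ; ∙-cong = λ {x} {x′} {y} {y′} p q → Vanishing-resp
                    (λ n → ℚ-diff.+-diff (seq x n) (seq y n) (seq x′ n) (seq y′ n))
                    (Vanishing-+ p q)
                }
              ; assoc = λ x y z → ≡⇒≈ℝ {(x +ℝ y) +ℝ z} {x +ℝ (y +ℝ z)}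
                  (λ n → ℚₚ.+-assoc (seq x n) (seq y n) (seq z n))
              }
            ; identity = (λ x → ≡⇒≈ℝ {fromℚ 0ℚ +ℝ x} {x} (λ n → ℚₚ.+-identityˡ (seq x n)))
                       , (λ x → ≡⇒≈ℝ {x +ℝ fromℚ 0ℚ} {x} (λ n → ℚₚ.+-identityʳ (seq x n)))
            }
          ; inverse = (λ x → ≡⇒≈ℝ {(-ℝ x) +ℝ x} {fromℚ 0ℚ} (λ n → ℚₚ.+-inverseˡ (seq x n)))
                    , (λ x → ≡⇒≈ℝ {x +ℝ (-ℝ x)} {fromℚ 0ℚ} (λ n → ℚₚ.+-inverseʳ (seq x n)))
          ; ⁻¹-cong = λ {x} {y} p → Vanishing-resp
              (λ n → ℚ-diff.neg-diff (seq x n) (seq y n)) (Vanishing-neg p)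
          }
        ; comm = λ x y → ≡⇒≈ℝ {x +ℝ y} {y +ℝ x} (λ n → ℚₚ.+-comm (seq x n) (seq y n))
        }
      ; *-cong = λ {x} {x′} {y} {y′} p q → Vanishing-resp
          (λ n → ℚ-diff.*-diff (seq x n) (seq y n) (seq x′ n) (seq y′ n))
          (Vanishing-+ (Vanishing-* {b = seq x} (cauchy⇒bounded (cauchy x)) q)
                       (Vanishing-* {b = seq y′} (cauchy⇒bounded (cauchy y′)) p))
      ; *-assoc = λ x y z → ≡⇒≈ℝ {(x *ℝ y) *ℝ z} {x *ℝ (y *ℝ z)}
          (λ n → ℚₚ.*-assoc (seq x n) (seq y n) (seq z n))
      ; *-identity = (λ x → ≡⇒≈ℝ {fromℚ 1ℚ *ℝ x} {x} (λ n → ℚₚ.*-identityˡ (seq x n)))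
                   , (λ x → ≡⇒≈ℝ {x *ℝ fromℚ 1ℚ} {x} (λ n → ℚₚ.*-identityʳ (seq x n)))
      ; distrib = (λ x y z → ≡⇒≈ℝ {x *ℝ (y +ℝ z)} {(x *ℝ y) +ℝ (x *ℝ z)}
                    (λ n → ℚₚ.*-distribˡ-+ (seq x n) (seq y n) (seq z n)))
                , (λ x y z → ≡⇒≈ℝ {(y +ℝ z) *ℝ x} {(y *ℝ x) +ℝ (z *ℝ x)}
                    (λ n → ℚₚ.*-distribʳ-+ (seq x n) (seq y n) (seq z n)))
      }
    ; *-comm = λ x y → ≡⇒≈ℝ {x *ℝ y} {y *ℝ x} (λ n → ℚₚ.*-comm (seq x n) (seq y n))
    }
  }

------------------------------------------------------------------------
-- The complex numbers: ℂ = ℝ[i] with i² = -1.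

module AdjoinI (R : CommutativeRing c ℓ) where
  open CommutativeRing R hiding (refl; sym; trans)
  private module R = CommutativeRing R

  infix 5 _+i_

  record R[i] : Set c where
    constructor _+i_
    field
      re im : Carrier

  open R[i] public

  _≈ᵢ_ : R[i] → R[i] → Set ℓ
  z ≈ᵢ w = re z ≈ re w × im z ≈ im w

  _+ᵢ_ _*ᵢ_ : R[i] → R[i] → R[i]
  z +ᵢ w = (re z + re w) +i (im z + im w)
  z *ᵢ w = (re z * re w - im z * im w) +i (re z * im w + im z * re w)

  -ᵢ_ : R[i] → R[i]
  -ᵢ z = (- re z) +i (- im z)

  private
    open NaturalCoefficients commutativeSemiring using (solve; _:+_; _:*_; _:=_)
    open RingProperties ring using (-1*x≈-x)

    assoc-re : ∀ m a b c d e f →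
      (a * c + m * (b * d)) * e + m * ((a * d + b * c) * f) ≈
      a * (c * e + m * (d * f)) + m * (b * (c * f + d * e))
    assoc-re = solve 7 (λ m a b c d e f →
      (a :* c :+ m :* (b :* d)) :* e :+ m :* ((a :* d :+ b :* c) :* f) :=
      a :* (c :* e :+ m :* (d :* f)) :+ m :* (b :* (c :* f :+ d :* e))) R.refl

    assoc-im : ∀ m a b c d e f →
      (a * c + m * (b * d)) * f + (a * d + b * c) * e ≈
      a * (c * f + d * e) + b * (c * e + m * (d * f))
    assoc-im = solve 7 (λ m a b c d e f →
      (a :* c :+ m :* (b :* d)) :* f :+ (a :* d :+ b :* c) :* e :=
      a :* (c :* f :+ d :* e) :+ b :* (c :* e :+ m :* (d :* f))) R.refl

    distribˡ-re : ∀ m a b c d e f →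
      a * (c + e) + m * (b * (d + f)) ≈ (a * c + m * (b * d)) + (a * e + m * (b * f))
    distribˡ-re = solve 7 (λ m a b c d e f →
      a :* (c :+ e) :+ m :* (b :* (d :+ f)) :=
      (a :* c :+ m :* (b :* d)) :+ (a :* e :+ m :* (b :* f))) R.refl

    distribˡ-im : ∀ a b c d e f →
      a * (d + f) + b * (c + e) ≈ (a * d + b * c) + (a * f + b * e)
    distribˡ-im = solve 6 (λ a b c d e f →
      a :* (d :+ f) :+ b :* (c :+ e) := (a :* d :+ b :* c) :+ (a :* f :+ b :* e)) R.refl

    comm-im : ∀ a b c d → a * d + b * c ≈ c * b + d * a
    comm-im = solve 4 (λ a b c d → a :* d :+ b :* c := c :* b :+ d :* a) R.refl

    ≈ᵢ-setoid : Setoid c ℓ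
    ≈ᵢ-setoid = record
      { _≈_ = _≈ᵢ_
      ; isEquivalence = record
        { refl  = R.refl , R.refl
        ; sym   = λ (p , q) → R.sym p , R.sym q
        ; trans = λ (p , q) (r , s) → R.trans p r , R.trans q s
        }
      }
    open module E = Setoid ≈ᵢ-setoid using ()

    -- The same product with subtraction written as adding (-1) times a
    -- number, which leaves only semiring identities for the solver.
    _*′_ : R[i] → R[i] → R[i]
    z *′ w = (re z * re w + (- 1#) * (im z * im w)) +i (re z * im w + im z * re w)

    *≈*′ : ∀ z w → (z *ᵢ w) ≈ᵢ (z *′ w)
    *≈*′ z w = +-congˡ (R.sym (-1*x≈-x _)) , R.refl

    +ᵢ-cong : ∀ {z z′ w w′} → z ≈ᵢ z′ → w ≈ᵢ w′ → (z +ᵢ w) ≈ᵢ (z′ +ᵢ w′)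
    +ᵢ-cong (p , q) (r , s) = +-cong p r , +-cong q s

    *ᵢ-cong : ∀ {z z′ w w′} → z ≈ᵢ z′ → w ≈ᵢ w′ → (z *ᵢ w) ≈ᵢ (z′ *ᵢ w′)
    *ᵢ-cong (p , q) (r , s) =
      +-cong (*-cong p r) (-‿cong (*-cong q s)) , +-cong (*-cong p s) (*-cong q r)

    *ᵢ-comm : ∀ z w → (z *ᵢ w) ≈ᵢ (w *ᵢ z)
    *ᵢ-comm (a +i b) (c +i d) =
      +-cong (*-comm a c) (-‿cong (*-comm b d)) , comm-im a b c d

    *ᵢ-assoc : ∀ x y z → ((x *ᵢ y) *ᵢ z) ≈ᵢ (x *ᵢ (y *ᵢ z))
    *ᵢ-assoc x@(a +i b) y@(c +i d) z@(e +i f) = begin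
      (x *ᵢ y) *ᵢ z  ≈⟨ *ᵢ-cong (*≈*′ x y) E.refl ⟩
      (x *′ y) *ᵢ z  ≈⟨ *≈*′ (x *′ y) z ⟩
      (x *′ y) *′ z  ≈⟨ assoc-re (- 1#) a b c d e f , assoc-im (- 1#) a b c d e f ⟩
      x *′ (y *′ z)  ≈⟨ *≈*′ x (y *′ z) ⟨
      x *ᵢ (y *′ z)  ≈⟨ *ᵢ-cong (E.refl {x}) (*≈*′ y z) ⟨
      x *ᵢ (y *ᵢ z)  ∎
      where open SetoidReasoning ≈ᵢ-setoid

    *ᵢ-distribˡ : ∀ x y z → (x *ᵢ (y +ᵢ z)) ≈ᵢ ((x *ᵢ y) +ᵢ (x *ᵢ z))
    *ᵢ-distribˡ x@(a +i b) y@(c +i d) z@(e +i f) = begin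
      x *ᵢ (y +ᵢ z)         ≈⟨ *≈*′ x (y +ᵢ z) ⟩
      x *′ (y +ᵢ z)         ≈⟨ distribˡ-re (- 1#) a b c d e f , distribˡ-im a b c d e f ⟩
      (x *′ y) +ᵢ (x *′ z)  ≈⟨ +ᵢ-cong (*≈*′ x y) (*≈*′ x z) ⟨
      (x *ᵢ y) +ᵢ (x *ᵢ z)  ∎
      where open SetoidReasoning ≈ᵢ-setoid

    *ᵢ-identityˡ : ∀ z → ((1# +i 0#) *ᵢ z) ≈ᵢ z
    *ᵢ-identityˡ z@(a +i b) = begin
      (1# +i 0#) *ᵢ z  ≈⟨ *≈*′ (1# +i 0#) z ⟩
      (1# +i 0#) *′ z  ≈⟨ +-cong (*-identityˡ a) (R.trans (*-congˡ (zeroˡ b)) (zeroʳ (- 1#)))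
                        , +-cong (*-identityˡ b) (zeroˡ a) ⟩
      z +ᵢ (0# +i 0#)  ≈⟨ +-identityʳ a , +-identityʳ b ⟩
      z                ∎
      where open SetoidReasoning ≈ᵢ-setoid

  R[i]-commutativeRing : CommutativeRing c ℓ
  R[i]-commutativeRing = record
    { Carrier = R[i] ; _≈_ = _≈ᵢ_ ; _+_ = _+ᵢ_ ; _*_ = _*ᵢ_ ; -_ = -ᵢ_
    ; 0# = 0# +i 0# ; 1# = 1# +i 0#
    ; isCommutativeRing = record
      { isRing = record
        { +-isAbelianGroup = record
          { isGroup = record
            { isMonoid = record
              { isSemigroup = record
                { isMagma = record
                  { isEquivalence = E.isEquivalence
                  ; ∙-cong = +ᵢ-cong
                  }
                ; assoc = λ _ _ _ → R.+-assoc _ _ _ , R.+-assoc _ _ _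
                }
              ; identity = (λ _ → R.+-identityˡ _ , R.+-identityˡ _)
                         , (λ _ → R.+-identityʳ _ , R.+-identityʳ _)
              }
            ; inverse = (λ _ → R.-‿inverseˡ _ , R.-‿inverseˡ _)
                      , (λ _ → R.-‿inverseʳ _ , R.-‿inverseʳ _)
            ; ⁻¹-cong = λ (p , q) → -‿cong p , -‿cong q
            }
          ; comm = λ _ _ → R.+-comm _ _ , R.+-comm _ _
          }
        ; *-cong = *ᵢ-cong
        ; *-assoc = *ᵢ-assoc
        ; *-identity = Consequences.comm∧idˡ⇒id ≈ᵢ-setoid *ᵢ-comm *ᵢ-identityˡ
        ; distrib = Consequences.comm∧distrˡ⇒distr ≈ᵢ-setoid +ᵢ-cong *ᵢ-comm *ᵢ-distribˡ
        }
      ; *-comm = *ᵢ-comm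
      }
    }

ℂ-commutativeRing : CommutativeRing 0ℓ 0ℓ
ℂ-commutativeRing = AdjoinI.R[i]-commutativeRing ℝ-commutativeRing

------------------------------------------------------------------------
-- Homogeneous polynomials and black-box algorithms over a commutative
-- ring; opened for ℂ at the end.

module Forms (R : CommutativeRing c ℓ) where
  open CommutativeRing R using (Carrier; _≈_; 0#; 1#; _+_; _*_; semiring; +-rawMonoid)
  open RawSemiringOps (Semiring.rawSemiring semiring) using (_^_) renaming (_×_ to _·_)
  open RawMonoidOps +-rawMonoid using () renaming (sum to ∑)

  ∑ₗ : {A : Set} → List A → (A → Carrier) → Carrier
  ∑ₗ xs f = List.foldr (λ x s → f x + s) 0# xs

  -- Entry α of such an array is the coefficient of x₁^α₁ ⋯ xₙ^αₙ. Arrays may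
  -- have infinite support, i.e. be formal power series; those that are
  -- homogeneous are polynomials.
  Coefficients : ℕ → Set c
  Coefficients n = Vec ℕ n → Carrier

  -- All (α , β) with α + β = γ, each listed once.
  splits : ∀ {n} → Vec ℕ n → List (Vec ℕ n × Vec ℕ n)
  splits []      = ([] , []) ∷ []
  splits (k ∷ γ) = cartesianProductWith
    (λ i (α , β) → (i ∷ α) , ((k ∸ i) ∷ β)) (upTo (suc k)) (splits γ)

  𝟙 : ∀ {n} → Coefficients n
  𝟙 []          = 1#
  𝟙 (zero  ∷ α) = 𝟙 α
  𝟙 (suc _ ∷ α) = 0#

  infixl 7 _⊛_

  _⊛_ : ∀ {n} → Coefficients n → Coefficients n → Coefficients n
  (f ⊛ g) γ = ∑ₗ (splits γ) (λ (α , β) → f α * g β)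

  power : ∀ {n} → Coefficients n → ℕ → Coefficients n
  power f zero    = 𝟙
  power f (suc d) = f ⊛ power f d

  -- The partial derivative ∂/∂xᵢ; below, ∂^ α = ∂₁^α₁ ⋯ ∂ₙ^αₙ.
  ∂ : ∀ {n} → Fin n → Coefficients n → Coefficients n
  ∂ i f α = suc (lookup α i) · f (α [ i ]%= suc)

  ∂^ : ∀ {n} → Vec ℕ n → Coefficients n → Coefficients n
  ∂^ {n} α f = List.foldr (λ i h → ℕ.fold h (∂ i) (lookup α i)) f (allFin n)

  -- All α ∈ ℕⁿ with α₁ + ⋯ + αₙ = d, each listed once.
  exponents : (n d : ℕ) → List (Vec ℕ n)
  exponents zero    zero    = [] ∷ []
  exponents zero    (suc _) = []
  exponents (suc n) d       =
    concatMap (λ k → List.map (k ∷_) (exponents n (d ∸ k))) (upTo (suc d))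

  record Form (n d : ℕ) : Set (c ⊔ ℓ) where
    field
      coeff       : Coefficients n
      homogeneous : ∀ α → Vec.sum α ≢ d → coeff α ≈ 0#

  open Form public

  Point : ℕ → Set c
  Point n = Vec Carrier n

  eval : ∀ {n d} → Form n d → Point n → Carrier
  eval {n} {d} f v = ∑ₗ (exponents n d) λ α →
    coeff f α * Vec.foldr′ _*_ 1# (Vec.zipWith _^_ v α)

  infix 9 _⟨∂⟩_

  _⟨∂⟩_ : ∀ {n d e} → Form n d → Form n e → Coefficients n
  (_⟨∂⟩_ {n} {d} g f) β = ∑ₗ (exponents n d) λ α → coeff g α * ∂^ α (coeff f) β

  -- In equal degrees g(∂x)f is a constant polynomial; this is that constant.
  pairing : ∀ {n d} → Form n d → Form n d → Carrier
  pairing {n} g f = (g ⟨∂⟩ f) (replicate n 0)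

  IsSumOfPowers : ∀ {n d} → Form n d → ℕ → Set (c ⊔ ℓ)
  IsSumOfPowers {n} {d} g r = Σ[ l ∈ Vector (Form n 1) r ]
    (∀ α → coeff g α ≈ ∑ (λ j → power (coeff (l j)) d α))

  IsWaringRank : ∀ {n d} → Form n d → ℕ → Set (c ⊔ ℓ)
  IsWaringRank g r = IsSumOfPowers g r × (∀ s → IsSumOfPowers g s → r ≤ s)

  -- Adaptive query strategies. What is done with the answers between queries
  -- is free of charge, hence an arbitrary function.
  data Strategy (n : ℕ) : Set c where
    output : Carrier → Strategy n
    query  : Point n → (Carrier → Strategy n) → Strategy n

  infix 4 _≋_

  data _≋_ {n : ℕ} : Strategy n → Strategy n → Set (c ⊔ ℓ) where
    output : ∀ {a b} → a ≈ b → output a ≋ output b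
    query  : ∀ {v w s t} → Pointwise _≈_ v w → (∀ {a b} → a ≈ b → s a ≋ t b) →
             query v s ≋ query w t

  -- Numbers are given only up to _≈_, so an algorithm must not depend on how
  -- an answer happens to be represented: its strategy has to be related to
  -- itself by the partial equivalence _≋_.
  record Algorithm (n : ℕ) : Set (c ⊔ ℓ) where
    field
      strategy    : Strategy n
      extensional : strategy ≋ strategy

  open Algorithm public

  runResult : ∀ {n d} → Strategy n → Form n d → Carrier
  runResult (output a)  f = a
  runResult (query v s) f = runResult (s (eval f v)) f

  runQueries : ∀ {n d} → Strategy n → Form n d → ℕ
  runQueries (output a)  f = 0
  runQueries (query v s) f = suc (runQueries (s (eval f v)) f)

  result : ∀ {n d} → Algorithm n → Form n d → Carrier
  result A = runResult (strategy A)

  queries : ∀ {n d} → Algorithm n → Form n d → ℕ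
  queries A = runQueries (strategy A)

  Computes : ∀ {n d} → Algorithm n → Form n d → Set (c ⊔ ℓ)
  Computes {n} {d} A g = (f : Form n d) → result A f ≈ pairing g f

open Forms ℂ-commutativeRing public

{-# OPTIONS --safe #-}
-- Upper bound: ℓᵈ(∂x)f = d! f(v) for ℓ = v₁x₁ + ⋯ + vₙxₙ, so a decomposition
-- of g into r powers computes g(∂x)f from r values of f.
--
-- Lower bound: let v₁, …, vₛ be the points queried on f. A form h vanishing at
-- them can be added to f without changing any answer, so g(∂x)h = 0. Hence
-- h ↦ g(∂x)h is a linear combination of the evaluations at the vⱼ, and
-- g = Σⱼ cⱼ ℓⱼᵈ, where the cⱼ are absorbed into the ℓⱼ by taking d-th roots.
--
-- The inequality r ≤ s is decidable, so it may be proved under a double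
-- negation, where every complex number is either zero or invertible and has
-- d-th roots. The latter holds because the equation (1 + y)ᵈ = 1 + x is solved
-- for small x by a contraction, and the d-th powers form a group; this first
-- gives roots of the Gaussian rationals along a path from 1, and then of c ≠ 0
-- by writing c = q(1 + x) with q a Gaussian rational.
module Submission where

open import Defs using (module Forms; module AdjoinI)
open import Algebra.Bundles using (CommutativeRing; Semiring)
import Algebra.Definitions.RawSemiring as RawSemiringOps
import Algebra.Properties.CommutativeSemiring.Exp as CommutativeExp
import Algebra.Properties.Ring as RingProperties
import Algebra.Properties.Semiring.Exp as Exp
import Algebra.Properties.Semiring.Mult as Mult
import Algebra.Properties.Semiring.Sum as Sum
import Algebra.Solver.Ring.NaturalCoefficients.Default as NaturalCoefficients
open import Data.Fin.Base using (Fin; zero; suc)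
open import Data.List.Base as List
  using (List; []; _∷_; _++_; upTo; applyUpTo; allFin; concatMap; cartesianProductWith)
import Data.List.Properties as Listₚ
open import Data.List.Relation.Unary.All as All using (All; []; _∷_)
open import Data.Nat.Base as ℕ using (ℕ; zero; suc; _∸_; s≤s; z≤n)
import Data.Nat.Coprimality as Coprimality
import Data.Nat.GeneralisedArithmetic as ℕ using (fold)
import Data.Nat.Properties as ℕₚ
open import Data.Product.Base using (_×_; _,_; ∃-syntax; Σ-syntax; proj₁; proj₂; uncurry)
open import Data.Sum.Base using (_⊎_; inj₁; inj₂)
open import Data.Vec.Base as Vec using (Vec; []; _∷_; lookup; replicate)
open import Data.Vec.Functional as Vector using (Vector)
open import Data.Vec.Relation.Binary.Pointwise.Inductive as Pointwise using (Pointwise; []; _∷_)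
open import Function.Base using (id; _∘_; _$_)
open import Level using (Level; _⊔_; 0ℓ) renaming (suc to lsuc)
open import Relation.Binary.Bundles using (Preorder)
open import Relation.Binary.Definitions using (Tri; tri<; tri≈; tri>)
open import Relation.Binary.PropositionalEquality as ≡ using (_≡_; _≢_)
import Relation.Binary.Reasoning.Preorder as PreorderReasoning
import Relation.Binary.Reasoning.Setoid as SetoidReasoning
open import Relation.Binary.Structures using (IsPreorder)
open import Relation.Nullary using (¬_; Dec; yes; no; contradiction)
open import Relation.Nullary.Decidable using (decidable-stable; toWitness)

-- Absolute values, norms and contractions

record AbsoluteValue {c ℓ} (K : CommutativeRing c ℓ) p : Set (c ⊔ ℓ ⊔ lsuc p) where
  open CommutativeRing K
  infix 4 _≤_
  field
    _≤_          : Carrier → Carrier → Set p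
    ≤-isPreorder : IsPreorder _≈_ _≤_
    +-mono-≤     : ∀ {x y u v} → x ≤ y → u ≤ v → x + u ≤ y + v
    *-monoˡ-≤    : ∀ {x y z} → 0# ≤ x → y ≤ z → x * y ≤ x * z
    ∣_∣          : Carrier → Carrier
    ∣∣-cong      : ∀ {x y} → x ≈ y → ∣ x ∣ ≈ ∣ y ∣
    0≤∣x∣        : ∀ x → 0# ≤ ∣ x ∣
    ∣x+y∣≤       : ∀ x y → ∣ x + y ∣ ≤ ∣ x ∣ + ∣ y ∣
    ∣x*y∣≈       : ∀ x y → ∣ x * y ∣ ≈ ∣ x ∣ * ∣ y ∣
    ∣-x∣≈        : ∀ x → ∣ - x ∣ ≈ ∣ x ∣
    0≤x⇒∣x∣≈x    : ∀ {x} → 0# ≤ x → ∣ x ∣ ≈ x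
    0≤x²         : ∀ x → 0# ≤ x * x
    0≤1          : 0# ≤ 1#
    -- This replaces division by 2: estimates with a factor ½ are kept in doubled form.
    halve        : ∀ {x y} → x + x ≤ y + y → x ≤ y

  open IsPreorder ≤-isPreorder public
    using () renaming (refl to ≤-refl; reflexive to ≤-reflexive; trans to ≤-trans)

  preorder : Preorder c ℓ p
  preorder = record { isPreorder = ≤-isPreorder }

  open NaturalCoefficients commutativeSemiring using (solve; _:+_; _:*_; _:=_; con)
  open PreorderReasoning preorder

  0≤x+y : ∀ {x y} → 0# ≤ x → 0# ≤ y → 0# ≤ x + y
  0≤x+y 0≤x 0≤y = ≤-trans (≤-reflexive (sym (+-identityˡ 0#))) (+-mono-≤ 0≤x 0≤y)

  0≤x*y : ∀ {x y} → 0# ≤ x → 0# ≤ y → 0# ≤ x * y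
  0≤x*y {x} 0≤x 0≤y = ≤-trans (≤-reflexive (sym (zeroʳ x))) (*-monoˡ-≤ 0≤x 0≤y)

  x≤x+y : ∀ {x y} → 0# ≤ y → x ≤ x + y
  x≤x+y {x} 0≤y = ≤-trans (≤-reflexive (sym (+-identityʳ x))) (+-mono-≤ ≤-refl 0≤y)

  x≤y+x : ∀ {x y} → 0# ≤ y → x ≤ y + x
  x≤y+x 0≤y = ≤-trans (x≤x+y 0≤y) (≤-reflexive (+-comm _ _))

  *-monoʳ-≤ : ∀ {x y z} → 0# ≤ x → y ≤ z → y * x ≤ z * x
  *-monoʳ-≤ {x} {y} {z} 0≤x y≤z =
    ≤-trans (≤-reflexive (*-comm y x)) (≤-trans (*-monoˡ-≤ 0≤x y≤z) (≤-reflexive (*-comm x z)))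

  *-mono-≤ : ∀ {x y u v} → 0# ≤ x → 0# ≤ v → x ≤ y → u ≤ v → x * u ≤ y * v
  *-mono-≤ 0≤x 0≤v x≤y u≤v = ≤-trans (*-monoˡ-≤ 0≤x u≤v) (*-monoʳ-≤ 0≤v x≤y)

  ∣x∣²≈x² : ∀ x → ∣ x ∣ * ∣ x ∣ ≈ x * x
  ∣x∣²≈x² x = trans (sym (∣x*y∣≈ x x)) (0≤x⇒∣x∣≈x (0≤x² x))

  -- The gap is (x - y)². Writing x = y + e turns the equality into one of semirings, without
  -- subtraction.
  [x+y]²≤2[x²+y²] : ∀ x y → (x + y) * (x + y) ≤ (x * x + y * y) + (x * x + y * y)
  [x+y]²≤2[x²+y²] x y = begin
    (x + y) * (x + y)                         ≲⟨ x≤x+y (0≤x² e) ⟩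
    (x + y) * (x + y) + e * e                 ≈⟨ +-congʳ (*-cong (+-congʳ x≈) (+-congʳ x≈)) ⟩
    (y + e + y) * (y + e + y) + e * e
      ≈⟨ solve 2 (λ y e → (y :+ e :+ y) :* (y :+ e :+ y) :+ e :* e :=
           ((y :+ e) :* (y :+ e) :+ y :* y) :+ ((y :+ e) :* (y :+ e) :+ y :* y)) refl y e ⟩
    ((y + e) * (y + e) + y * y) + ((y + e) * (y + e) + y * y)
      ≈⟨ sym (+-cong (+-congʳ (*-cong x≈ x≈)) (+-congʳ (*-cong x≈ x≈))) ⟩
    (x * x + y * y) + (x * x + y * y)         ∎
    where
    e = x + - y
    x≈ : x ≈ y + e
    x≈ = trans (sym (+-identityˡ x)) (trans (+-congʳ (sym (-‿inverseʳ y)))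
      (solve 3 (λ x y m → y :+ m :+ x := y :+ (x :+ m)) refl x y (- y)))

  4x≈ : ∀ x → ((1# + 1#) + (1# + 1#)) * x ≈ x + x + (x + x)
  4x≈ x = solve 1 (λ x → ((con 1 :+ con 1) :+ (con 1 :+ con 1)) :* x := x :+ x :+ (x :+ x)) refl x

  2x≈ : ∀ x → x * (1# + 1#) ≈ x + x
  2x≈ x = solve 1 (λ x → x :* (con 1 :+ con 1) := x :+ x) refl x

  -- The arithmetic of one shrinking step in `contraction-vanishes`, where `k` is a multiple of η:
  -- the sum is at most 5η + k, hence at most 6η + 2k.
  halving-bound : ∀ {u v} η k → u ≤ η + η + η + (η + k) → v ≤ η → 0# ≤ η → 0# ≤ k →
                  u + v ≤ (η + η + η + k) + (η + η + η + k)
  halving-bound {u} {v} η k u≤ v≤η 0≤η 0≤k = begin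
    u + v                                     ≲⟨ +-mono-≤ u≤ v≤η ⟩
    η + η + η + (η + k) + η                   ≲⟨ x≤x+y (0≤x+y 0≤η 0≤k) ⟩
    η + η + η + (η + k) + η + (η + k)
      ≈⟨ solve 2 (λ η k → η :+ η :+ η :+ (η :+ k) :+ η :+ (η :+ k) :=
           (η :+ η :+ η :+ k) :+ (η :+ η :+ η :+ k)) refl η k ⟩
    (η + η + η + k) + (η + η + η + k)         ∎

record Norm {c ℓ p} {K : CommutativeRing c ℓ} (A : AbsoluteValue K p) {r s} (R : CommutativeRing r s) :
            Set (c ⊔ ℓ ⊔ p ⊔ r ⊔ s) where
  private
    module K = CommutativeRing K
    module A = AbsoluteValue A
  open CommutativeRing R
  field
    ‖_‖     : Carrier → K.Carrier
    ‖‖-cong : ∀ {x y} → x ≈ y → ‖ x ‖ K.≈ ‖ y ‖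
    0≤‖x‖   : ∀ x → K.0# A.≤ ‖ x ‖
    ‖x+y‖≤  : ∀ x y → ‖ x + y ‖ A.≤ ‖ x ‖ K.+ ‖ y ‖
    ‖x*y‖≤  : ∀ x y → ‖ x * y ‖ A.≤ ‖ x ‖ K.* ‖ y ‖
    ‖-x‖≈   : ∀ x → ‖ - x ‖ K.≈ ‖ x ‖
    ‖0‖≈0   : ‖ 0# ‖ K.≈ K.0#
    ‖1‖≈1   : ‖ 1# ‖ K.≈ K.1#

  open Mult semiring using () renaming (_×_ to _·_)
  open Mult K.semiring using () renaming (_×_ to _·ᴷ_)

  ‖+‖-mono : ∀ {x y a b} → ‖ x ‖ A.≤ a → ‖ y ‖ A.≤ b → ‖ x + y ‖ A.≤ a K.+ b
  ‖+‖-mono x≤a y≤b = A.≤-trans (‖x+y‖≤ _ _) (A.+-mono-≤ x≤a y≤b)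

  ‖*‖-mono : ∀ {x y a b} → ‖ x ‖ A.≤ a → ‖ y ‖ A.≤ b → ‖ x * y ‖ A.≤ a K.* b
  ‖*‖-mono x≤a y≤b = A.≤-trans (‖x*y‖≤ _ _)
    (A.*-mono-≤ (0≤‖x‖ _) (A.≤-trans (0≤‖x‖ _) y≤b) x≤a y≤b)

  ‖n‖≤n : ∀ n → ‖ n · 1# ‖ A.≤ n ·ᴷ K.1#
  ‖n‖≤n zero    = A.≤-reflexive ‖0‖≈0
  ‖n‖≤n (suc n) = ‖+‖-mono (A.≤-reflexive ‖1‖≈1) (‖n‖≤n n)

  0≤n : ∀ n → K.0# A.≤ n ·ᴷ K.1#
  0≤n n = A.≤-trans (0≤‖x‖ _) (‖n‖≤n n)

-- The ℓ¹ norm: submultiplicative, and rational on Gaussian rationals.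
module _ {c ℓ p} {K : CommutativeRing c ℓ} (A : AbsoluteValue K p) where
  open CommutativeRing K
  open AbsoluteValue A
  open AdjoinI K
  open NaturalCoefficients commutativeSemiring using (solve; _:+_; _:*_; _:=_)
  open RingProperties ring using (-‿distribʳ-*)

  infix 10 ∥_∥₁

  ∥_∥₁ : R[i] → Carrier
  ∥ z ∥₁ = ∣ re z ∣ + ∣ im z ∣

  norm₁ : Norm A R[i]-commutativeRing
  norm₁ = record
    { ‖_‖     = ∥_∥₁
    ; ‖‖-cong = λ (p , q) → +-cong (∣∣-cong p) (∣∣-cong q)
    ; 0≤‖x‖   = λ z → 0≤x+y (0≤∣x∣ (re z)) (0≤∣x∣ (im z))
    ; ‖x+y‖≤  = λ z w → ≤-trans (+-mono-≤ (∣x+y∣≤ (re z) (re w)) (∣x+y∣≤ (im z) (im w)))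
        (≤-reflexive (solve 4 (λ a b c d → (a :+ c) :+ (b :+ d) := (a :+ b) :+ (c :+ d)) refl _ _ _ _))
    ; ‖x*y‖≤  = λ (a +i b) (c +i d) → begin
        ∣ a * c + - (b * d) ∣ + ∣ a * d + b * c ∣
          ≲⟨ +-mono-≤ (∣x+y∣≤ _ _) (∣x+y∣≤ _ _) ⟩
        (∣ a * c ∣ + ∣ - (b * d) ∣) + (∣ a * d ∣ + ∣ b * c ∣)
          ≈⟨ +-cong (+-cong (∣x*y∣≈ a c) (trans (∣-x∣≈ _) (∣x*y∣≈ b d))) (+-cong (∣x*y∣≈ a d) (∣x*y∣≈ b c)) ⟩
        (∣ a ∣ * ∣ c ∣ + ∣ b ∣ * ∣ d ∣) + (∣ a ∣ * ∣ d ∣ + ∣ b ∣ * ∣ c ∣)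
          ≈⟨ solve 4 (λ a b c d → (a :* c :+ b :* d) :+ (a :* d :+ b :* c) := (a :+ b) :* (c :+ d)) refl _ _ _ _ ⟩
        (∣ a ∣ + ∣ b ∣) * (∣ c ∣ + ∣ d ∣) ∎
    ; ‖-x‖≈   = λ z → +-cong (∣-x∣≈ (re z)) (∣-x∣≈ (im z))
    ; ‖0‖≈0   = trans (+-cong ∣0∣≈0 ∣0∣≈0) (+-identityˡ 0#)
    ; ‖1‖≈1   = trans (+-cong (0≤x⇒∣x∣≈x 0≤1) ∣0∣≈0) (+-identityʳ 1#)
    }
    where
    open PreorderReasoning preorder
    ∣0∣≈0 : ∣ 0# ∣ ≈ 0#
    ∣0∣≈0 = 0≤x⇒∣x∣≈x ≤-refl

  ∣z∣² : R[i] → Carrier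
  ∣z∣² (a +i b) = a * a + b * b

  ∥z∥₁²≤2∣z∣² : ∀ z → ∥ z ∥₁ * ∥ z ∥₁ ≤ ∣z∣² z + ∣z∣² z
  ∥z∥₁²≤2∣z∣² (a +i b) = ≤-trans ([x+y]²≤2[x²+y²] ∣ a ∣ ∣ b ∣)
    (≤-reflexive (+-cong ∣z∣²≈ ∣z∣²≈))
    where ∣z∣²≈ = +-cong (∣x∣²≈x² a) (∣x∣²≈x² b)

  -- With n = 1/(a² + b²) the witness is the conjugate of z times n. Its norm is n times that of z,
  -- so the bound 2 comes from comparing the squared ℓ¹ norm with a² + b².
  inverse : ∀ z n → ∣z∣² z * n ≈ 1# → 0# ≤ n →
            Σ[ w ∈ R[i] ] ((z *ᵢ w) ≈ᵢ (1# +i 0#)) × ∥ z ∥₁ * ∥ w ∥₁ ≤ 1# + 1#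
  inverse z@(a +i b) n Nn≈1 0≤n = (a * n +i - (b * n)) , (re-part , im-part) , bound
    where
    open RingProperties ring using (-‿involutive)
    re-part : a * (a * n) + - (b * - (b * n)) ≈ 1#
    re-part = trans (+-congˡ (trans (-‿cong (sym (-‿distribʳ-* b (b * n)))) (-‿involutive _)))
      (trans (solve 3 (λ a b n → a :* (a :* n) :+ b :* (b :* n) := (a :* a :+ b :* b) :* n) refl a b n) Nn≈1)
    im-part : a * - (b * n) + b * (a * n) ≈ 0#
    im-part = trans (+-cong (sym (-‿distribʳ-* a (b * n)))
      (solve 3 (λ a b n → b :* (a :* n) := a :* (b :* n)) refl a b n)) (-‿inverseˡ _)
    bound : ∥ z ∥₁ * (∣ a * n ∣ + ∣ - (b * n) ∣) ≤ 1# + 1#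
    bound = begin
      ∥ z ∥₁ * (∣ a * n ∣ + ∣ - (b * n) ∣)
        ≈⟨ *-congˡ (+-cong (∣x*n∣≈ a) (trans (∣-x∣≈ _) (∣x*n∣≈ b))) ⟩
      ∥ z ∥₁ * (∣ a ∣ * n + ∣ b ∣ * n)
        ≈⟨ solve 3 (λ a b n → (a :+ b) :* (a :* n :+ b :* n) := ((a :+ b) :* (a :+ b)) :* n) refl _ _ n ⟩
      ∥ z ∥₁ * ∥ z ∥₁ * n                ≲⟨ *-monoʳ-≤ 0≤n (∥z∥₁²≤2∣z∣² z) ⟩
      (∣z∣² z + ∣z∣² z) * n              ≈⟨ trans (distribʳ n _ _) (+-cong Nn≈1 Nn≈1) ⟩
      1# + 1#                            ∎
      where
      open PreorderReasoning preorder
      ∣x*n∣≈ : ∀ x → ∣ x * n ∣ ≈ ∣ x ∣ * n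
      ∣x*n∣≈ x = trans (∣x*y∣≈ x n) (*-congˡ (0≤x⇒∣x∣≈x 0≤n))

-- (1 + y)ᵈ = 1 + d y + rest d y, where rest d is a contraction near 0.
module BinomialRest {c ℓ p r s} {K : CommutativeRing c ℓ} {A : AbsoluteValue K p}
                    {R : CommutativeRing r s} (norm : Norm A R) where
  private
    module K = CommutativeRing K
    module A = AbsoluteValue A
  open CommutativeRing R hiding (zero)
  open NaturalCoefficients K.commutativeSemiring using ()
    renaming (solve to solveᴷ; _:+_ to _⊞_; _:*_ to _⊠_; _:=_ to _⊜_; con to conᴷ)
  open Norm norm
  open RawSemiringOps (Semiring.rawSemiring semiring) using (_^_)
  open Mult semiring using () renaming (_×_ to _·_)
  open Mult K.semiring using () renaming (_×_ to _·ᴷ_)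
  open NaturalCoefficients commutativeSemiring using (solve; _:+_; _:*_; _:=_; con)

  rest : ℕ → Carrier → Carrier
  rest zero    y = 0#
  rest (suc d) y = (1# + y) * rest d y + (d · 1#) * (y * y)

  rest-cong : ∀ d {y z} → y ≈ z → rest d y ≈ rest d z
  rest-cong zero    y≈z = refl
  rest-cong (suc d) y≈z = +-cong (*-cong (+-congˡ y≈z) (rest-cong d y≈z)) (*-congˡ (*-cong y≈z y≈z))

  [1+y]^d : ∀ d y → (1# + y) ^ d ≈ 1# + ((d · 1#) * y + rest d y)
  [1+y]^d zero    y = sym (trans (+-congˡ (trans (+-identityʳ _) (zeroˡ y))) (+-identityʳ 1#))
  [1+y]^d (suc d) y = trans (*-congˡ ([1+y]^d d y))
    (solve 3 (λ y d q → (con 1 :+ y) :* (con 1 :+ (d :* y :+ q)) :=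
                        con 1 :+ ((con 1 :+ d) :* y :+ ((con 1 :+ y) :* q :+ d :* (y :* y))))
      refl y (d · 1#) (rest d y))

  -- The increment of `rest d` from y to y + e, with a factor `e` in every summand, as a Lipschitz
  -- estimate needs. The last summand is due to (y + e)² = y² + e((y + e) + y).
  restStep : ℕ → Carrier → Carrier → Carrier
  restStep zero    y e = 0#
  restStep (suc d) y e =
    (1# + (y + e)) * restStep d y e + (e * rest d y + (d · 1#) * (e * ((y + e) + y)))

  rest-+ : ∀ d y e → rest d (y + e) ≈ rest d y + restStep d y e
  rest-+ zero    y e = sym (+-identityʳ 0#)
  rest-+ (suc d) y e = trans (+-congʳ (*-congˡ (rest-+ d y e)))
    (solve 5 (λ y e d q s →
        (con 1 :+ (y :+ e)) :* (q :+ s) :+ d :* ((y :+ e) :* (y :+ e)) :=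
        ((con 1 :+ y) :* q :+ d :* (y :* y)) :+
        ((con 1 :+ (y :+ e)) :* s :+ (e :* q :+ d :* (e :* ((y :+ e) :+ y)))))
      refl y e (d · 1#) (rest d y) (restStep d y e))

  -- The recurrence b ↦ 3b + 2d is read off from `restStep` on a ball of radius ρ ≤ 1: 2b because 1
  -- + (y + e) has norm at most 2, b from `e * rest d y`, and 2d from the last summand.
  restBound : ℕ → K.Carrier
  restBound zero    = K.0#
  restBound (suc d) = let b = restBound d in
    (b K.+ b K.+ b) K.+ (d ·ᴷ K.1# K.+ d ·ᴷ K.1#)

  0≤restBound : ∀ d → K.0# A.≤ restBound d
  0≤restBound zero    = A.≤-refl
  0≤restBound (suc d) = A.0≤x+y (A.0≤x+y (A.0≤x+y 0≤b 0≤b) 0≤b) (A.0≤x+y (0≤n d) (0≤n d))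
    where 0≤b = 0≤restBound d

  module _ {ρ} (0≤ρ : K.0# A.≤ ρ) (ρ≤1 : ρ A.≤ K.1#) where
    open PreorderReasoning A.preorder

    ‖1+y‖≤2 : ∀ {y} → ‖ y ‖ A.≤ ρ → ‖ 1# + y ‖ A.≤ K.1# K.+ K.1#
    ‖1+y‖≤2 y≤ρ = ‖+‖-mono (A.≤-reflexive ‖1‖≈1) (A.≤-trans y≤ρ ρ≤1)

    ‖rest‖≤ : ∀ d {y} → ‖ y ‖ A.≤ ρ → ‖ rest d y ‖ A.≤ restBound d K.* ρ
    ‖rest‖≤ zero    y≤ρ = A.≤-reflexive (K.trans ‖0‖≈0 (K.sym (K.zeroˡ ρ)))
    ‖rest‖≤ (suc d) {y} y≤ρ = begin
      ‖ (1# + y) * rest d y + (d · 1#) * (y * y) ‖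
        ≲⟨ ‖+‖-mono (‖*‖-mono (‖1+y‖≤2 y≤ρ) (‖rest‖≤ d y≤ρ))
             (‖*‖-mono (‖n‖≤n d) (‖*‖-mono (A.≤-trans y≤ρ ρ≤1) y≤ρ)) ⟩
      (K.1# K.+ K.1#) K.* (b K.* ρ) K.+ n K.* (K.1# K.* ρ)
        -- The estimate so far has the factor 2b + d; it is raised to 3b + 2d, so that `rest` and
        -- `restStep` share one constant.
        ≲⟨ A.x≤x+y (A.0≤x*y (A.0≤x+y (0≤restBound d) (0≤n d)) 0≤ρ) ⟩
      ((K.1# K.+ K.1#) K.* (b K.* ρ) K.+ n K.* (K.1# K.* ρ)) K.+ (b K.+ n) K.* ρ
        ≈⟨ solveᴷ 3 (λ b n ρ → ((conᴷ 1 ⊞ conᴷ 1) ⊠ (b ⊠ ρ) ⊞ n ⊠ (conᴷ 1 ⊠ ρ)) ⊞ (b ⊞ n) ⊠ ρ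
             ⊜ ((b ⊞ b ⊞ b) ⊞ (n ⊞ n)) ⊠ ρ) K.refl b n ρ ⟩
      restBound (suc d) K.* ρ ∎
      where
      b = restBound d
      n = d ·ᴷ K.1#

    ‖restStep‖≤ : ∀ d {y e} → ‖ y ‖ A.≤ ρ → ‖ y + e ‖ A.≤ ρ →
                  ‖ restStep d y e ‖ A.≤ restBound d K.* (ρ K.* ‖ e ‖)
    ‖restStep‖≤ zero    y≤ρ y+e≤ρ = A.≤-reflexive (K.trans ‖0‖≈0 (K.sym (K.zeroˡ _)))
    ‖restStep‖≤ (suc d) {y} {e} y≤ρ y+e≤ρ = begin
      ‖ (1# + (y + e)) * restStep d y e + (e * rest d y + (d · 1#) * (e * ((y + e) + y))) ‖
        ≲⟨ ‖+‖-mono (‖*‖-mono (‖1+y‖≤2 y+e≤ρ) (‖restStep‖≤ d y≤ρ y+e≤ρ))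
             (‖+‖-mono (‖*‖-mono A.≤-refl (‖rest‖≤ d y≤ρ))
               (‖*‖-mono (‖n‖≤n d) (‖*‖-mono A.≤-refl (‖+‖-mono y+e≤ρ y≤ρ)))) ⟩
      (K.1# K.+ K.1#) K.* (b K.* (ρ K.* ε)) K.+ (ε K.* (b K.* ρ) K.+ n K.* (ε K.* (ρ K.+ ρ)))
        ≈⟨ solveᴷ 4 (λ b n ρ ε → (conᴷ 1 ⊞ conᴷ 1) ⊠ (b ⊠ (ρ ⊠ ε)) ⊞ (ε ⊠ (b ⊠ ρ) ⊞ n ⊠ (ε ⊠ (ρ ⊞ ρ)))
             ⊜ ((b ⊞ b ⊞ b) ⊞ (n ⊞ n)) ⊠ (ρ ⊠ ε)) K.refl b n ρ ε ⟩
      restBound (suc d) K.* (ρ K.* ε) ∎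
      where
      b = restBound d
      n = d ·ᴷ K.1#
      ε = ‖ e ‖

    -- Since `rest d` vanishes at 0, its value at y is an increment from 0, and the Lipschitz
    -- estimate yields a second factor ρ. This is what lets `rootStep` map a small ball into itself.
    ‖rest‖≤ρ² : ∀ d {y} → ‖ y ‖ A.≤ ρ → ‖ rest d y ‖ A.≤ restBound d K.* (ρ K.* ρ)
    ‖rest‖≤ρ² d {y} y≤ρ = begin
      ‖ rest d y ‖                         ≈⟨ ‖‖-cong (rest≈restStep d y) ⟩
      ‖ restStep d 0# y ‖                  ≲⟨ ‖restStep‖≤ d (A.≤-trans (A.≤-reflexive ‖0‖≈0) 0≤ρ)
                                                (A.≤-trans (A.≤-reflexive (‖‖-cong (+-identityˡ y))) y≤ρ) ⟩
      restBound d K.* (ρ K.* ‖ y ‖)        ≲⟨ A.*-monoˡ-≤ (0≤restBound d) (A.*-monoˡ-≤ 0≤ρ y≤ρ) ⟩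
      restBound d K.* (ρ K.* ρ)            ∎
      where
      rest-0 : ∀ d → rest d 0# ≈ 0#
      rest-0 zero    = refl
      rest-0 (suc d) = trans (+-cong (trans (*-congˡ (rest-0 d)) (zeroʳ _))
        (trans (*-congˡ (zeroʳ _)) (zeroʳ _))) (+-identityʳ 0#)
      rest≈restStep : ∀ d y → rest d y ≈ restStep d 0# y
      rest≈restStep d y = trans (rest-cong d (sym (+-identityˡ y)))
        (trans (rest-+ d 0# y) (trans (+-congʳ (rest-0 d)) (+-identityˡ _)))

-- Both equations are solved by iterating a contraction in y.
module LocalEquations {c ℓ p r s} {K : CommutativeRing c ℓ} {A : AbsoluteValue K p}
                      {R : CommutativeRing r s} (norm : Norm A R) where
  private
    module K = CommutativeRing K
    module A = AbsoluteValue A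
  open CommutativeRing R hiding (zero)
  open NaturalCoefficients K.commutativeSemiring using ()
    renaming (solve to solveᴷ; _:+_ to _⊞_; _:*_ to _⊠_; _:=_ to _⊜_; con to conᴷ)
  open Norm norm
  open BinomialRest norm
  open RawSemiringOps (Semiring.rawSemiring semiring) using (_^_)
  open Mult semiring using () renaming (_×_ to _·_)
  open NaturalCoefficients commutativeSemiring using (solve; _:+_; _:*_; _:=_; con)
  open RingProperties ring using (-‿distribʳ-*; -‿+-comm; -‿involutive)
  open PreorderReasoning A.preorder

  open Exp semiring using (^-congˡ)

  dist : Carrier → Carrier → K.Carrier
  dist x y = ‖ x + - y ‖

  ≈+difference : ∀ x y → x ≈ y + (x + - y)
  ≈+difference x y = trans (sym (+-identityˡ x)) (trans (+-congʳ (sym (-‿inverseʳ y)))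
    (solve 3 (λ x y m → y :+ m :+ x := y :+ (x :+ m)) refl x y (- y)))

  difference : ∀ {x y z} → x ≈ y + z → x + - y ≈ z
  difference {x} {y} {z} x≈y+z = trans (+-congʳ x≈y+z)
    (trans (solve 3 (λ y z m → y :+ z :+ m := (y :+ m) :+ z) refl y z (- y))
      (trans (+-congʳ (-‿inverseʳ y)) (+-identityˡ z)))

  dist-shift : ∀ x y t → dist x y K.≈ dist (x + - t) (y + - t)
  dist-shift x y t = ‖‖-cong $ sym $ difference (trans (+-congʳ (≈+difference x y))
    (solve 3 (λ y e m → y :+ e :+ m := (y :+ m) :+ e) refl y (x + - y) (- t)))

  dist-triangle : ∀ x y → dist x 0# A.≤ dist x y K.+ ‖ y ‖
  dist-triangle x y = A.≤-trans (A.≤-reflexive (‖‖-cong (difference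
    (trans (≈+difference x y) (trans (+-comm _ _) (sym (+-identityˡ _))))))) (‖x+y‖≤ _ _)

  dist-quotient : ∀ x {y z} → y * z ≈ 1# → dist (x * z) 1# A.≤ dist x y K.* ‖ z ‖
  dist-quotient x {y} {z} yz≈1 = A.≤-trans (A.≤-reflexive (‖‖-cong (difference
    (trans (*-congʳ (≈+difference x y)) (trans (distribʳ z y _) (+-congʳ yz≈1)))))) (‖x*y‖≤ _ _)

  dist-1+x : ∀ x → dist (1# + x) 1# K.≈ ‖ x ‖
  dist-1+x x = ‖‖-cong (difference refl)

  4K : K.Carrier
  4K = (K.1# K.+ K.1#) K.+ (K.1# K.+ K.1#)

  -- A fixed point y satisfies (1 + a)(1 + y) = 1.
  inverseStep : Carrier → Carrier → Carrier
  inverseStep a y = - (a * (1# + y))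

  inverseStep-solves : ∀ a y → (1# + a) * (1# + y) ≈ 1# + (y + - inverseStep a y)
  inverseStep-solves a y = trans
    (solve 2 (λ a y → (con 1 :+ a) :* (con 1 :+ y) := con 1 :+ (y :+ a :* (con 1 :+ y))) refl a y)
    (+-congˡ (+-congˡ (sym (-‿involutive _))))

  -- The failure of 1 + y to invert c is exactly the failure of y to be fixed, so vanishing
  -- residuals give an inverse in the limit.
  inverseStep-residual : ∀ c y → dist (c * (1# + y)) 1# K.≈ ‖ y + - inverseStep (c + - 1#) y ‖
  inverseStep-residual c y = ‖‖-cong (difference
    (trans (*-congʳ (≈+difference c 1#)) (inverseStep-solves (c + - 1#) y)))

  ‖1+y‖≤2′ : ∀ {y} → ‖ y ‖ A.≤ K.1# → ‖ 1# + y ‖ A.≤ K.1# K.+ K.1#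
  ‖1+y‖≤2′ = ‖1+y‖≤2 A.0≤1 A.≤-refl

  module _ {h} (2h≤1 : h K.+ h A.≤ K.1#) where

    inverseStep-ball : ∀ a y → ‖ a ‖ A.≤ h → ‖ y ‖ A.≤ K.1# → ‖ inverseStep a y ‖ A.≤ K.1#
    inverseStep-ball a y a≤h y≤1 = begin
      ‖ - (a * (1# + y)) ‖      ≈⟨ ‖-x‖≈ _ ⟩
      ‖ a * (1# + y) ‖          ≲⟨ ‖*‖-mono a≤h (‖1+y‖≤2′ y≤1) ⟩
      h K.* (K.1# K.+ K.1#)     ≈⟨ solveᴷ 1 (λ h → h ⊠ (conᴷ 1 ⊞ conᴷ 1) ⊜ h ⊞ h) K.refl h ⟩
      h K.+ h                   ≲⟨ 2h≤1 ⟩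
      K.1#                      ∎

    -- The term in `dist a b` is present because two iterates are computed from different
    -- approximations of one number. Its factor 4 is the doubling times the bound 2 for 1 + z.
    inverseStep-contracts : ∀ a b y z → ‖ a ‖ A.≤ h → ‖ z ‖ A.≤ K.1# →
      dist (inverseStep a y) (inverseStep b z) K.+ dist (inverseStep a y) (inverseStep b z) A.≤
      dist y z K.+ 4K K.* dist a b
    inverseStep-contracts a b y z a≤h z≤1 = begin
      dist (inverseStep a y) (inverseStep b z) K.+ dist (inverseStep a y) (inverseStep b z)
        ≲⟨ A.+-mono-≤ half half ⟩
      (h K.* ‖ e ‖ K.+ ‖ f ‖ K.* (K.1# K.+ K.1#)) K.+ (h K.* ‖ e ‖ K.+ ‖ f ‖ K.* (K.1# K.+ K.1#))
        ≈⟨ solveᴷ 3 (λ h e f → let g = h ⊠ e ⊞ f ⊠ (conᴷ 1 ⊞ conᴷ 1) in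
             g ⊞ g ⊜ (h ⊞ h) ⊠ e ⊞ ((conᴷ 1 ⊞ conᴷ 1) ⊞ (conᴷ 1 ⊞ conᴷ 1)) ⊠ f) K.refl h (‖ e ‖) (‖ f ‖) ⟩
      (h K.+ h) K.* ‖ e ‖ K.+ 4K K.* ‖ f ‖
        ≲⟨ A.+-mono-≤ (A.*-monoʳ-≤ (0≤‖x‖ e) 2h≤1) A.≤-refl ⟩
      K.1# K.* ‖ e ‖ K.+ 4K K.* ‖ f ‖
        ≈⟨ K.+-congʳ (K.*-identityˡ _) ⟩
      dist y z K.+ 4K K.* dist a b ∎
      where
      e = y + - z
      f = a + - b
      step≈ : inverseStep a y ≈ inverseStep b z + - (a * e + f * (1# + z))
      step≈ = trans (-‿cong (trans (*-congˡ (+-congˡ (≈+difference y z)))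
        (trans (*-congʳ (≈+difference a b))
        (trans (solve 4 (λ b f z e → (b :+ f) :* (con 1 :+ (z :+ e)) :=
                  b :* (con 1 :+ z) :+ ((b :+ f) :* e :+ f :* (con 1 :+ z))) refl b f z e)
          (+-congˡ (+-congʳ (*-congʳ (sym (≈+difference a b)))))))))
        (sym (-‿+-comm _ _))
      half : dist (inverseStep a y) (inverseStep b z) A.≤ h K.* ‖ e ‖ K.+ ‖ f ‖ K.* (K.1# K.+ K.1#)
      half = A.≤-trans (A.≤-reflexive (K.trans (‖‖-cong (difference step≈)) (‖-x‖≈ _)))
        (‖+‖-mono (‖*‖-mono a≤h A.≤-refl) (‖*‖-mono A.≤-refl (‖1+y‖≤2′ z≤1)))

  -- With k = 1/d this is the equation d y + rest d y = a, solved for its linear term; a fixed point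
  -- y satisfies (1 + y)ᵈ = 1 + a.
  rootStep : ℕ → Carrier → Carrier → Carrier → Carrier
  rootStep d k a y = k * (a + - rest d y)

  rootStep-solves : ∀ d {k} → (d · 1#) * k ≈ 1# → ∀ a y →
    (1# + y) ^ d ≈ (1# + a) + (d · 1#) * (y + - rootStep d k a y)
  rootStep-solves d {k} dk≈1 a y = sym (trans (+-congˡ expand) (trans
    (solve 5 (λ a a⁻ n y q → (con 1 :+ a) :+ (n :* y :+ (a⁻ :+ q)) := (a :+ a⁻) :+ (con 1 :+ (n :* y :+ q)))
      refl a (- a) n y q)
    (trans (+-congʳ (-‿inverseʳ a)) (trans (+-identityˡ _) (sym ([1+y]^d d y))))))
    where
    n = d · 1#
    q = rest d y
    expand : n * (y + - (k * (a + - q))) ≈ n * y + (- a + q)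
    expand = trans (distribˡ n y _) (+-congˡ (trans (sym (-‿distribʳ-* n _))
      (trans (-‿cong (trans (sym (*-assoc n k _)) (trans (*-congʳ dk≈1) (*-identityˡ _))))
        (trans (sym (-‿+-comm a (- q))) (+-congˡ (-‿involutive q))))))

  rootStep-residual : ∀ d {k} → (d · 1#) * k ≈ 1# → ∀ c x y → x ≈ 1# + y →
    dist (x ^ d) c A.≤ ‖ d · 1# ‖ K.* ‖ y + - rootStep d k (c + - 1#) y ‖
  rootStep-residual d dk≈1 c x y x≈1+y = A.≤-trans
    (A.≤-reflexive (‖‖-cong (difference (trans (^-congˡ d x≈1+y) (trans (rootStep-solves d dk≈1 (c + - 1#) y)
      (+-congʳ (sym (≈+difference c 1#))))))))
    (‖x*y‖≤ _ _)

  module _ (d : ℕ) {k ρ δ} (k≤2 : ‖ k ‖ A.≤ K.1# K.+ K.1#) (0≤ρ : K.0# A.≤ ρ) (ρ≤1 : ρ A.≤ K.1#)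
           (small : 4K K.* (restBound d K.* ρ) A.≤ K.1#) (4δ≤ρ : 4K K.* δ A.≤ ρ) where

    -- After doubling, `a` contributes 4δ and `rest` contributes 4Bρ · ρ, where B is `restBound d`;
    -- each is at most ρ. The 4 is the doubling times the bound 2 for k.
    rootStep-ball : ∀ a y → ‖ a ‖ A.≤ δ → ‖ y ‖ A.≤ ρ → ‖ rootStep d k a y ‖ A.≤ ρ
    rootStep-ball a y a≤δ y≤ρ = A.halve (begin
      ‖ rootStep d k a y ‖ K.+ ‖ rootStep d k a y ‖ ≲⟨ A.+-mono-≤ half half ⟩
      (K.1# K.+ K.1#) K.* (δ K.+ b K.* (ρ K.* ρ)) K.+ (K.1# K.+ K.1#) K.* (δ K.+ b K.* (ρ K.* ρ))
        ≈⟨ solveᴷ 3 (λ δ b ρ → let g = (conᴷ 1 ⊞ conᴷ 1) ⊠ (δ ⊞ b ⊠ (ρ ⊠ ρ)) in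
             g ⊞ g ⊜ ((conᴷ 1 ⊞ conᴷ 1) ⊞ (conᴷ 1 ⊞ conᴷ 1)) ⊠ δ ⊞
               (((conᴷ 1 ⊞ conᴷ 1) ⊞ (conᴷ 1 ⊞ conᴷ 1)) ⊠ (b ⊠ ρ)) ⊠ ρ) K.refl δ b ρ ⟩
      4K K.* δ K.+ (4K K.* (b K.* ρ)) K.* ρ         ≲⟨ A.+-mono-≤ 4δ≤ρ (A.*-monoʳ-≤ 0≤ρ small) ⟩
      ρ K.+ K.1# K.* ρ                              ≈⟨ K.+-congˡ (K.*-identityˡ ρ) ⟩
      ρ K.+ ρ                                       ∎)
      where
      b = restBound d
      half : ‖ rootStep d k a y ‖ A.≤ (K.1# K.+ K.1#) K.* (δ K.+ b K.* (ρ K.* ρ))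
      half = ‖*‖-mono k≤2 (‖+‖-mono a≤δ (A.≤-trans (A.≤-reflexive (‖-x‖≈ _)) (‖rest‖≤ρ² 0≤ρ ρ≤1 d y≤ρ)))

    rootStep-contracts : ∀ a b y z → ‖ y ‖ A.≤ ρ → ‖ z ‖ A.≤ ρ →
      dist (rootStep d k a y) (rootStep d k b z) K.+ dist (rootStep d k a y) (rootStep d k b z) A.≤
      dist y z K.+ 4K K.* dist a b
    rootStep-contracts a b y z y≤ρ z≤ρ = begin
      dist (rootStep d k a y) (rootStep d k b z) K.+ dist (rootStep d k a y) (rootStep d k b z)
        ≲⟨ A.+-mono-≤ half half ⟩
      (K.1# K.+ K.1#) K.* (‖ f ‖ K.+ B K.* (ρ K.* ‖ e ‖)) K.+ (K.1# K.+ K.1#) K.* (‖ f ‖ K.+ B K.* (ρ K.* ‖ e ‖))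
        ≈⟨ solveᴷ 4 (λ f B ρ e → let g = (conᴷ 1 ⊞ conᴷ 1) ⊠ (f ⊞ B ⊠ (ρ ⊠ e)) in
             g ⊞ g ⊜ (((conᴷ 1 ⊞ conᴷ 1) ⊞ (conᴷ 1 ⊞ conᴷ 1)) ⊠ (B ⊠ ρ)) ⊠ e ⊞
               ((conᴷ 1 ⊞ conᴷ 1) ⊞ (conᴷ 1 ⊞ conᴷ 1)) ⊠ f) K.refl (‖ f ‖) B ρ (‖ e ‖) ⟩
      (4K K.* (B K.* ρ)) K.* ‖ e ‖ K.+ 4K K.* ‖ f ‖
        ≲⟨ A.+-mono-≤ (A.*-monoʳ-≤ (0≤‖x‖ e) small) A.≤-refl ⟩
      K.1# K.* ‖ e ‖ K.+ 4K K.* ‖ f ‖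
        ≈⟨ K.+-congʳ (K.*-identityˡ _) ⟩
      dist y z K.+ 4K K.* dist a b ∎
      where
      B = restBound d
      e = y + - z
      f = a + - b
      y≈ = ≈+difference y z
      step≈ : rootStep d k a y ≈ rootStep d k b z + k * (f + - restStep d z e)
      step≈ = trans (*-congˡ (trans (+-cong (≈+difference a b)
          (trans (-‿cong (trans (rest-cong d y≈) (rest-+ d z e))) (sym (-‿+-comm _ _))))
        (solve 4 (λ b f q s → (b :+ f) :+ (q :+ s) := (b :+ q) :+ (f :+ s)) refl b f (- rest d z) (- restStep d z e))))
        (distribˡ k _ _)
      half : dist (rootStep d k a y) (rootStep d k b z) A.≤
             (K.1# K.+ K.1#) K.* (‖ f ‖ K.+ B K.* (ρ K.* ‖ e ‖))
      half = A.≤-trans (A.≤-reflexive (‖‖-cong (difference step≈)))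
        (‖*‖-mono k≤2 (‖+‖-mono A.≤-refl (A.≤-trans (A.≤-reflexive (‖-x‖≈ _))
          (‖restStep‖≤ 0≤ρ ρ≤1 d z≤ρ (A.≤-trans (A.≤-reflexive (‖‖-cong (sym y≈))) y≤ρ)))))

-- The multiplicative group of d-th powers

module Powers {a b c ℓ} (P : CommutativeRing a b) (Q : CommutativeRing c ℓ)
  (ι : CommutativeRing.Carrier P → CommutativeRing.Carrier Q)
  (ι-cong : ∀ {x y} → CommutativeRing._≈_ P x y → CommutativeRing._≈_ Q (ι x) (ι y))
  (ι-1 : CommutativeRing._≈_ Q (ι (CommutativeRing.1# P)) (CommutativeRing.1# Q))
  (ι-* : ∀ x y → CommutativeRing._≈_ Q (ι (CommutativeRing._*_ P x y)) (CommutativeRing._*_ Q (ι x) (ι y)))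
  (e : ℕ) where
  private
    d = suc e
    module Q = CommutativeRing Q
  open CommutativeRing P hiding (zero)
  open RawSemiringOps (Semiring.rawSemiring semiring) using (_^_)
  open RawSemiringOps (Semiring.rawSemiring Q.semiring) using () renaming (_^_ to _^Q_)
  open Exp semiring using (^-congˡ)
  module ExpP = CommutativeExp commutativeSemiring
  module ExpQ = CommutativeExp Q.commutativeSemiring
  open NaturalCoefficients commutativeSemiring using (solve; _:+_; _:*_; _:=_; con)

  IsPower : Q.Carrier → Set _
  IsPower z = ∃[ w ] w ^Q d Q.≈ z

  IsPower-cong : ∀ {y z} → y Q.≈ z → IsPower y → IsPower z
  IsPower-cong y≈z (w , w≈) = w , Q.trans w≈ y≈z

  IsPower-* : ∀ {y z} → IsPower y → IsPower z → IsPower (y Q.* z)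
  IsPower-* (v , v≈) (w , w≈) = v Q.* w , Q.trans (ExpQ.^-distrib-* v w d) (Q.*-cong v≈ w≈)

  ι-^ : ∀ x k → ι (x ^ k) Q.≈ ι x ^Q k
  ι-^ x zero    = ι-1
  ι-^ x (suc k) = Q.trans (ι-* x (x ^ k)) (Q.*-congˡ (ι-^ x k))

  1^n : ∀ n → 1# ^ n ≈ 1#
  1^n zero    = refl
  1^n (suc n) = trans (*-identityˡ _) (1^n n)

  -- The number lies in `P` and its root in `Q`: roots of Gaussian rationals are complex numbers,
  -- while the products and quotients that relate the radicands are exact in `P`.
  ιPower : Carrier → Set _
  ιPower x = IsPower (ι x)

  ιPower-cong : ∀ {x y} → x ≈ y → ιPower x → ιPower y
  ιPower-cong x≈y = IsPower-cong (ι-cong x≈y)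

  ιPower-* : ∀ {x y} → ιPower x → ιPower y → ιPower (x * y)
  ιPower-* {x} {y} px py = IsPower-cong (Q.sym (ι-* x y)) (IsPower-* px py)

  ιPower-^ : ∀ x → ιPower (x ^ d)
  ιPower-^ x = ι x , Q.sym (ι-^ x d)

  ιPower-1 : ιPower 1#
  ιPower-1 = ιPower-cong (1^n d) (ιPower-^ 1#)

  ιPower-power : ∀ {x} → ιPower x → ∀ k → ιPower (x ^ k)
  ιPower-power px zero    = ιPower-1
  ιPower-power px (suc k) = ιPower-* px (ιPower-power px k)

  -- Adding h to 1 + x multiplies it by 1 + h/(1 + x), which is near 1 for small h.
  ιPower-step : ∀ {x y h} → ιPower (1# + x) → (1# + x) * y ≈ 1# → ιPower (1# + h * y) →
                ιPower (1# + (h + x))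
  ιPower-step {x} {y} {h} px xy≈1 py = ιPower-cong
    (trans (solve 3 (λ x y h → (con 1 :+ x) :* (con 1 :+ h :* y) :=
                                con 1 :+ (h :* ((con 1 :+ x) :* y) :+ x)) refl x y h)
      (+-congˡ (+-congʳ (trans (*-congˡ xy≈1) (*-identityʳ h)))))
    (ιPower-* px py)

  -- x = i³(ix).
  ιPower-rotate : ∀ {i x} → i * i * (i * i) ≈ 1# → ιPower i → ιPower (i * x) → ιPower x
  ιPower-rotate {i} {x} i⁴≈1 pi pix = ιPower-cong
    (trans (solve 2 (λ i x → i :* i :* i :* (i :* x) := (i :* i :* (i :* i)) :* x) refl i x)
      (trans (*-congʳ i⁴≈1) (*-identityˡ x)))
    (ιPower-* (ιPower-* (ιPower-* pi pi) pi) pix)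

  ιPower-divide : ∀ {x y z} → ιPower y → y * z ≈ 1# → ιPower (x * y) → ιPower x
  ιPower-divide {x} {y} {z} py yz≈1 pxy = ιPower-cong
    (trans (solve 3 (λ x y z → x :* y :* z := x :* (y :* z)) refl x y z)
      (trans (*-congˡ yz≈1) (*-identityʳ x)))
    (ιPower-* pxy (inverse-power py yz≈1))
    where
    -- y⁻¹ = (y⁻¹)ᵈ yᵈ⁻¹
    inverse-power : ∀ {y z} → ιPower y → y * z ≈ 1# → ιPower z
    inverse-power {y} {z} py yz≈1 = ιPower-cong
      (trans (*-assoc z _ _) (trans (*-congˡ (trans (sym (ExpP.^-distrib-* z y e))
        (trans (^-congˡ e (trans (*-comm z y) yz≈1)) (1^n e)))) (*-identityʳ z)))
      (ιPower-* (ιPower-^ z) (ιPower-power py e))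

open import Data.Nat.Base using (_≤_; _<_)

-- Forms

module FormProperties {c ℓ} (R : CommutativeRing c ℓ) where
  open CommutativeRing R hiding (zero)
  open Forms R
  open RawSemiringOps (Semiring.rawSemiring semiring) using (_^_)
  open Mult semiring using (×-assoc-*; ×-congʳ; ×-homo-+) renaming (_×_ to _·_)
  open Sum semiring
    using (sum-cong-≋; ∑-distrib-+; *-distribˡ-sum)
    renaming (sum to ∑)
  open Exp semiring using (^-congˡ)
  open NaturalCoefficients commutativeSemiring using (solve; _:+_; _:*_; _:=_)
  open SetoidReasoning setoid

  private
    variable
      A B C : Set
      n d : ℕ

  ∑ₗ-cong : ∀ (xs : List A) {f g} → (∀ x → f x ≈ g x) → ∑ₗ xs f ≈ ∑ₗ xs g
  ∑ₗ-cong []       f≈g = refl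
  ∑ₗ-cong (x ∷ xs) f≈g = +-cong (f≈g x) (∑ₗ-cong xs f≈g)

  ∑ₗ-zero : ∀ (xs : List A) {f} → All (λ x → f x ≈ 0#) xs → ∑ₗ xs f ≈ 0#
  ∑ₗ-zero []       []       = refl
  ∑ₗ-zero (x ∷ xs) (p ∷ ps) = trans (+-cong p (∑ₗ-zero xs ps)) (+-identityʳ 0#)

  ∑ₗ-++ : ∀ (xs : List A) {ys} f → ∑ₗ (xs ++ ys) f ≈ ∑ₗ xs f + ∑ₗ ys f
  ∑ₗ-++ []       f = sym (+-identityˡ _)
  ∑ₗ-++ (x ∷ xs) f = trans (+-congˡ (∑ₗ-++ xs f)) (sym (+-assoc _ _ _))

  ∑ₗ-map : ∀ (h : A → B) xs f → ∑ₗ (List.map h xs) f ≈ ∑ₗ xs (f ∘ h)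
  ∑ₗ-map h []       f = refl
  ∑ₗ-map h (x ∷ xs) f = +-congˡ (∑ₗ-map h xs f)

  ∑ₗ-concatMap : ∀ (F : A → List B) xs f →
                 ∑ₗ (concatMap F xs) f ≈ ∑ₗ xs (λ x → ∑ₗ (F x) f)
  ∑ₗ-concatMap F []       f = refl
  ∑ₗ-concatMap F (x ∷ xs) f = trans (∑ₗ-++ (F x) f) (+-congˡ (∑ₗ-concatMap F xs f))

  ∑ₗ-cartesianProductWith : ∀ (p : A → B → C) xs ys f →
    ∑ₗ (cartesianProductWith p xs ys) f ≈ ∑ₗ xs (λ x → ∑ₗ ys (λ y → f (p x y)))
  ∑ₗ-cartesianProductWith p []       ys f = refl
  ∑ₗ-cartesianProductWith p (x ∷ xs) ys f = trans (∑ₗ-++ (List.map (p x) ys) f)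
    (+-cong (∑ₗ-map (p x) ys f) (∑ₗ-cartesianProductWith p xs ys f))

  ∑ₗ-linear : ∀ (xs : List A) f a g → ∑ₗ xs (λ x → f x + a * g x) ≈ ∑ₗ xs f + a * ∑ₗ xs g
  ∑ₗ-linear []       f a g = sym (trans (+-identityˡ _) (zeroʳ a))
  ∑ₗ-linear (x ∷ xs) f a g = trans (+-congˡ (∑ₗ-linear xs f a g))
    (solve 5 (λ p q a r s → (p :+ a :* q) :+ (r :+ a :* s) := (p :+ r) :+ a :* (q :+ s))
      refl (f x) (g x) a (∑ₗ xs f) (∑ₗ xs g))

  ∑ₗ-*ˡ : ∀ (xs : List A) a f → ∑ₗ xs (λ x → a * f x) ≈ a * ∑ₗ xs f
  ∑ₗ-*ˡ []       a f = sym (zeroʳ a)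
  ∑ₗ-*ˡ (x ∷ xs) a f = trans (+-congˡ (∑ₗ-*ˡ xs a f)) (sym (distribˡ a _ _))

  ∑ₗ-∑-comm : ∀ (xs : List A) {r} (f : Fin r → A → Carrier) →
              ∑ₗ xs (λ x → ∑ (λ j → f j x)) ≈ ∑ (λ j → ∑ₗ xs (f j))
  ∑ₗ-∑-comm []       {zero}  f = refl
  ∑ₗ-∑-comm []       {suc r} f = sym (trans (+-identityˡ _) (sym (∑ₗ-∑-comm [] (f ∘ suc))))
  ∑ₗ-∑-comm (x ∷ xs) f = trans (+-congˡ (∑ₗ-∑-comm xs f)) (sym (∑-distrib-+ (λ j → f j x) _))

  ∑ₗ-applyUpTo : ∀ (g h : ℕ → ℕ) m f → ∑ₗ (applyUpTo (g ∘ h) m) f ≈ ∑ₗ (applyUpTo h m) (f ∘ g)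
  ∑ₗ-applyUpTo g h zero    f = refl
  ∑ₗ-applyUpTo g h (suc m) f = +-congˡ (∑ₗ-applyUpTo g (h ∘ suc) m f)

  ∑ₗ-upTo-suc : ∀ m f → ∑ₗ (upTo (suc m)) f ≈ f 0 + ∑ₗ (upTo m) (f ∘ suc)
  ∑ₗ-upTo-suc m f = +-congˡ (∑ₗ-applyUpTo suc id m f)

  -- Monomials

  nat : ℕ → Carrier
  nat k = k · 1#

  ·≈nat-* : ∀ k x → k · x ≈ nat k * x
  ·≈nat-* k x = sym (trans (×-assoc-* k 1# x) (×-congʳ k (*-identityˡ x)))

  factorial : ℕ → Carrier
  factorial zero    = 1#
  factorial (suc k) = nat (suc k) * factorial k

  infix 10 _!ᵛ

  _!ᵛ : Vec ℕ n → Carrier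
  []      !ᵛ = 1#
  (k ∷ α) !ᵛ = factorial k * α !ᵛ

  infixr 8 _^ᵛ_

  _^ᵛ_ : Point n → Vec ℕ n → Carrier
  v ^ᵛ α = Vec.foldr′ _*_ 1# (Vec.zipWith _^_ v α)

  ^ᵛ-cong : ∀ {v w : Point n} → Pointwise _≈_ v w → ∀ α → v ^ᵛ α ≈ w ^ᵛ α
  ^ᵛ-cong []         []      = refl
  ^ᵛ-cong (p ∷ ps) (k ∷ α) = *-cong (^-congˡ k p) (^ᵛ-cong ps α)

  eval-cong : ∀ (f : Form n d) {v w} → Pointwise _≈_ v w → eval f v ≈ eval f w
  eval-cong {n} {d} f v≈w = ∑ₗ-cong (exponents n d) (λ α → *-congˡ (^ᵛ-cong v≈w α))

  scale : Carrier → Point n → Point n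
  scale a = Vec.map (a *_)

  scale-^ᵛ : ∀ a (v : Point n) α → scale a v ^ᵛ α ≈ a ^ Vec.sum α * v ^ᵛ α
  scale-^ᵛ a []       []      = sym (*-identityˡ 1#)
  scale-^ᵛ a (x ∷ v) (k ∷ α) = begin
    (a * x) ^ k * scale a v ^ᵛ α
      ≈⟨ *-cong (CommutativeExp.^-distrib-* commutativeSemiring a x k) (scale-^ᵛ a v α) ⟩
    (a ^ k * x ^ k) * (a ^ s * v ^ᵛ α)
      ≈⟨ solve 4 (λ p q r t → (p :* q) :* (r :* t) := (p :* r) :* (q :* t)) refl _ _ _ _ ⟩
    (a ^ k * a ^ s) * (x ^ k * v ^ᵛ α)
      ≈⟨ *-congʳ (sym (CommutativeExp.^-homo-* commutativeSemiring a k s)) ⟩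
    a ^ (k ℕ.+ s) * (x ^ k * v ^ᵛ α)          ∎
    where s = Vec.sum α

  δ : ℕ → ℕ → Carrier
  δ zero    zero    = 1#
  δ zero    (suc _) = 0#
  δ (suc _) zero    = 0#
  δ (suc j) (suc k) = δ j k

  ∑-δ : ∀ {j m} → j < m → ∀ (f : ℕ → Carrier) → ∑ₗ (upTo m) (λ k → δ j k * f k) ≈ f j
  ∑-δ {zero} {suc m} j<m f = begin
    ∑ₗ (upTo (suc m)) (λ k → δ 0 k * f k)                ≈⟨ ∑ₗ-upTo-suc m _ ⟩
    1# * f 0 + ∑ₗ (upTo m) (λ k → 0# * f (suc k))
      ≈⟨ +-cong (*-identityˡ _) (∑ₗ-zero (upTo m) (All.universal (λ k → zeroˡ _) _)) ⟩
    f 0 + 0#                                             ≈⟨ +-identityʳ _ ⟩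
    f 0                                                  ∎
  ∑-δ {suc j} {suc m} (s≤s j<m) f = begin
    ∑ₗ (upTo (suc m)) (λ k → δ (suc j) k * f k)          ≈⟨ ∑ₗ-upTo-suc m _ ⟩
    0# * f 0 + ∑ₗ (upTo m) (λ k → δ j k * f (suc k))     ≈⟨ +-cong (zeroˡ _) (∑-δ j<m (f ∘ suc)) ⟩
    0# + f (suc j)                                       ≈⟨ +-identityˡ _ ⟩
    f (suc j)                                            ∎

  δᵛ : Vec ℕ n → Coefficients n
  δᵛ []      []      = 1#
  δᵛ (j ∷ α) (k ∷ β) = δ j k * δᵛ α β

  δ-≢ : ∀ {j k} → j ≢ k → δ j k ≈ 0#
  δ-≢ {zero}  {zero}  j≢k = contradiction ≡.refl j≢k
  δ-≢ {zero}  {suc k} j≢k = refl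
  δ-≢ {suc j} {zero}  j≢k = refl
  δ-≢ {suc j} {suc k} j≢k = δ-≢ (j≢k ∘ ≡.cong suc)

  δᵛ-≢ : ∀ (α β : Vec ℕ n) → Vec.sum β ≢ Vec.sum α → δᵛ α β ≈ 0#
  δᵛ-≢ []      []      ne = contradiction ≡.refl ne
  δᵛ-≢ (j ∷ α) (k ∷ β) ne with j ℕₚ.≟ k
  ... | no j≢k     = trans (*-congʳ (δ-≢ j≢k)) (zeroˡ _)
  ... | yes ≡.refl = trans (*-congˡ (δᵛ-≢ α β (ne ∘ ≡.cong (j ℕ.+_)))) (zeroʳ _)

  ∑-δᵛ : ∀ {n} d (α : Vec ℕ n) → Vec.sum α ≡ d → ∀ (f : Coefficients n) →
         ∑ₗ (exponents n d) (λ β → δᵛ α β * f β) ≈ f α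
  ∑-δᵛ {zero}  zero []     ≡.refl f = trans (+-identityʳ _) (*-identityˡ _)
  ∑-δᵛ {suc n} d (j ∷ α) eq f = begin
    ∑ₗ (exponents (suc n) d) (λ β → δᵛ (j ∷ α) β * f β)
      ≈⟨ ∑ₗ-concatMap (λ k → List.map (k ∷_) (exponents n (d ∸ k))) (upTo (suc d)) _ ⟩
    ∑ₗ (upTo (suc d)) (λ k → ∑ₗ (List.map (k ∷_) (exponents n (d ∸ k))) (λ β → δᵛ (j ∷ α) β * f β))
      ≈⟨ ∑ₗ-cong (upTo (suc d)) (λ k → trans (∑ₗ-map (k ∷_) (exponents n (d ∸ k)) _)
           (trans (∑ₗ-cong (exponents n (d ∸ k)) (λ β → *-assoc _ _ _)) (∑ₗ-*ˡ (exponents n (d ∸ k)) _ _))) ⟩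
    ∑ₗ (upTo (suc d)) (λ k → δ j k * ∑ₗ (exponents n (d ∸ k)) (λ β → δᵛ α β * f (k ∷ β)))
      ≈⟨ ∑-δ (s≤s (≡.subst (j ≤_) eq (ℕₚ.m≤m+n j _))) _ ⟩
    ∑ₗ (exponents n (d ∸ j)) (λ β → δᵛ α β * f (j ∷ β))
      ≈⟨ ∑-δᵛ (d ∸ j) α (≡.trans (≡.sym (ℕₚ.m+n∸m≡n j _)) (≡.cong (_∸ j) eq)) (f ∘ (j ∷_)) ⟩
    f (j ∷ α) ∎

  -- Powers of linear forms

  slice : ℕ → Coefficients (suc n) → Coefficients n
  slice k f α = f (k ∷ α)

  ⊛-slices : ∀ (f g : Coefficients (suc n)) k γ →
    (f ⊛ g) (k ∷ γ) ≈ ∑ₗ (upTo (suc k)) (λ i → (slice i f ⊛ slice (k ∸ i) g) γ)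
  ⊛-slices f g k γ = ∑ₗ-cartesianProductWith _ (upTo (suc k)) (splits γ) _

  ⊛-zeroˡ : ∀ {f : Coefficients n} → (∀ α → f α ≈ 0#) → ∀ g γ → (f ⊛ g) γ ≈ 0#
  ⊛-zeroˡ f≈0 g γ = ∑ₗ-zero (splits γ)
    (All.universal (λ (α , β) → trans (*-congʳ (f≈0 α)) (zeroˡ _)) _)

  Homogeneous : ℕ → Coefficients n → Set _
  Homogeneous d f = ∀ α → Vec.sum α ≢ d → f α ≈ 0#

  ⊛-constantˡ : ∀ {f : Coefficients n} → Homogeneous 0 f → ∀ g γ →
                (f ⊛ g) γ ≈ f (replicate n 0) * g γ
  ⊛-constantˡ         hom g []      = +-identityʳ _
  ⊛-constantˡ {f = f} hom g (k ∷ γ) = begin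
    (f ⊛ g) (k ∷ γ)                            ≈⟨ ⊛-slices f g k γ ⟩
    ∑ₗ (upTo (suc k)) (λ i → (slice i f ⊛ slice (k ∸ i) g) γ)
      ≈⟨ ∑ₗ-upTo-suc k _ ⟩
    (slice 0 f ⊛ slice k g) γ + ∑ₗ (upTo k) (λ i → (slice (suc i) f ⊛ slice (k ∸ suc i) g) γ)
      ≈⟨ +-cong (⊛-constantˡ (λ α → hom (0 ∷ α)) (slice k g) γ)
           (∑ₗ-zero (upTo k) (All.universal (λ i → ⊛-zeroˡ (λ α → hom (suc i ∷ α) λ ()) _ γ) _)) ⟩
    slice 0 f (replicate _ 0) * g (k ∷ γ) + 0# ≈⟨ +-identityʳ _ ⟩
    slice 0 f (replicate _ 0) * g (k ∷ γ)      ∎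

  linearCoeffs : Coefficients n → Point n
  linearCoeffs {zero}  f = []
  linearCoeffs {suc n} f = f (1 ∷ replicate n 0) ∷ linearCoeffs (slice 0 f)

  -- Entry γ of (v₁x₁ + ⋯ + vₙxₙ)g, which is the sum of vᵢ g(γ - eᵢ) over all
  -- i with γᵢ > 0.
  shiftSum : Point n → Coefficients n → Coefficients n
  shiftSum []      g []          = 0#
  shiftSum (x ∷ v) g (zero  ∷ γ) = shiftSum v (slice 0 g) γ
  shiftSum (x ∷ v) g (suc k ∷ γ) = shiftSum v (slice (suc k) g) γ + x * g (k ∷ γ)

  -- Only two slices of f contribute: slice 0 is linear in the remaining variables, and slice 1 is
  -- constant, namely the coefficient of the first variable.
  ⊛-linearˡ : ∀ {f : Coefficients n} → Homogeneous 1 f → ∀ g γ →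
              (f ⊛ g) γ ≈ shiftSum (linearCoeffs f) g γ
  ⊛-linearˡ hom g []      = trans (+-identityʳ _) (trans (*-congʳ (hom [] λ ())) (zeroˡ _))
  ⊛-linearˡ {f = f} hom g (zero ∷ γ) = begin
    (f ⊛ g) (0 ∷ γ)                                   ≈⟨ ⊛-slices f g 0 γ ⟩
    (slice 0 f ⊛ slice 0 g) γ + 0#                    ≈⟨ +-identityʳ _ ⟩
    (slice 0 f ⊛ slice 0 g) γ                         ≈⟨ ⊛-linearˡ (λ α → hom (0 ∷ α)) (slice 0 g) γ ⟩
    shiftSum (linearCoeffs (slice 0 f)) (slice 0 g) γ ∎
  ⊛-linearˡ {f = f} hom g (suc k ∷ γ) = begin
    (f ⊛ g) (suc k ∷ γ)                               ≈⟨ ⊛-slices f g (suc k) γ ⟩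
    ∑ₗ (upTo (2 ℕ.+ k)) F                             ≈⟨ ∑ₗ-upTo-suc (suc k) F ⟩
    F 0 + ∑ₗ (upTo (suc k)) (F ∘ suc)                 ≈⟨ +-congˡ (∑ₗ-upTo-suc k (F ∘ suc)) ⟩
    F 0 + (F 1 + ∑ₗ (upTo k) (λ i → F (2 ℕ.+ i)))
      ≈⟨ +-cong (⊛-linearˡ (λ α → hom (0 ∷ α)) (slice (suc k) g) γ)
           (trans (+-cong (⊛-constantˡ (λ α ne → hom (1 ∷ α) λ eq → ne (ℕₚ.suc-injective eq)) (slice k g) γ)
             (∑ₗ-zero (upTo k) (All.universal (λ i → ⊛-zeroˡ (λ α → hom (2 ℕ.+ i ∷ α) λ ()) _ γ) _)))
             (+-identityʳ _)) ⟩
    shiftSum (linearCoeffs f) g (suc k ∷ γ)           ∎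
    where
    F : ℕ → Carrier
    F i = (slice i f ⊛ slice (suc k ∸ i) g) γ

  shiftSum-zero : ∀ (v : Point n) {g} γ → (∀ β → suc (Vec.sum β) ≡ Vec.sum γ → g β ≈ 0#) →
                  shiftSum v g γ ≈ 0#
  shiftSum-zero []      []          g≈0 = refl
  shiftSum-zero (x ∷ v) (zero  ∷ γ) g≈0 = shiftSum-zero v γ (g≈0 ∘ (0 ∷_))
  shiftSum-zero (x ∷ v) (suc k ∷ γ) g≈0 = trans
    (+-cong
      (shiftSum-zero v γ λ β eq → g≈0 (suc k ∷ β)
        (≡.cong suc (≡.trans (≡.sym (ℕₚ.+-suc k _)) (≡.cong (k ℕ.+_) eq))))
      (trans (*-congˡ (g≈0 (k ∷ γ) ≡.refl)) (zeroʳ x)))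
    (+-identityʳ 0#)

  -- This is xᵢ · xᵞ⁻ᵉⁱ = xᵞ and γᵢ (γ - eᵢ)! = γ!, summed over i.
  shiftSum-^ᵛ : ∀ (v : Point n) {g} γ a b →
    (∀ β → suc (Vec.sum β) ≡ Vec.sum γ → a * (β !ᵛ * g β) ≈ b * v ^ᵛ β) →
    a * (γ !ᵛ * shiftSum v g γ) ≈ nat (Vec.sum γ) * (b * v ^ᵛ γ)
  shiftSum-^ᵛ []      []          a b hyp = trans (trans (*-congˡ (zeroʳ _)) (zeroʳ a)) (sym (zeroˡ _))
  shiftSum-^ᵛ (x ∷ v) {g} (zero  ∷ γ) a b hyp = begin
    a * ((1# * γ !ᵛ) * shiftSum v (slice 0 g) γ)  ≈⟨ *-congˡ (*-congʳ (*-identityˡ _)) ⟩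
    a * (γ !ᵛ * shiftSum v (slice 0 g) γ)         ≈⟨ shiftSum-^ᵛ v γ a b (λ β eq →
      trans (*-congˡ (*-congʳ (sym (*-identityˡ _)))) (trans (hyp (0 ∷ β) eq) (*-congˡ (*-identityˡ _)))) ⟩
    nat (Vec.sum γ) * (b * v ^ᵛ γ)                ≈⟨ *-congˡ (*-congˡ (sym (*-identityˡ _))) ⟩
    nat (Vec.sum γ) * (b * (1# * v ^ᵛ γ))         ∎
  shiftSum-^ᵛ (x ∷ v) {g} (suc k ∷ γ) a b hyp = begin
    a * (((nat (suc k) * k!) * γ !ᵛ) * (s + x * g (k ∷ γ)))
      ≈⟨ solve 7 (λ a m f γ! s x g → a :* (((m :* f) :* γ!) :* (s :+ x :* g)) :=
            (a :* (m :* f)) :* (γ! :* s) :+ m :* (x :* (a :* ((f :* γ!) :* g)))) refl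
          a (nat (suc k)) k! (γ !ᵛ) s x (g (k ∷ γ)) ⟩
    (a * (nat (suc k) * k!)) * (γ !ᵛ * s) + nat (suc k) * (x * (a * ((k! * γ !ᵛ) * g (k ∷ γ))))
      -- The factors `a` and `b` are arbitrary so that (k + 1)! and the (k + 1)-st power of x, which
      -- belong to the first coordinate, can be moved into them for the recursion on the others.
      ≈⟨ +-cong (shiftSum-^ᵛ v γ (a * (nat (suc k) * k!)) (b * x ^ suc k) hyp′)
           (*-congˡ (*-congˡ (hyp (k ∷ γ) ≡.refl))) ⟩
    nat (Vec.sum γ) * ((b * x ^ suc k) * v ^ᵛ γ) + nat (suc k) * (x * (b * (x ^ k * v ^ᵛ γ)))
      ≈⟨ solve 6 (λ p m b x y z → p :* ((b :* (x :* y)) :* z) :+ m :* (x :* (b :* (y :* z))) :=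
            (m :+ p) :* (b :* ((x :* y) :* z))) refl
          (nat (Vec.sum γ)) (nat (suc k)) b x (x ^ k) (v ^ᵛ γ) ⟩
    (nat (suc k) + nat (Vec.sum γ)) * (b * (x ^ suc k * v ^ᵛ γ))
      ≈⟨ *-congʳ (sym (×-homo-+ 1# (suc k) (Vec.sum γ))) ⟩
    nat (suc k ℕ.+ Vec.sum γ) * (b * (x ^ suc k * v ^ᵛ γ)) ∎
    where
    k! = factorial k
    s = shiftSum v (slice (suc k) g) γ
    hyp′ : ∀ β → suc (Vec.sum β) ≡ Vec.sum γ →
           (a * (nat (suc k) * k!)) * (β !ᵛ * g (suc k ∷ β)) ≈ (b * x ^ suc k) * v ^ᵛ β
    hyp′ β eq = begin
      (a * (nat (suc k) * k!)) * (β !ᵛ * g (suc k ∷ β))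
        ≈⟨ solve 5 (λ a m f β! g → (a :* (m :* f)) :* (β! :* g) := a :* (((m :* f) :* β!) :* g)) refl
             a (nat (suc k)) k! (β !ᵛ) (g (suc k ∷ β)) ⟩
      a * ((suc k ∷ β) !ᵛ * g (suc k ∷ β))
        ≈⟨ hyp (suc k ∷ β) (≡.cong suc (≡.trans (≡.sym (ℕₚ.+-suc k _)) (≡.cong (k ℕ.+_) eq))) ⟩
      b * (x ^ suc k * v ^ᵛ β)                           ≈⟨ sym (*-assoc b _ _) ⟩
      (b * x ^ suc k) * v ^ᵛ β                           ∎

  𝟙-homogeneous : Homogeneous {n} 0 𝟙
  𝟙-homogeneous []          ne = contradiction ≡.refl ne
  𝟙-homogeneous (zero  ∷ α) ne = 𝟙-homogeneous α ne
  𝟙-homogeneous (suc k ∷ α) ne = refl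

  power-homogeneous : ∀ {f : Coefficients n} → Homogeneous 1 f → ∀ d → Homogeneous d (power f d)
  power-homogeneous hom zero    = 𝟙-homogeneous
  power-homogeneous {f = f} hom (suc d) γ ne = trans (⊛-linearˡ hom _ γ)
    (shiftSum-zero (linearCoeffs f) γ λ β eq →
      power-homogeneous hom d β (λ eq′ → ne (≡.trans (≡.sym eq) (≡.cong suc eq′))))

  𝟙-^ᵛ : ∀ (v : Point n) α → Vec.sum α ≡ 0 → α !ᵛ * 𝟙 α ≈ v ^ᵛ α
  𝟙-^ᵛ []      []         eq = *-identityˡ 1#
  𝟙-^ᵛ (x ∷ v) (zero ∷ α) eq = trans (*-congʳ (*-identityˡ _))
    (trans (𝟙-^ᵛ v α eq) (sym (*-identityˡ _)))

  -- The multinomial theorem with denominators cleared. By induction on d: another factor ℓ brings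
  -- in the total degree d + 1, which turns d! into (d + 1)!.
  power-^ᵛ : ∀ {f : Coefficients n} → Homogeneous 1 f → ∀ {d} α → Vec.sum α ≡ d →
             α !ᵛ * power f d α ≈ factorial d * linearCoeffs f ^ᵛ α
  power-^ᵛ {f = f} hom {zero}  α eq = trans (𝟙-^ᵛ (linearCoeffs f) α eq) (sym (*-identityˡ _))
  power-^ᵛ {f = f} hom {suc d} α eq = begin
    α !ᵛ * power f (suc d) α                                 ≈⟨ *-congˡ (⊛-linearˡ hom _ α) ⟩
    α !ᵛ * shiftSum v (power f d) α                          ≈⟨ sym (*-identityˡ _) ⟩
    1# * (α !ᵛ * shiftSum v (power f d) α)                   ≈⟨ shiftSum-^ᵛ v α 1# (factorial d) (λ β eq′ →
      trans (*-identityˡ _) (power-^ᵛ hom β (ℕₚ.suc-injective (≡.trans eq′ eq)))) ⟩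
    nat (Vec.sum α) * (factorial d * v ^ᵛ α)                 ≈⟨ *-congʳ (reflexive (≡.cong nat eq)) ⟩
    nat (suc d) * (factorial d * v ^ᵛ α)                     ≈⟨ sym (*-assoc _ _ _) ⟩
    factorial (suc d) * v ^ᵛ α                               ∎
    where v = linearCoeffs f

  linearForm : Point n → Form n 1
  linearForm {n} v = record { coeff = entries v ; homogeneous = entries-homogeneous v }
    where
    entries : ∀ {n} → Point n → Coefficients n
    entries []      []                = 0#
    entries (x ∷ v) (zero        ∷ α) = entries v α
    entries (x ∷ v) (suc zero    ∷ α) = x * 𝟙 α
    entries (x ∷ v) (suc (suc k) ∷ α) = 0#

    entries-homogeneous : ∀ {n} (v : Point n) → Homogeneous 1 (entries v)
    entries-homogeneous []      []                ne = refl
    entries-homogeneous (x ∷ v) (zero        ∷ α) ne = entries-homogeneous v α ne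
    entries-homogeneous (x ∷ v) (suc zero    ∷ α) ne =
      trans (*-congˡ (𝟙-homogeneous α (ne ∘ ≡.cong suc))) (zeroʳ x)
    entries-homogeneous (x ∷ v) (suc (suc k) ∷ α) ne = refl

  linearCoeffs-linearForm : ∀ (v : Point n) → Pointwise _≈_ (linearCoeffs (coeff (linearForm v))) v
  linearCoeffs-linearForm []      = []
  linearCoeffs-linearForm {suc n} (x ∷ v) =
    trans (*-congˡ (𝟙-replicate n)) (*-identityʳ x) ∷ linearCoeffs-linearForm v
    where
    𝟙-replicate : ∀ n → 𝟙 (replicate n 0) ≈ 1#
    𝟙-replicate zero    = refl
    𝟙-replicate (suc n) = 𝟙-replicate n

  -- Differential operators

  fold-∂-cong : ∀ (i : Fin n) k {g h : Coefficients n} → (∀ β → g β ≈ h β) →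
                ∀ β → ℕ.fold g (∂ i) k β ≈ ℕ.fold h (∂ i) k β
  fold-∂-cong i zero    g≈h β = g≈h β
  fold-∂-cong i (suc k) g≈h β = ×-congʳ (suc (lookup β i)) (fold-∂-cong i k g≈h _)

  fold-∂-slice : ∀ (i : Fin n) k g j β →
                 ℕ.fold g (∂ (suc i)) k (j ∷ β) ≈ ℕ.fold (slice j g) (∂ i) k β
  fold-∂-slice i zero    g j β = refl
  fold-∂-slice i (suc k) g j β = ×-congʳ (suc (lookup β i)) (fold-∂-slice i k g j _)

  -- Each derivative contributes one factor of (k + j)!/j!; the quotient is avoided by multiplying
  -- by j!.
  fold-∂-zero : ∀ k (g : Coefficients (suc n)) j β →
    factorial j * ℕ.fold g (∂ zero) k (j ∷ β) ≈ factorial (k ℕ.+ j) * g (k ℕ.+ j ∷ β)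
  fold-∂-zero zero    g j β = refl
  fold-∂-zero (suc k) g j β = begin
    factorial j * (suc j · h)           ≈⟨ *-congˡ (·≈nat-* (suc j) h) ⟩
    factorial j * (nat (suc j) * h)
      ≈⟨ solve 3 (λ a b c → a :* (b :* c) := (b :* a) :* c) refl _ _ _ ⟩
    factorial (suc j) * h               ≈⟨ fold-∂-zero k g (suc j) β ⟩
    factorial (k ℕ.+ suc j) * g (k ℕ.+ suc j ∷ β)
      ≈⟨ reflexive (≡.cong (λ m → factorial m * g (m ∷ β)) (ℕₚ.+-suc k j)) ⟩
    factorial (suc k ℕ.+ j) * g (suc k ℕ.+ j ∷ β) ∎
    where h = ℕ.fold g (∂ zero) k (suc j ∷ β)

  tail∂^ : Vec ℕ n → Coefficients (suc n) → Coefficients (suc n)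
  tail∂^ α g (j ∷ β) = ∂^ α (slice j g) β

  -- `allFin` begins with `zero`, so the derivatives in the first variable are outermost, and all
  -- others act within the slices of fixed first exponent.
  ∂^-suc : ∀ k (α : Vec ℕ n) g β → ∂^ (k ∷ α) g β ≈ ℕ.fold (tail∂^ α g) (∂ zero) k β
  ∂^-suc {n} k α g = fold-∂-cong zero k {h = tail∂^ α g} λ where
      (j ∷ β) → trans (reflexive (≡.cong (λ is → ∂s is (j ∷ β)) tabulate-suc)) (go (allFin n) j β)
    where
    ∂s : List (Fin (suc n)) → Coefficients (suc n)
    ∂s = List.foldr (λ i h → ℕ.fold h (∂ i) (lookup (k ∷ α) i)) g
    tabulate-suc : List.tabulate suc ≡ List.map suc (allFin n)
    tabulate-suc = ≡.sym (Listₚ.map-tabulate id suc)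
    go : ∀ is j β → ∂s (List.map suc is) (j ∷ β) ≈
         List.foldr (λ i h → ℕ.fold h (∂ i) (lookup α i)) (slice j g) is β
    go []       j β = refl
    go (i ∷ is) j β = trans (fold-∂-slice i (lookup α i) (∂s (List.map suc is)) j β)
      (fold-∂-cong i (lookup α i) (go is j) β)

  ∂^-at-0 : ∀ (α : Vec ℕ n) g → ∂^ α g (replicate n 0) ≈ α !ᵛ * g α
  ∂^-at-0 []      g = sym (*-identityˡ _)
  ∂^-at-0 (k ∷ α) g = begin
    ∂^ (k ∷ α) g (0 ∷ 0s)                      ≈⟨ ∂^-suc k α g (0 ∷ 0s) ⟩
    ℕ.fold h (∂ zero) k (0 ∷ 0s)               ≈⟨ sym (*-identityˡ _) ⟩
    1# * ℕ.fold h (∂ zero) k (0 ∷ 0s)          ≈⟨ fold-∂-zero k h 0 0s ⟩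
    factorial (k ℕ.+ 0) * h (k ℕ.+ 0 ∷ 0s)
      ≈⟨ reflexive (≡.cong (λ m → factorial m * h (m ∷ 0s)) (ℕₚ.+-identityʳ k)) ⟩
    factorial k * ∂^ α (slice k g) 0s          ≈⟨ *-congˡ (∂^-at-0 α (slice k g)) ⟩
    factorial k * (α !ᵛ * g (k ∷ α))           ≈⟨ sym (*-assoc _ _ _) ⟩
    (k ∷ α) !ᵛ * g (k ∷ α)                     ∎
    where
    0s = replicate _ 0
    h = tail∂^ α g

  -- The common shape of both kinds of functional: the weights `v ^ᵛ_` give evaluation at v, by
  -- definition, and the weights `dual g` give g(∂x).
  ⟨_∣_⟩ : Form n d → Coefficients n → Carrier
  ⟨_∣_⟩ {n} {d} h a = ∑ₗ (exponents n d) λ α → coeff h α * a α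

  -- Entry α is the value of g(∂x) at the monomial with exponent α when α has degree d, since ∂ᵅxᵅ =
  -- α!.
  dual : Form n d → Coefficients n
  dual g α = α !ᵛ * coeff g α

  pairing≈⟨∣⟩ : ∀ (g f : Form n d) → pairing g f ≈ ⟨ f ∣ dual g ⟩
  pairing≈⟨∣⟩ {n} {d} g f = ∑ₗ-cong (exponents n d) λ α → begin
    coeff g α * ∂^ α (coeff f) (replicate n 0)  ≈⟨ *-congˡ (∂^-at-0 α (coeff f)) ⟩
    coeff g α * (α !ᵛ * coeff f α)
      ≈⟨ solve 3 (λ a b c → a :* (b :* c) := c :* (b :* a)) refl _ _ _ ⟩
    coeff f α * dual g α                        ∎

  ⟨∣⟩-congʳ : ∀ (f : Form n d) {a b} → (∀ α → Vec.sum α ≡ d → a α ≈ b α) → ⟨ f ∣ a ⟩ ≈ ⟨ f ∣ b ⟩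
  ⟨∣⟩-congʳ {n} {d} f {a} {b} a≈b = ∑ₗ-cong (exponents n d) λ α → case-degree α (Vec.sum α ℕₚ.≟ d)
    where
    case-degree : ∀ α → Dec (Vec.sum α ≡ d) → coeff f α * a α ≈ coeff f α * b α
    case-degree α (yes eq) = *-congˡ (a≈b α eq)
    case-degree α (no ne)  = *-congʳ₀ (homogeneous f α ne)
      where
      *-congʳ₀ : coeff f α ≈ 0# → coeff f α * a α ≈ coeff f α * b α
      *-congʳ₀ f≈0 = trans (trans (*-congʳ f≈0) (zeroˡ _)) (sym (trans (*-congʳ f≈0) (zeroˡ _)))

  pairing-sumOfPowers : ∀ (g : Form n d) {r} (l : Vector (Form n 1) r) →
    (∀ α → coeff g α ≈ ∑ (λ j → power (coeff (l j)) d α)) → ∀ f →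
    pairing g f ≈ factorial d * ∑ (λ j → eval f (linearCoeffs (coeff (l j))))
  pairing-sumOfPowers {n} {d} g {r} l g≈ f = begin
    pairing g f
      ≈⟨ pairing≈⟨∣⟩ g f ⟩
    ⟨ f ∣ dual g ⟩
      ≈⟨ ⟨∣⟩-congʳ f (λ α eq → begin
           α !ᵛ * coeff g α                              ≈⟨ *-congˡ (g≈ α) ⟩
           α !ᵛ * ∑ (λ j → power (coeff (l j)) d α)
             ≈⟨ *-distribˡ-sum (α !ᵛ) (λ j → power (coeff (l j)) d α) ⟩
           ∑ (λ j → α !ᵛ * power (coeff (l j)) d α)
             ≈⟨ sum-cong-≋ (λ j → power-^ᵛ (homogeneous (l j)) α eq) ⟩
           ∑ (λ j → factorial d * v j ^ᵛ α)
             ≈⟨ sym (*-distribˡ-sum (factorial d) (λ j → v j ^ᵛ α)) ⟩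
           factorial d * ∑ (λ j → v j ^ᵛ α)              ∎) ⟩
    ⟨ f ∣ (λ α → factorial d * ∑ (λ j → v j ^ᵛ α)) ⟩
      ≈⟨ ∑ₗ-cong E (λ α → trans (solve 3 (λ a b c → a :* (b :* c) := b :* (a :* c)) refl _ _ _)
           (*-congˡ (*-distribˡ-sum (coeff f α) (λ j → v j ^ᵛ α)))) ⟩
    ∑ₗ E (λ α → factorial d * ∑ (λ j → coeff f α * v j ^ᵛ α))
      ≈⟨ ∑ₗ-*ˡ E (factorial d) _ ⟩
    factorial d * ∑ₗ E (λ α → ∑ (λ j → coeff f α * v j ^ᵛ α))
      ≈⟨ *-congˡ (∑ₗ-∑-comm E (λ j α → coeff f α * v j ^ᵛ α)) ⟩
    factorial d * ∑ (λ j → eval f (v j)) ∎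
    where
    E = exponents n d
    v : Vector (Point n) r
    v j = linearCoeffs (coeff (l j))

-- Query complexity over a field, up to double negation

private
  variable
    a b : Level
    A B : Set a

infixl 1 _>>=_

_>>=_ : ¬ ¬ A → (A → ¬ ¬ B) → ¬ ¬ B
(m >>= f) k = m (λ x → f x k)

pure : A → ¬ ¬ A
pure x k = k x

¬¬-choice : ∀ {p} r {P : Fin r → Set p} → (∀ j → ¬ ¬ P j) → ¬ ¬ (∀ j → P j)
¬¬-choice zero    p = pure λ ()
¬¬-choice (suc r) p = p zero >>= λ p₀ → ¬¬-choice r (p ∘ suc) >>= λ ps →
  pure λ { zero → p₀ ; (suc j) → ps j }

¬¬-all-or-any : ∀ {p q} {P : A → Set p} {Q : A → Set q} → (∀ x → ¬ ¬ (P x ⊎ Q x)) →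
                ∀ xs → ¬ ¬ (All P xs ⊎ ∃[ x ] Q x)
¬¬-all-or-any p⊎q []       = pure (inj₁ [])
¬¬-all-or-any p⊎q (x ∷ xs) = p⊎q x >>= λ where
  (inj₂ q) → pure (inj₂ (x , q))
  (inj₁ p) → ¬¬-all-or-any p⊎q xs >>= λ where
    (inj₂ q)  → pure (inj₂ q)
    (inj₁ ps) → pure (inj₁ (p ∷ ps))

-- Functionals that vanish on a common kernel

module Duality {c ℓ m n} (R : CommutativeRing c ℓ) {M : Set m} {N : Set n} where
  open CommutativeRing R hiding (zero)
  open Sum semiring
    using (sum-cong-≋; ∑-distrib-+; *-distribˡ-sum; *-distribʳ-sum)
    renaming (sum to ∑)
  open NaturalCoefficients commutativeSemiring using (solve; _:+_; _:*_; _:=_)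
  open RingProperties ring using (-‿distribˡ-*; -‿distribʳ-*; -‿+-comm; -0#≈0#)
  open SetoidReasoning setoid

  module Elimination
    (_⊕_·_ : M → Carrier → M → M) (_⊞_·_ : N → Carrier → N → N)
    (⟨_∣_⟩ : M → N → Carrier)
    (linearˡ : ∀ h k h′ e → ⟨ h ⊕ k · h′ ∣ e ⟩ ≈ ⟨ h ∣ e ⟩ + k * ⟨ h′ ∣ e ⟩)
    (linearʳ : ∀ h e k e′ → ⟨ h ∣ e ⊞ k · e′ ⟩ ≈ ⟨ h ∣ e ⟩ + k * ⟨ h ∣ e′ ⟩)
    (zero-or-onto : ∀ e → ¬ ¬ ((∀ h → ⟨ h ∣ e ⟩ ≈ 0#) ⊎ ∃[ h ] ⟨ h ∣ e ⟩ ≈ 1#))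
    where

    Combination : ∀ {s} → Vector N s → N → Set _
    Combination {s} es φ = Σ[ k ∈ Vector Carrier s ]
      (∀ h → ⟨ h ∣ φ ⟩ ≈ ∑ (λ j → k j * ⟨ h ∣ es j ⟩))

    -- Elimination: if ⟨ h₀ ∣ e₀ ⟩ = 1, then e - ⟨ h₀ ∣ e ⟩ e₀ takes the same
    -- value at h as e takes at the projection of h to the kernel of e₀ along h₀.
    ∩ker⊆ker⇒span : ∀ {s} (es : Vector N s) φ →
      (∀ h → (∀ j → ⟨ h ∣ es j ⟩ ≈ 0#) → ⟨ h ∣ φ ⟩ ≈ 0#) →
      ¬ ¬ Combination es φ
    ∩ker⊆ker⇒span {zero}  es φ ker = pure ((λ ()) , λ h → ker h λ ())
    ∩ker⊆ker⇒span {suc s} es φ ker = zero-or-onto (es zero) >>= λ where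
        (inj₁ e₀≈0) → ∩ker⊆ker⇒span (es ∘ suc) φ
          (λ h es≈0 → ker h λ { zero → e₀≈0 h ; (suc j) → es≈0 j }) >>= λ (k , φ≈) →
          pure (0# Vector.∷ k , λ h → trans (φ≈ h) (sym (trans (+-congʳ (zeroˡ _)) (+-identityˡ _))))
        (inj₂ (h₀ , e₀h₀≈1)) → eliminate h₀ e₀h₀≈1
      where
      e₀ = es zero
      eliminate : ∀ h₀ → ⟨ h₀ ∣ e₀ ⟩ ≈ 1# →
                  ¬ ¬ Combination es φ
      eliminate h₀ e₀h₀≈1 =
        ∩ker⊆ker⇒span (λ j → reduce (es (suc j))) (reduce φ) ker′ >>= λ (k , φ≈) →
        -- Reduction took ⟨ h₀ ∣ φ ⟩ e₀ away from φ and ⟨ h₀ ∣ eⱼ ⟩ e₀ from each eⱼ; the new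
        -- coefficient collects these multiples of e₀.
        pure ((⟨ h₀ ∣ φ ⟩ + - ∑ (λ j → k j * ⟨ h₀ ∣ es (suc j) ⟩)) Vector.∷ k , λ h → expand h k (φ≈ h))
        where
        reduce : N → N
        reduce e = e ⊞ - ⟨ h₀ ∣ e ⟩ · e₀

        project : M → M
        project h = h ⊕ - ⟨ h ∣ e₀ ⟩ · h₀

        project-e₀ : ∀ h → ⟨ project h ∣ e₀ ⟩ ≈ 0#
        project-e₀ h = begin
          ⟨ project h ∣ e₀ ⟩                           ≈⟨ linearˡ h _ h₀ e₀ ⟩
          ⟨ h ∣ e₀ ⟩ + - ⟨ h ∣ e₀ ⟩ * ⟨ h₀ ∣ e₀ ⟩
            ≈⟨ +-congˡ (trans (*-congˡ e₀h₀≈1) (*-identityʳ _)) ⟩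
          ⟨ h ∣ e₀ ⟩ + - ⟨ h ∣ e₀ ⟩                    ≈⟨ -‿inverseʳ _ ⟩
          0#                                           ∎

        project-reduce : ∀ h e → ⟨ project h ∣ e ⟩ ≈ ⟨ h ∣ reduce e ⟩
        project-reduce h e = begin
          ⟨ project h ∣ e ⟩                            ≈⟨ linearˡ h _ h₀ e ⟩
          ⟨ h ∣ e ⟩ + - ⟨ h ∣ e₀ ⟩ * ⟨ h₀ ∣ e ⟩        ≈⟨ +-congˡ (sym (-‿distribˡ-* _ _)) ⟩
          ⟨ h ∣ e ⟩ + - (⟨ h ∣ e₀ ⟩ * ⟨ h₀ ∣ e ⟩)      ≈⟨ +-congˡ (-‿cong (*-comm _ _)) ⟩
          ⟨ h ∣ e ⟩ + - (⟨ h₀ ∣ e ⟩ * ⟨ h ∣ e₀ ⟩)      ≈⟨ +-congˡ (-‿distribˡ-* _ _) ⟩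
          ⟨ h ∣ e ⟩ + - ⟨ h₀ ∣ e ⟩ * ⟨ h ∣ e₀ ⟩        ≈⟨ sym (linearʳ h e _ e₀) ⟩
          ⟨ h ∣ reduce e ⟩                             ∎

        ker′ : ∀ h → (∀ j → ⟨ h ∣ reduce (es (suc j)) ⟩ ≈ 0#) → ⟨ h ∣ reduce φ ⟩ ≈ 0#
        ker′ h es≈0 = trans (sym (project-reduce h φ)) (ker (project h) λ where
          zero    → project-e₀ h
          (suc j) → trans (project-reduce h (es (suc j))) (es≈0 j))

        cancel : ∀ {x y z} → x + - y ≈ z → x ≈ z + y
        cancel {x} {y} {z} eq = begin
          x              ≈⟨ sym (+-identityʳ x) ⟩
          x + 0#         ≈⟨ +-congˡ (sym (-‿inverseˡ y)) ⟩
          x + (- y + y)  ≈⟨ sym (+-assoc _ _ _) ⟩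
          x + - y + y    ≈⟨ +-congʳ eq ⟩
          z + y          ∎

        expand : ∀ h k → ⟨ h ∣ reduce φ ⟩ ≈ ∑ (λ j → k j * ⟨ h ∣ reduce (es (suc j)) ⟩) →
          ⟨ h ∣ φ ⟩ ≈ (⟨ h₀ ∣ φ ⟩ + - ∑ (λ j → k j * ⟨ h₀ ∣ es (suc j) ⟩)) * ⟨ h ∣ e₀ ⟩
                      + ∑ (λ j → k j * ⟨ h ∣ es (suc j) ⟩)
        expand h k φ≈ = trans (cancel reduced) (begin
          S + - T * u + p * u
            ≈⟨ solve 4 (λ S T u p → S :+ T :* u :+ p :* u := (p :+ T) :* u :+ S) refl S (- T) u p ⟩
          (p + - T) * u + S      ∎)
          where
          u = ⟨ h ∣ e₀ ⟩
          p = ⟨ h₀ ∣ φ ⟩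
          S = ∑ (λ j → k j * ⟨ h ∣ es (suc j) ⟩)
          T = ∑ (λ j → k j * ⟨ h₀ ∣ es (suc j) ⟩)
          reduced : ⟨ h ∣ φ ⟩ + - (p * u) ≈ S + - T * u
          reduced = begin
            ⟨ h ∣ φ ⟩ + - (p * u)     ≈⟨ +-congˡ (-‿distribˡ-* _ _) ⟩
            ⟨ h ∣ φ ⟩ + - p * u       ≈⟨ sym (linearʳ h φ _ e₀) ⟩
            ⟨ h ∣ reduce φ ⟩          ≈⟨ φ≈ ⟩
            ∑ (λ j → k j * ⟨ h ∣ reduce (es (suc j)) ⟩)
              ≈⟨ sum-cong-≋ (λ j → trans (*-congˡ (linearʳ h (es (suc j)) _ e₀))
                   (trans (distribˡ _ _ _)
                   (+-congˡ (trans (sym (*-assoc _ _ _)) (*-congʳ (sym (-‿distribʳ-* _ _))))))) ⟩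
            ∑ (λ j → k j * ⟨ h ∣ es (suc j) ⟩ + - (k j * ⟨ h₀ ∣ es (suc j) ⟩) * u)
              ≈⟨ ∑-distrib-+ (λ j → k j * ⟨ h ∣ es (suc j) ⟩) _ ⟩
            S + ∑ (λ j → - (k j * ⟨ h₀ ∣ es (suc j) ⟩) * u)
              ≈⟨ +-congˡ (sym (*-distribʳ-sum u (λ j → - (k j * ⟨ h₀ ∣ es (suc j) ⟩)))) ⟩
            S + ∑ (λ j → - (k j * ⟨ h₀ ∣ es (suc j) ⟩)) * u
              ≈⟨ +-congˡ (*-congʳ (∑-neg (λ j → k j * ⟨ h₀ ∣ es (suc j) ⟩))) ⟩
            S + - T * u               ∎
            where
            ∑-neg : ∀ {r} (f : Vector Carrier r) → ∑ (λ j → - f j) ≈ - ∑ f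
            ∑-neg {zero}  f = sym -0#≈0#
            ∑-neg {suc r} f = trans (+-congˡ (∑-neg (f ∘ suc))) (-‿+-comm _ _)

module QueryComplexity {c ℓ} (R : CommutativeRing c ℓ) where
  open CommutativeRing R hiding (zero)
  open Forms R
  open FormProperties R
  open RawSemiringOps (Semiring.rawSemiring semiring) using (_^_)
  open Sum semiring
    using (sum-cong-≋; *-distribˡ-sum)
    renaming (sum to ∑)
  open NaturalCoefficients commutativeSemiring using (solve; _:+_; _:*_; _:=_)
  open SetoidReasoning setoid

  private
    variable
      n d : ℕ

  -- Upper bound: summing the values at fixed points

  sumQueries : ∀ {r} → Carrier → Vector (Point n) r → Carrier → Strategy n
  sumQueries {r = zero}  k vs s = output (k * s)
  sumQueries {r = suc r} k vs s = query (vs zero) λ a → sumQueries k (vs ∘ suc) (s + a)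

  sumQueries-extensional : ∀ {r k} (vs : Vector (Point n) r) {s t} → s ≈ t →
                           sumQueries k vs s ≋ sumQueries k vs t
  sumQueries-extensional {r = zero}  vs s≈t = output (*-congˡ s≈t)
  sumQueries-extensional {r = suc r} vs s≈t =
    query (Pointwise.refl refl) λ a≈b → sumQueries-extensional (vs ∘ suc) (+-cong s≈t a≈b)

  runResult-sumQueries : ∀ {r k} (vs : Vector (Point n) r) s (f : Form n d) →
    runResult (sumQueries k vs s) f ≈ k * (s + ∑ (λ j → eval f (vs j)))
  runResult-sumQueries {r = zero}  vs s f = *-congˡ (sym (+-identityʳ s))
  runResult-sumQueries {r = suc r} vs s f = trans
    (runResult-sumQueries (vs ∘ suc) (s + eval f (vs zero)) f) (*-congˡ (+-assoc _ _ _))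

  runQueries-sumQueries : ∀ {r k} (vs : Vector (Point n) r) s (f : Form n d) →
                          runQueries (sumQueries k vs s) f ≡ r
  runQueries-sumQueries {r = zero}  vs s f = ≡.refl
  runQueries-sumQueries {r = suc r} vs s f = ≡.cong suc (runQueries-sumQueries (vs ∘ suc) _ f)

  sumOfPowers⇒algorithm : ∀ (g : Form n d) r → IsSumOfPowers g r →
    ∃[ A ] (Computes A g × (∀ (f : Form n d) → queries A f ≡ r))
  sumOfPowers⇒algorithm {n} {d} g r (l , g≈) =
      record { strategy = sumQueries (factorial d) vs 0# ; extensional = sumQueries-extensional vs refl }
    , (λ f → trans (runResult-sumQueries vs 0# f)
        (trans (*-congˡ (+-identityˡ _)) (sym (pairing-sumOfPowers g l g≈ f))))
    , runQueries-sumQueries vs 0#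
    where
    vs : Vector (Point n) r
    vs j = linearCoeffs (coeff (l j))

  -- Forms that an algorithm cannot distinguish

  queryPoints : ∀ (s : Strategy n) (f : Form n d) → Vector (Point n) (runQueries s f)
  queryPoints (output a)  f = λ ()
  queryPoints (query v s) f = v Vector.∷ queryPoints (s (eval f v)) f

  -- Adaptivity does no harm: as long as the answers agree, the next points agree too. Two related
  -- strategies are needed for the induction, because answers that agree only up to `_≈_` lead to
  -- continuations related only by `_≋_`.
  sameAnswers⇒sameResult : ∀ {s t} (f f′ : Form n d) → s ≋ t →
    (∀ j → eval f (queryPoints s f j) ≈ eval f′ (queryPoints s f j)) →
    runResult s f ≈ runResult t f′
  sameAnswers⇒sameResult f f′ (output a≈b)    same = a≈b
  sameAnswers⇒sameResult f f′ (query v≈w s≋t) same =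
    sameAnswers⇒sameResult f f′ (s≋t (trans (same zero) (eval-cong f′ v≈w))) (same ∘ suc)

  _⊕_·_ : Form n d → Carrier → Form n d → Form n d
  coeff       (f ⊕ k · h) α    = coeff f α + k * coeff h α
  homogeneous (f ⊕ k · h) α ne = trans
    (+-cong (homogeneous f α ne) (trans (*-congˡ (homogeneous h α ne)) (zeroʳ k))) (+-identityʳ 0#)

  ⟨∣⟩-linearˡ : ∀ (f : Form n d) k h a → ⟨ f ⊕ k · h ∣ a ⟩ ≈ ⟨ f ∣ a ⟩ + k * ⟨ h ∣ a ⟩
  ⟨∣⟩-linearˡ {n} {d} f k h a = trans
    (∑ₗ-cong (exponents n d) (λ α → solve 4 (λ f k h a → (f :+ k :* h) :* a := f :* a :+ k :* (h :* a))
      refl (coeff f α) k (coeff h α) (a α)))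
    (∑ₗ-linear (exponents n d) _ k _)

  ⟨∣⟩-linearʳ : ∀ (f : Form n d) a k b → ⟨ f ∣ (λ α → a α + k * b α) ⟩ ≈ ⟨ f ∣ a ⟩ + k * ⟨ f ∣ b ⟩
  ⟨∣⟩-linearʳ {n} {d} f a k b = trans
    (∑ₗ-cong (exponents n d) (λ α → solve 4 (λ f a k b → f :* (a :+ k :* b) := f :* a :+ k :* (f :* b))
      refl (coeff f α) (a α) k (b α)))
    (∑ₗ-linear (exponents n d) _ k _)

  monomial : ∀ (α : Vec ℕ n) → Vec.sum α ≡ d → Carrier → Form n d
  coeff       (monomial α eq k) β    = k * δᵛ α β
  homogeneous (monomial α eq k) β ne =
    trans (*-congˡ (δᵛ-≢ α β (λ eq′ → ne (≡.trans eq′ eq)))) (zeroʳ k)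

  ⟨monomial∣⟩ : ∀ (α : Vec ℕ n) (eq : Vec.sum α ≡ d) k a → ⟨ monomial α eq k ∣ a ⟩ ≈ k * a α
  ⟨monomial∣⟩ {n} {d} α eq k a = begin
    ∑ₗ E (λ β → k * δᵛ α β * a β)    ≈⟨ ∑ₗ-cong E (λ β → *-assoc k _ _) ⟩
    ∑ₗ E (λ β → k * (δᵛ α β * a β))  ≈⟨ ∑ₗ-*ˡ E k _ ⟩
    k * ∑ₗ E (λ β → δᵛ α β * a β)    ≈⟨ *-congˡ (∑-δᵛ d α eq a) ⟩
    k * a α                          ∎
    where E = exponents n d

  Unit : Carrier → Set _
  Unit x = ∃[ y ] x * y ≈ 1#

  Unit-* : ∀ {x y} → Unit x → Unit y → Unit (x * y)
  Unit-* {x} {y} (u , xu≈1) (v , yv≈1) = u * v , (begin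
    x * y * (u * v)
      ≈⟨ solve 4 (λ x y u v → x :* y :* (u :* v) := (x :* u) :* (y :* v)) refl x y u v ⟩
    (x * u) * (y * v)    ≈⟨ *-cong xu≈1 yv≈1 ⟩
    1# * 1#              ≈⟨ *-identityˡ 1# ⟩
    1#                   ∎)

  Unit-cancelˡ : ∀ {x y z} → Unit x → x * y ≈ x * z → y ≈ z
  Unit-cancelˡ {x} {y} {z} (u , xu≈1) xy≈xz = begin
    y              ≈⟨ sym (cancel y) ⟩
    u * (x * y)    ≈⟨ *-congˡ xy≈xz ⟩
    u * (x * z)    ≈⟨ cancel z ⟩
    z              ∎
    where
    cancel : ∀ y → u * (x * y) ≈ y
    cancel y = begin
      u * (x * y)  ≈⟨ solve 3 (λ u x y → u :* (x :* y) := (x :* u) :* y) refl u x y ⟩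
      (x * u) * y  ≈⟨ *-congʳ xu≈1 ⟩
      1# * y       ≈⟨ *-identityˡ y ⟩
      y            ∎

  -- Lower bound over a field of characteristic 0 with d-th roots

  module LowerBound
    (nat-unit     : ∀ k → Unit (nat (suc k)))
    (zero-or-unit : ∀ x → ¬ ¬ (x ≈ 0# ⊎ Unit x))
    (d : ℕ)
    (root         : ∀ x → ¬ ¬ (∃[ w ] w ^ d ≈ x))
    where

    factorial-unit : ∀ k → Unit (factorial k)
    factorial-unit zero    = 1# , *-identityˡ 1#
    factorial-unit (suc k) = Unit-* (nat-unit k) (factorial-unit k)

    !ᵛ-unit : ∀ (α : Vec ℕ n) → Unit (α !ᵛ)
    !ᵛ-unit []      = 1# , *-identityˡ 1#
    !ᵛ-unit (k ∷ α) = Unit-* (factorial-unit k) (!ᵛ-unit α)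

    zero-or-onto : ∀ (a : Coefficients n) →
      ¬ ¬ ((∀ (h : Form n d) → ⟨ h ∣ a ⟩ ≈ 0#) ⊎ ∃[ h ] ⟨_∣_⟩ {d = d} h a ≈ 1#)
    zero-or-onto {n} a = ¬¬-all-or-any {P = Null} {Q = NonNull} null-or-not (exponents n d) >>= λ where
        (inj₁ null)                 → pure (inj₁ λ h →
          ∑ₗ-zero (exponents n d) (All.map (λ {α} → null⇒0 h α) null))
        (inj₂ (α , eq , k , aαk≈1)) → pure (inj₂ (monomial α eq k ,
          trans (⟨monomial∣⟩ α eq k a) (trans (*-comm k _) aαk≈1)))
      where
      Null NonNull : Vec ℕ n → Set _
      -- The degree is tested for each listed exponent. A wrong degree counts as null, since forms
      -- have coefficient 0 there; a right one is required to build `monomial`.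
      Null    α = Vec.sum α ≢ d ⊎ a α ≈ 0#
      NonNull α = Vec.sum α ≡ d × Unit (a α)

      null-or-not : ∀ α → ¬ ¬ (Null α ⊎ NonNull α)
      null-or-not α with Vec.sum α ℕₚ.≟ d
      ... | no ne  = pure (inj₁ (inj₁ ne))
      ... | yes eq = zero-or-unit (a α) >>= λ where
        (inj₁ a≈0)  → pure (inj₁ (inj₂ a≈0))
        (inj₂ unit) → pure (inj₂ (eq , unit))

      null⇒0 : ∀ (h : Form n d) α → Null α → coeff h α * a α ≈ 0#
      null⇒0 h α (inj₁ ne)  = trans (*-congʳ (homogeneous h α ne)) (zeroˡ _)
      null⇒0 h α (inj₂ a≈0) = trans (*-congˡ a≈0) (zeroʳ _)

    -- A form h vanishing at the points queried on f cannot be told apart from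
    -- 0 by adding it to f, so pairing g kills it.
    queries-determine-pairing : ∀ (g f : Form n d) A → Computes A g → ∀ h →
      (∀ j → eval h (queryPoints (strategy A) f j) ≈ 0#) → ⟨ h ∣ dual g ⟩ ≈ 0#
    queries-determine-pairing g f A computes h h≈0 = begin
      ⟨ h ∣ dual g ⟩                                       ≈⟨ sym (+-identityˡ _) ⟩
      0# + ⟨ h ∣ dual g ⟩                                  ≈⟨ +-congʳ (sym (-‿inverseˡ p)) ⟩
      - p + p + ⟨ h ∣ dual g ⟩                             ≈⟨ +-assoc _ _ _ ⟩
      - p + (p + ⟨ h ∣ dual g ⟩)                           ≈⟨ +-congˡ (+-congˡ (sym (*-identityˡ _))) ⟩
      - p + (p + 1# * ⟨ h ∣ dual g ⟩)
        ≈⟨ +-congˡ (sym (⟨∣⟩-linearˡ f 1# h (dual g))) ⟩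
      - p + ⟨ f′ ∣ dual g ⟩
        ≈⟨ +-congˡ (sym (trans (computes f′) (pairing≈⟨∣⟩ g f′))) ⟩
      - p + result A f′                                    ≈⟨ +-congˡ (sym same) ⟩
      - p + result A f
        ≈⟨ +-congˡ (trans (computes f) (pairing≈⟨∣⟩ g f)) ⟩
      - p + p                                              ≈⟨ -‿inverseˡ p ⟩
      0#                                                   ∎
      where
      p = ⟨ f ∣ dual g ⟩
      f′ = f ⊕ 1# · h
      same : result A f ≈ result A f′
      same = sameAnswers⇒sameResult f f′ (extensional A) λ j → sym (begin
        eval f′ (queryPoints (strategy A) f j)
          ≈⟨ ⟨∣⟩-linearˡ f 1# h (queryPoints (strategy A) f j ^ᵛ_) ⟩
        _ + 1# * eval h (queryPoints (strategy A) f j) ≈⟨ +-congˡ (trans (*-congˡ (h≈0 j)) (zeroʳ 1#)) ⟩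
        eval f (queryPoints (strategy A) f j) + 0#     ≈⟨ +-identityʳ _ ⟩
        eval f (queryPoints (strategy A) f j)          ∎)

    combination⇒sumOfPowers : ∀ (g : Form n d) {s} (vs : Vector (Point n) s) (k : Vector Carrier s) →
      (∀ h → ⟨ h ∣ dual g ⟩ ≈ ∑ (λ j → k j * eval h (vs j))) → ¬ ¬ IsSumOfPowers g s
    combination⇒sumOfPowers {n} g {s} vs k g≈ =
      -- The division by d! anticipates the factor d! with which a power of a linear form represents
      -- an evaluation, as in `power-^ᵛ`.
      ¬¬-choice s (λ j → root (proj₁ (factorial-unit d) * k j)) >>= λ roots →
      let w = λ j → proj₁ (roots j) in
      pure ((λ j → linearForm (scale (w j) (vs j)))
        , λ α → entry w (λ j → proj₂ (roots j)) α (Vec.sum α ℕₚ.≟ d))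
      where
      d!⁻¹ = proj₁ (factorial-unit d)
      module _ (w : Vector Carrier s) (w≈ : ∀ j → w j ^ d ≈ d!⁻¹ * k j) where
        l : Vector (Form n 1) s
        l j = linearForm (scale (w j) (vs j))

        power-l : ∀ α → Vec.sum α ≡ d → ∀ j → k j * vs j ^ᵛ α ≈ α !ᵛ * power (coeff (l j)) d α
        power-l α eq j = sym (begin
          α !ᵛ * power (coeff (l j)) d α
            ≈⟨ power-^ᵛ (homogeneous (l j)) α eq ⟩
          factorial d * linearCoeffs (coeff (l j)) ^ᵛ α
            ≈⟨ *-congˡ (^ᵛ-cong (linearCoeffs-linearForm (scale (w j) (vs j))) α) ⟩
          factorial d * scale (w j) (vs j) ^ᵛ α
            ≈⟨ *-congˡ (scale-^ᵛ (w j) (vs j) α) ⟩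
          factorial d * (w j ^ Vec.sum α * vs j ^ᵛ α)
            ≈⟨ *-congˡ (*-congʳ (trans (reflexive (≡.cong (w j ^_) eq)) (w≈ j))) ⟩
          factorial d * (d!⁻¹ * k j * vs j ^ᵛ α)
            ≈⟨ solve 4 (λ f u k v → f :* (u :* k :* v) := (f :* u) :* (k :* v)) refl (factorial d) d!⁻¹ (k j) _ ⟩
          (factorial d * d!⁻¹) * (k j * vs j ^ᵛ α)
            ≈⟨ *-congʳ (proj₂ (factorial-unit d)) ⟩
          1# * (k j * vs j ^ᵛ α)
            ≈⟨ *-identityˡ _ ⟩
          k j * vs j ^ᵛ α ∎)

        entry : ∀ α → Dec (Vec.sum α ≡ d) → coeff g α ≈ ∑ (λ j → power (coeff (l j)) d α)
        entry α (no ne) = trans (homogeneous g α ne)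
            (sym (∑-zero λ j → power-homogeneous (homogeneous (l j)) d α ne))
          where
          ∑-zero : ∀ {s} {f : Vector Carrier s} → (∀ j → f j ≈ 0#) → ∑ f ≈ 0#
          ∑-zero {zero}  f≈0 = refl
          ∑-zero {suc s} f≈0 = trans (+-cong (f≈0 zero) (∑-zero (f≈0 ∘ suc))) (+-identityʳ 0#)
        -- Testing the identity of functionals on the monomial with exponent α isolates this
        -- coefficient of g, up to α!.
        entry α (yes eq) = Unit-cancelˡ (!ᵛ-unit α) (begin
          dual g α                                       ≈⟨ sym (*-identityˡ _) ⟩
          1# * dual g α                                  ≈⟨ sym (⟨monomial∣⟩ α eq 1# (dual g)) ⟩
          ⟨ monomial α eq 1# ∣ dual g ⟩                  ≈⟨ g≈ (monomial α eq 1#) ⟩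
          ∑ (λ j → k j * eval (monomial α eq 1#) (vs j))
            ≈⟨ sum-cong-≋ (λ j → *-congˡ (trans (⟨monomial∣⟩ α eq 1# (vs j ^ᵛ_)) (*-identityˡ _))) ⟩
          ∑ (λ j → k j * vs j ^ᵛ α)                      ≈⟨ sum-cong-≋ (power-l α eq) ⟩
          ∑ (λ j → α !ᵛ * power (coeff (l j)) d α)
            ≈⟨ sym (*-distribˡ-sum (α !ᵛ) (λ j → power (coeff (l j)) d α)) ⟩
          α !ᵛ * ∑ (λ j → power (coeff (l j)) d α)       ∎)

    -- The bound holds at each f and not just in the worst case: the points queried on any single f
    -- already carry a decomposition of g, up to double negation.
    waringRank≤queries : ∀ (g : Form n d) r → (∀ s → IsSumOfPowers g s → r ≤ s) →
      ∀ A → Computes A g → ∀ (f : Form n d) → r ≤ queries A f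
    waringRank≤queries g r minimal A computes f = decidable-stable (r ℕₚ.≤? queries A f)
      (∩ker⊆ker⇒span (λ j → vs j ^ᵛ_) (dual g) (queries-determine-pairing g f A computes) >>= λ (k , g≈) →
       combination⇒sumOfPowers g vs k g≈ >>= λ g-sum →
       pure (minimal _ g-sum))
      where
      vs = queryPoints (strategy A) f
      open Duality.Elimination R _⊕_·_ (λ a k b α → a α + k * b α) ⟨_∣_⟩ ⟨∣⟩-linearˡ ⟨∣⟩-linearʳ zero-or-onto

-- Rational numbers

open import Defs
open import Data.Integer.Base as ℤ using (+_)
import Data.Integer.Properties as ℤₚ
open import Data.Nat.Base using (_⊓_)
open import Data.Rational.Base as ℚ using (ℚ; 0ℚ; 1ℚ; ½; ∣_∣; positive; nonNegative; mkℚ)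
import Data.Rational.Properties as ℚₚ
import Data.Rational.Unnormalised.Base as ℚᵘ
import Data.Rational.Unnormalised.Properties as ℚᵘₚ

ℚ-absoluteValue : AbsoluteValue ℚₚ.+-*-commutativeRing 0ℓ
ℚ-absoluteValue = record
  { _≤_          = ℚ._≤_
  ; ≤-isPreorder = ℚₚ.≤-isPreorder
  ; +-mono-≤     = ℚₚ.+-mono-≤
  ; *-monoˡ-≤    = λ {x} 0≤x → ℚₚ.*-monoˡ-≤-nonNeg x {{nonNegative 0≤x}}
  ; ∣_∣          = ∣_∣
  ; ∣∣-cong      = ≡.cong ∣_∣
  ; 0≤∣x∣        = ℚₚ.0≤∣p∣
  ; ∣x+y∣≤       = ℚₚ.∣p+q∣≤∣p∣+∣q∣
  ; ∣x*y∣≈       = ℚₚ.∣p*q∣≡∣p∣*∣q∣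
  ; ∣-x∣≈        = ℚₚ.∣-p∣≡∣p∣
  ; 0≤x⇒∣x∣≈x    = ℚₚ.0≤p⇒∣p∣≡p
  ; 0≤x²         = 0≤p²
  ; 0≤1          = ℚₚ.nonNegative⁻¹ 1ℚ
  ; halve        = λ 2p≤2q → ℚₚ.≮⇒≥ λ q<p → ℚₚ.<-irrefl ≡.refl (ℚₚ.<-≤-trans (ℚₚ.+-mono-< q<p q<p) 2p≤2q)
  }
  where
  0≤∣p∣² : ∀ p → 0ℚ ℚ.≤ ∣ p ∣ ℚ.* ∣ p ∣
  0≤∣p∣² p = ℚₚ.≤-trans (ℚₚ.≤-reflexive (≡.sym (ℚₚ.*-zeroʳ ∣ p ∣)))
    (ℚₚ.*-monoˡ-≤-nonNeg ∣ p ∣ {{ℚₚ.∣-∣-nonNeg p}} (ℚₚ.0≤∣p∣ p))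
  neg-square : ∀ p → (ℚ.- p) ℚ.* (ℚ.- p) ≡ p ℚ.* p
  neg-square p = ≡.trans (≡.sym (ℚₚ.neg-distribˡ-* p (ℚ.- p)))
    (≡.trans (≡.cong ℚ.-_ (≡.sym (ℚₚ.neg-distribʳ-* p p)))
      (RingProperties.-‿involutive (CommutativeRing.ring ℚₚ.+-*-commutativeRing) (p ℚ.* p)))
  0≤p² : ∀ p → 0ℚ ℚ.≤ p ℚ.* p
  0≤p² p with ℚₚ.∣p∣≡p∨∣p∣≡-p p
  ... | inj₁ eq = ≡.subst (λ q → 0ℚ ℚ.≤ q ℚ.* q) eq (0≤∣p∣² p)
  ... | inj₂ eq = ≡.subst (0ℚ ℚ.≤_) (neg-square p) (≡.subst (λ q → 0ℚ ℚ.≤ q ℚ.* q) eq (0≤∣p∣² p))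

open AbsoluteValue ℚ-absoluteValue
  using (0≤x+y; 0≤x*y; x≤x+y; x≤y+x; *-monoˡ-≤; *-monoʳ-≤; halve; halving-bound; 4x≈; 2x≈)
open Mult (CommutativeRing.semiring ℚₚ.+-*-commutativeRing) using ()
  renaming (_×_ to _·ℚ_; ×-assoc-* to ·ℚ-assoc-*)

reciprocal : ∀ {p} → 0ℚ ℚ.< p → ∃[ q ] (p ℚ.* q ≡ 1ℚ × 0ℚ ℚ.< q)
reciprocal {p} 0<p = ℚ.1/ p , ℚₚ.*-inverseʳ p , ℚₚ.positive⁻¹ (ℚ.1/ p)
  where
  instance
    _ = positive 0<p
    _ = ℚₚ.pos⇒nonZero p
    _ = ℚₚ.1/pos⇒pos p

0<x*y : ∀ {x y} → 0ℚ ℚ.< x → 0ℚ ℚ.< y → 0ℚ ℚ.< x ℚ.* y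
0<x*y {x} {y} 0<x 0<y = ≡.subst (ℚ._< x ℚ.* y) (ℚₚ.*-zeroʳ x) (ℚₚ.*-monoʳ-<-pos x {{positive 0<x}} 0<y)

fromℕ : ℕ → ℚ
fromℕ n = mkℚ (+ n) 0 (Coprimality.sym (Coprimality.1-coprimeTo n))

n·1≡n : ∀ n → n ·ℚ 1ℚ ≡ fromℕ n
n·1≡n zero    = ≡.refl
n·1≡n (suc n) = ≡.trans (≡.cong (1ℚ ℚ.+_) (n·1≡n n)) (ℚₚ.toℚᵘ-injective
  (ℚᵘₚ.≃-trans (ℚₚ.toℚᵘ-homo-+ 1ℚ (fromℕ n))
    (ℚᵘ.*≡* (≡.cong (λ m → (+ 1 ℤ.+ m) ℤ.* + 1) (ℤₚ.*-identityʳ (+ n))))))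

p≤∣↥p∣ : ∀ p → p ℚ.≤ fromℕ ℤ.∣ ℚ.↥ p ∣
p≤∣↥p∣ (mkℚ (+ zero)   _ _) = ℚ.*≤* (ℤ.+≤+ z≤n)
p≤∣↥p∣ (mkℚ (+ suc m)  _ _) = ℚ.*≤* (ℤ.+≤+ (ℕₚ.*-monoʳ-≤ (suc m) (s≤s z≤n)))
p≤∣↥p∣ (mkℚ ℤ.-[1+ m ] _ _) = ℚ.*≤* ℤ.-≤+

-- A rational is at most the absolute value of its numerator; this is applied to p/q.
archimedean : ∀ p {q} → 0ℚ ℚ.< q → ∃[ n ] p ℚ.≤ n ·ℚ q
archimedean p {q} 0<q with reciprocal 0<q
... | r , qr≡1 , 0<r = n , (begin
    p                        ≡⟨ ℚₚ.*-identityʳ p ⟨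
    p ℚ.* 1ℚ                 ≡⟨ ≡.cong (p ℚ.*_) (≡.trans (≡.sym qr≡1) (ℚₚ.*-comm q r)) ⟩
    p ℚ.* (r ℚ.* q)          ≡⟨ ℚₚ.*-assoc p r q ⟨
    p ℚ.* r ℚ.* q            ≤⟨ *-monoʳ-≤ (ℚₚ.<⇒≤ 0<q) (p≤∣↥p∣ (p ℚ.* r)) ⟩
    fromℕ n ℚ.* q            ≡⟨ ≡.cong (ℚ._* q) (n·1≡n n) ⟨
    (n ·ℚ 1ℚ) ℚ.* q          ≡⟨ ·ℚ-assoc-* n 1ℚ q ⟩
    n ·ℚ (1ℚ ℚ.* q)          ≡⟨ ≡.cong (n ·ℚ_) (ℚₚ.*-identityˡ q) ⟩
    n ·ℚ q                   ∎)
  where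
  open ℚₚ.≤-Reasoning
  n = ℤ.∣ ℚ.↥ (p ℚ.* r) ∣

0≤n·q : ∀ n {q} → 0ℚ ℚ.≤ q → 0ℚ ℚ.≤ n ·ℚ q
0≤n·q zero    0≤q = ℚₚ.≤-refl
0≤n·q (suc n) 0≤q = 0≤x+y 0≤q (0≤n·q n 0≤q)

p≤∣p∣ : ∀ p → p ℚ.≤ ∣ p ∣
p≤∣p∣ (mkℚ (+ n)      _ _) = ℚₚ.≤-refl
p≤∣p∣ (mkℚ ℤ.-[1+ n ] _ _) = ℚ.*≤* ℤ.-≤+

module _ {I : Set} {rank : I → ℕ} where

  Vanishing-dominated : ∀ {x y} → (∀ i → ∣ x i ∣ ℚ.≤ y i) → Vanishing rank y → Vanishing rank x
  small (Vanishing-dominated {x} {y} x≤y y→0) ε ε>0 with small y→0 ε ε>0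
  ... | N , y<ε = N , λ i N≤i →
    ℚₚ.≤-<-trans (ℚₚ.≤-trans (x≤y i) (p≤∣p∣ (y i))) (y<ε i N≤i)

  Vanishing-∣∣ : ∀ {x} → Vanishing rank x → Vanishing rank (λ i → ∣ x i ∣)
  small (Vanishing-∣∣ {x} x→0) ε ε>0 with small x→0 ε ε>0
  ... | N , x<ε = N , λ i N≤i → ≡.subst (ℚ._< ε) (≡.sym (ℚₚ.∣∣p∣∣≡∣p∣ (x i))) (x<ε i N≤i)

  Vanishing-scale : ∀ a {x} → Vanishing rank x → Vanishing rank (λ i → a ℚ.* x i)
  Vanishing-scale a = Vanishing-* {b = λ _ → a}
    (∣ a ∣ ℚ.+ 1ℚ , ℚₚ.+-mono-≤-< (ℚₚ.0≤∣p∣ a) (ℚₚ.positive⁻¹ 1ℚ) , 0 ,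
    λ _ _ → x≤x+y (ℚₚ.nonNegative⁻¹ 1ℚ))

Vanishing-reindex : ∀ {I J : Set} {rank : I → ℕ} {rank′ : J → ℕ} {x} (f : J → I) →
  (∀ j → rank′ j ≤ rank (f j)) → Vanishing rank x → Vanishing rank′ (x ∘ f)
small (Vanishing-reindex f rank′≤ x→0) ε ε>0 with small x→0 ε ε>0
... | N , x<ε = N , λ j N≤j → x<ε (f j) (ℕₚ.≤-trans N≤j (rank′≤ j))

quarter : ∀ ε → 0ℚ ℚ.< ε → ∃[ η ] (0ℚ ℚ.< η × η ℚ.+ η ℚ.+ (η ℚ.+ η) ≡ ε)
quarter ε ε>0 = ½ ℚ.* (½ ℚ.* ε) , 0<x*y 0<½ (0<x*y 0<½ ε>0) ,
  ≡.trans (≡.cong₂ ℚ._+_ (double (½ ℚ.* ε)) (double (½ ℚ.* ε))) (double ε)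
  where
  0<½ = ℚₚ.positive⁻¹ ½
  double : ∀ x → ½ ℚ.* x ℚ.+ ½ ℚ.* x ≡ x
  double x = ≡.trans (≡.sym (ℚₚ.*-distribʳ-+ x ½ ½)) (ℚₚ.*-identityˡ x)

-- A uniform strict contraction with vanishing perturbations: bounds shrink
-- from 3η + (n + 1)η to 3η + nη.
module _ {u v : ℕ × ℕ → ℚ} {B} (0≤u : ∀ i → 0ℚ ℚ.≤ u i) (u≤B : ∀ i → u i ℚ.≤ B)
         (v→0 : Vanishing (uncurry _⊓_) v)
         (contract : ∀ m n → u (suc m , suc n) ℚ.+ u (suc m , suc n) ℚ.≤ u (m , n) ℚ.+ v (m , n)) where

  contraction-vanishes : Vanishing (uncurry _⊓_) u
  small contraction-vanishes ε ε>0 with quarter ε ε>0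
  ... | η , 0<η , 4η≡ε with archimedean B 0<η | small v→0 η 0<η
  ... | n , B≤nη | M , v<η = let N , u≤3η = descend n 0 initial in
      N , λ i N≤i → begin-strict
        ∣ u i ∣                      ≡⟨ ℚₚ.0≤p⇒∣p∣≡p (0≤u i) ⟩
        u i                          ≤⟨ u≤3η i N≤i ⟩
        -- The descent ends at 3η; the fourth quarter of ε makes the inequality strict.
        η ℚ.+ η ℚ.+ η ℚ.+ 0ℚ         <⟨ ℚₚ.+-monoʳ-< (η ℚ.+ η ℚ.+ η) 0<η ⟩
        η ℚ.+ η ℚ.+ η ℚ.+ η          ≡⟨ ℚₚ.+-assoc (η ℚ.+ η) η η ⟩
        η ℚ.+ η ℚ.+ (η ℚ.+ η)        ≡⟨ 4η≡ε ⟩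
        ε                            ∎
    where
    open ℚₚ.≤-Reasoning
    Bounded-by : ℕ → ℕ → Set
    Bounded-by k N = ∀ i → N ≤ uncurry _⊓_ i → u i ℚ.≤ η ℚ.+ η ℚ.+ η ℚ.+ k ·ℚ η

    0≤η = ℚₚ.<⇒≤ 0<η

    initial : Bounded-by n 0
    initial i _ = ℚₚ.≤-trans (u≤B i) (ℚₚ.≤-trans B≤nη (ℚₚ.≤-trans
      (x≤x+y (0≤x+y (0≤x+y 0≤η 0≤η) 0≤η)) (ℚₚ.≤-reflexive (ℚₚ.+-comm (n ·ℚ η) _))))

    shrink : ∀ k N → Bounded-by (suc k) N → ∃[ N′ ] Bounded-by k N′
    -- Past this index both components have predecessors beyond N, where `u` is bounded, and beyond
    -- M, where `v` is below η.
    shrink k N bounded = suc (N ℕ.⊔ M) , λ where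
      (suc m , suc n) (s≤s le) → halve (ℚₚ.≤-trans (contract m n)
        (halving-bound η (k ·ℚ η) (bounded (m , n) (ℕₚ.≤-trans (ℕₚ.m≤m⊔n N M) le))
          (ℚₚ.≤-trans (p≤∣p∣ (v (m , n))) (ℚₚ.<⇒≤ (v<η (m , n) (ℕₚ.≤-trans (ℕₚ.m≤n⊔m N M) le))))
          0≤η (0≤n·q k 0≤η)))

    descend : ∀ k N → Bounded-by k N → ∃[ N′ ] Bounded-by 0 N′
    descend zero    N bounded = N , bounded
    descend (suc k) N bounded = let N′ , bounded′ = shrink k N bounded in descend k N′ bounded′

-- Gaussian rationals and their limits

module ℚ[i] = AdjoinI ℚₚ.+-*-commutativeRing
module ℝ[i] = AdjoinI ℝ-commutativeRing
module G = CommutativeRing ℚ[i].R[i]-commutativeRing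
module ℂ = CommutativeRing ℂ-commutativeRing

-- Abstract, so that the argument of a norm can be inferred.
abstract
  ℚ[i]-norm : Norm ℚ-absoluteValue ℚ[i].R[i]-commutativeRing
  ℚ[i]-norm = norm₁ ℚ-absoluteValue

  ‖z‖≡∣re∣+∣im∣ : ∀ z → Norm.‖_‖ ℚ[i]-norm z ≡ ∣ ℚ[i].re z ∣ ℚ.+ ∣ ℚ[i].im z ∣
  ‖z‖≡∣re∣+∣im∣ z = ≡.refl

open Norm ℚ[i]-norm
open LocalEquations ℚ[i]-norm

approx : ℂ.Carrier → ℕ → G.Carrier
approx z n = seq (ℝ[i].re z) n ℚ[i].+i seq (ℝ[i].im z) n

∣re∣≤‖‖ : ∀ z → ∣ ℚ[i].re z ∣ ℚ.≤ ‖ z ‖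
∣re∣≤‖‖ z = ≡.subst (∣ ℚ[i].re z ∣ ℚ.≤_) (≡.sym (‖z‖≡∣re∣+∣im∣ z)) (x≤x+y (ℚₚ.0≤∣p∣ (ℚ[i].im z)))

∣im∣≤‖‖ : ∀ z → ∣ ℚ[i].im z ∣ ℚ.≤ ‖ z ‖
∣im∣≤‖‖ z = ≡.subst (∣ ℚ[i].im z ∣ ℚ.≤_) (≡.sym (‖z‖≡∣re∣+∣im∣ z)) (x≤y+x (ℚₚ.0≤∣p∣ (ℚ[i].re z)))

dist-approx→0⇒≈ : ∀ z w → Vanishing id (λ n → dist (approx z n) (approx w n)) → z ℂ.≈ w
dist-approx→0⇒≈ z w d→0 =
    Vanishing-dominated (λ n → ∣re∣≤‖‖ (approx z n G.- approx w n)) d→0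
  , Vanishing-dominated (λ n → ∣im∣≤‖‖ (approx z n G.- approx w n)) d→0

approx-cauchy : ∀ z → Vanishing (uncurry _⊓_) (λ (m , n) → dist (approx z m) (approx z n))
approx-cauchy z = Vanishing-resp (λ (m , n) → ≡.sym (‖z‖≡∣re∣+∣im∣ (approx z m G.- approx z n)))
  (Vanishing-+ (Vanishing-∣∣ (cauchy (ℝ[i].re z))) (Vanishing-∣∣ (cauchy (ℝ[i].im z))))

limit : (y : ℕ → G.Carrier) → Vanishing (uncurry _⊓_) (λ (m , n) → dist (y m) (y n)) → ℂ.Carrier
limit y y-cauchy =
  mkℝ (λ n → ℚ[i].re (y n)) (Vanishing-dominated (λ (m , n) → ∣re∣≤‖‖ (y m G.- y n)) y-cauchy) ℝ[i].+i
  mkℝ (λ n → ℚ[i].im (y n)) (Vanishing-dominated (λ (m , n) → ∣im∣≤‖‖ (y m G.- y n)) y-cauchy)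

-- Fixed points of a sequence of contractions

module FixedPoint {Φ : ℕ → G.Carrier → G.Carrier} {ρ} (0≤ρ : 0ℚ ℚ.≤ ρ)
  (ball : ∀ n y → ‖ y ‖ ℚ.≤ ρ → ‖ Φ n y ‖ ℚ.≤ ρ)
  {v : ℕ × ℕ → ℚ} (v→0 : Vanishing (uncurry _⊓_) v)
  (contracts : ∀ m n y z → ‖ y ‖ ℚ.≤ ρ → ‖ z ‖ ℚ.≤ ρ →
               dist (Φ m y) (Φ n z) ℚ.+ dist (Φ m y) (Φ n z) ℚ.≤ dist y z ℚ.+ v (m , n))
  where

  -- The map changes with n: iteration and refinement of the data advance together, so a single
  -- sequence of Gaussian rationals replaces a limit of limits.
  iterate : ℕ → G.Carrier
  iterate zero    = G.0#
  iterate (suc n) = Φ n (iterate n)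

  iterate-ball : ∀ n → ‖ iterate n ‖ ℚ.≤ ρ
  iterate-ball zero    = ℚₚ.≤-trans (ℚₚ.≤-reflexive ‖0‖≈0) 0≤ρ
  iterate-ball (suc n) = ball n _ (iterate-ball n)

  iterate-cauchy : Vanishing (uncurry _⊓_) (λ (m , n) → dist (iterate m) (iterate n))
  iterate-cauchy = contraction-vanishes {v = v} {B = ρ ℚ.+ ρ} (λ _ → 0≤‖x‖ _)
    (λ (m , n) → ‖+‖-mono (iterate-ball m)
      (ℚₚ.≤-trans (ℚₚ.≤-reflexive (‖-x‖≈ (iterate n))) (iterate-ball n)))
    v→0 (λ m n → contracts m n _ _ (iterate-ball m) (iterate-ball n))

  fixedPoint : ℂ.Carrier
  fixedPoint = limit iterate iterate-cauchy

  -- The residual at n is the distance between the iterates n and n + 1.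
  residual→0 : Vanishing id (λ n → ‖ iterate n G.- Φ n (iterate n) ‖)
  residual→0 = Vanishing-reindex (λ n → n , suc n) (λ n → ℕₚ.⊓-glb ℕₚ.≤-refl (ℕₚ.n≤1+n n)) iterate-cauchy

module _ (c : ℂ.Carrier) where

  deviation : ℕ → G.Carrier
  deviation n = approx c n G.- G.1#

  deviation-cauchy : Vanishing (uncurry _⊓_) (λ (m , n) → 4K ℚ.* dist (deviation m) (deviation n))
  deviation-cauchy = Vanishing-scale 4K (Vanishing-resp
    (λ (m , n) → dist-shift (approx c m) (approx c n) G.1#)
    (approx-cauchy c))

  -- Multiplication is termwise, so the n-th term of c(1 + y) is the n-th term of c times 1 +
  -- `iterate n`, and its distance from 1 is the n-th residual.
  near-one⇒unit : (∀ n → ‖ deviation n ‖ ℚ.≤ ½) → ∃[ w ] c ℂ.* w ℂ.≈ ℂ.1#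
  near-one⇒unit near = ℂ.1# ℂ.+ fixedPoint , dist-approx→0⇒≈ (c ℂ.* (ℂ.1# ℂ.+ fixedPoint)) ℂ.1#
    (Vanishing-resp (λ n → ≡.sym (inverseStep-residual (approx c n) (iterate n))) residual→0)
    where
    2h≤1 : ½ ℚ.+ ½ ℚ.≤ 1ℚ
    2h≤1 = ℚₚ.≤-refl
    open FixedPoint {Φ = λ n → inverseStep (deviation n)} (ℚₚ.nonNegative⁻¹ 1ℚ)
      (λ n y → inverseStep-ball 2h≤1 (deviation n) y (near n)) deviation-cauchy
      (λ m n y z _ → inverseStep-contracts 2h≤1 (deviation m) (deviation n) y z (near m))

open BinomialRest ℚ[i]-norm using (restBound; 0≤restBound)
open Mult G.semiring using ()
  renaming (_×_ to _·G_; ×-comm-* to ·G-comm-*; ×-congʳ to ·G-congʳ)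
open RawSemiringOps (Semiring.rawSemiring G.semiring) using () renaming (_^_ to _^G_)
open RawSemiringOps (Semiring.rawSemiring ℂ.semiring) using () renaming (_^_ to _^ℂ_)

invertible : ∀ z → 0ℚ ℚ.< ‖ z ‖ → ∃[ w ] (z G.* w G.≈ G.1#) × ‖ z ‖ ℚ.* ‖ w ‖ ℚ.≤ 1ℚ ℚ.+ 1ℚ
invertible z 0<z =
  let n , Nn≡1 , 0<n   = reciprocal 0<N
      w , zw≈1 , zw≤2  = inverse ℚ-absoluteValue z n Nn≡1 (ℚₚ.<⇒≤ 0<n)
  in w , zw≈1 , ≡.subst (ℚ._≤ 1ℚ ℚ.+ 1ℚ) (≡.sym (≡.cong₂ ℚ._*_ (‖z‖≡∣re∣+∣im∣ z) (‖z‖≡∣re∣+∣im∣ w))) zw≤2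
  where
  N = ∣z∣² ℚ-absoluteValue z
  z²≤2N : ‖ z ‖ ℚ.* ‖ z ‖ ℚ.≤ N ℚ.+ N
  z²≤2N = ≡.subst (λ q → q ℚ.* q ℚ.≤ N ℚ.+ N) (≡.sym (‖z‖≡∣re∣+∣im∣ z)) (∥z∥₁²≤2∣z∣² ℚ-absoluteValue z)
  0<N : 0ℚ ℚ.< N
  0<N = ℚₚ.≰⇒> λ N≤0 → ℚₚ.<-irrefl ≡.refl
    (ℚₚ.<-≤-trans (0<x*y 0<z 0<z) (ℚₚ.≤-trans z²≤2N (ℚₚ.+-mono-≤ {N} {0ℚ} {N} {0ℚ} N≤0 N≤0)))

-- The bound is uniform on the half-plane Re z ≥ 1, so one step length serves for a whole path in
-- it.
right-invertible : ∀ z → 1ℚ ℚ.≤ ℚ[i].re z → ∃[ w ] (z G.* w G.≈ G.1#) × ‖ w ‖ ℚ.≤ 1ℚ ℚ.+ 1ℚ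
right-invertible z 1≤re = let w , zw≈1 , zw≤2 = invertible z (ℚₚ.<-≤-trans (ℚₚ.positive⁻¹ 1ℚ) 1≤z) in
  w , zw≈1 , ℚₚ.≤-trans (ℚₚ.≤-reflexive (≡.sym (ℚₚ.*-identityˡ ‖ w ‖)))
    (ℚₚ.≤-trans (*-monoʳ-≤ (0≤‖x‖ w) 1≤z) zw≤2)
  where
  1≤z : 1ℚ ℚ.≤ ‖ z ‖
  1≤z = ℚₚ.≤-trans 1≤re (ℚₚ.≤-trans (p≤∣p∣ _) (∣re∣≤‖‖ z))

re-· : ∀ n z → ℚ[i].re (n ·G z) ≡ n ·ℚ ℚ[i].re z
re-· zero    z = ≡.refl
re-· (suc n) z = ≡.cong (ℚ[i].re z ℚ.+_) (re-· n z)

im-· : ∀ n z → ℚ[i].im (n ·G z) ≡ n ·ℚ ℚ[i].im z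
im-· zero    z = ≡.refl
im-· (suc n) z = ≡.cong (ℚ[i].im z ℚ.+_) (im-· n z)

1≤[1+n]·1 : ∀ n → 1ℚ ℚ.≤ suc n ·ℚ 1ℚ
1≤[1+n]·1 n = x≤x+y (0≤n·q n (ℚₚ.nonNegative⁻¹ 1ℚ))

nat-invertible : ∀ n → ∃[ k ] ((suc n ·G G.1#) G.* k G.≈ G.1#) × ‖ k ‖ ℚ.≤ 1ℚ ℚ.+ 1ℚ
nat-invertible n = right-invertible (suc n ·G G.1#)
  (ℚₚ.≤-trans (1≤[1+n]·1 n) (ℚₚ.≤-reflexive (≡.sym (re-· (suc n) G.1#))))

approx-^ : ∀ z k n → approx (z ^ℂ k) n ≡ approx z n ^G k
approx-^ z zero    n = ≡.refl
approx-^ z (suc k) n = ≡.cong (approx z n G.*_) (approx-^ z k n)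

approx≡⇒≈ : ∀ z w → (∀ n → approx z n ≡ approx w n) → z ℂ.≈ w
approx≡⇒≈ z w eq = ≡⇒≈ℝ {ℝ[i].re z} {ℝ[i].re w} (λ n → ≡.cong ℚ[i].re (eq n))
                 , ≡⇒≈ℝ {ℝ[i].im z} {ℝ[i].im w} (λ n → ≡.cong ℚ[i].im (eq n))

ι : G.Carrier → ℂ.Carrier
ι (a ℚ[i].+i b) = fromℚ a ℝ[i].+i fromℚ b

ι-cong : ∀ {p q} → p G.≈ q → ι p ℂ.≈ ι q
ι-cong {p} {q} (re≡ , im≡) =
    ≡⇒≈ℝ {ℝ[i].re (ι p)} {ℝ[i].re (ι q)} (λ _ → re≡)
  , ≡⇒≈ℝ {ℝ[i].im (ι p)} {ℝ[i].im (ι q)} (λ _ → im≡)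

ι-+ : ∀ p q → ι (p G.+ q) ℂ.≈ ι p ℂ.+ ι q
ι-+ p q = approx≡⇒≈ (ι (p G.+ q)) (ι p ℂ.+ ι q) (λ _ → ≡.refl)

ι-* : ∀ p q → ι (p G.* q) ℂ.≈ ι p ℂ.* ι q
ι-* p q = approx≡⇒≈ (ι (p G.* q)) (ι p ℂ.* ι q) (λ _ → ≡.refl)

ι-^ : ∀ p k → ι (p ^G k) ℂ.≈ ι p ^ℂ k
ι-^ p zero    = ℂ.refl {ι G.1#}
ι-^ p (suc k) = ℂ.trans {ι (p ^G suc k)} {ι p ℂ.* ι (p ^G k)} {ι p ^ℂ suc k} (ι-* p (p ^G k))
  (ℂ.*-cong {ι p} {ι p} {ι (p ^G k)} {ι p ^ℂ k} (ℂ.refl {ι p}) (ι-^ p k))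

-- If (1 + y)ᵈ = 1 + d y + rest d y with restBound d = B, then the equation
-- (1 + y)ᵈ = 1 + x for ‖ x ‖ ≤ δ is solved by a contraction of ‖ y ‖ ≤ ρ.
record Radius (B : ℚ) : Set where
  field
    ρ δ   : ℚ
    0≤ρ   : 0ℚ ℚ.≤ ρ
    ρ≤1   : ρ ℚ.≤ 1ℚ
    4Bρ≤1 : 4K ℚ.* (B ℚ.* ρ) ℚ.≤ 1ℚ
    0<δ   : 0ℚ ℚ.< δ
    4δ≤ρ  : 4K ℚ.* δ ℚ.≤ ρ
    δ≤1   : δ ℚ.≤ 1ℚ

-- The choice ρ = 1/(1 + 4B) secures both ρ ≤ 1 and 4Bρ ≤ 1; then δ = ρ/4.
radius : ∀ {B} → 0ℚ ℚ.≤ B → Radius B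
radius {B} 0≤B = from-reciprocal (reciprocal (ℚₚ.<-≤-trans (ℚₚ.positive⁻¹ 1ℚ) (x≤x+y 0≤4B)))
  where
  open ℚₚ.≤-Reasoning
  s : ℚ
  s = 1ℚ ℚ.+ 4K ℚ.* B
  0≤4B : 0ℚ ℚ.≤ 4K ℚ.* B
  0≤4B = 0≤x*y (ℚₚ.nonNegative⁻¹ 4K) 0≤B
  module _ {ρ} (sρ≡1 : s ℚ.* ρ ≡ 1ℚ) (0<ρ : 0ℚ ℚ.< ρ)
           {δ} (0<δ : 0ℚ ℚ.< δ) (4δ≡ρ : δ ℚ.+ δ ℚ.+ (δ ℚ.+ δ) ≡ ρ) where
    0≤ρ = ℚₚ.<⇒≤ 0<ρ
    0≤δ = ℚₚ.<⇒≤ 0<δ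
    ρ≤1 : ρ ℚ.≤ 1ℚ
    ρ≤1 = begin
      ρ              ≡⟨ ℚₚ.*-identityˡ ρ ⟨
      1ℚ ℚ.* ρ       ≤⟨ *-monoʳ-≤ {ρ} {1ℚ} {s} 0≤ρ (x≤x+y {1ℚ} 0≤4B) ⟩
      s ℚ.* ρ        ≡⟨ sρ≡1 ⟩
      1ℚ             ∎
    δ≤ρ : δ ℚ.≤ ρ
    δ≤ρ = begin
      δ                        ≤⟨ x≤x+y {δ} {δ} 0≤δ ⟩
      δ ℚ.+ δ                  ≤⟨ x≤x+y {δ ℚ.+ δ} {δ ℚ.+ δ} (0≤x+y 0≤δ 0≤δ) ⟩
      δ ℚ.+ δ ℚ.+ (δ ℚ.+ δ)    ≡⟨ 4δ≡ρ ⟩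
      ρ                        ∎
    4Bρ≤1 : 4K ℚ.* (B ℚ.* ρ) ℚ.≤ 1ℚ
    4Bρ≤1 = begin
      4K ℚ.* (B ℚ.* ρ)   ≡⟨ ℚₚ.*-assoc 4K B ρ ⟨
      4K ℚ.* B ℚ.* ρ     ≤⟨ *-monoʳ-≤ 0≤ρ (x≤y+x {4K ℚ.* B} {1ℚ} (ℚₚ.nonNegative⁻¹ 1ℚ)) ⟩
      s ℚ.* ρ            ≡⟨ sρ≡1 ⟩
      1ℚ                 ∎
    radius′ : Radius B
    radius′ = record
      { ρ = ρ ; δ = δ ; 0≤ρ = 0≤ρ ; ρ≤1 = ρ≤1 ; 4Bρ≤1 = 4Bρ≤1 ; 0<δ = 0<δ
      ; 4δ≤ρ = ℚₚ.≤-reflexive (≡.trans (4x≈ δ) 4δ≡ρ) ; δ≤1 = ℚₚ.≤-trans δ≤ρ ρ≤1 }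
  from-reciprocal : ∃[ ρ ] (s ℚ.* ρ ≡ 1ℚ × 0ℚ ℚ.< ρ) → Radius B
  from-reciprocal (ρ , sρ≡1 , 0<ρ) = let δ , 0<δ , 4δ≡ρ = quarter ρ 0<ρ in radius′ sρ≡1 0<ρ 0<δ 4δ≡ρ

HasRoot : ℕ → ℂ.Carrier → Set
HasRoot d z = ∃[ w ] w ^ℂ d ℂ.≈ z

module _ (d : ℕ) {k} (dk≈1 : (d ·G G.1#) G.* k G.≈ G.1#) (k≤2 : ‖ k ‖ ℚ.≤ 1ℚ ℚ.+ 1ℚ)
         (R : Radius (restBound d)) where
  open Radius R

  near-one⇒root : ∀ c → (∀ n → ‖ deviation c n ‖ ℚ.≤ δ) → HasRoot d c
  near-one⇒root c near = w , dist-approx→0⇒≈ (w ^ℂ d) c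
      (Vanishing-dominated bound (Vanishing-scale ‖ d ·G G.1# ‖ residual→0))
    where
    open FixedPoint {Φ = λ n → rootStep d k (deviation c n)} 0≤ρ
      (λ n y → rootStep-ball d {k} {ρ} {δ} k≤2 0≤ρ ρ≤1 4Bρ≤1 4δ≤ρ (deviation c n) y (near n))
      (deviation-cauchy c)
      (λ m n → rootStep-contracts d {k} {ρ} {δ} k≤2 0≤ρ ρ≤1 4Bρ≤1 4δ≤ρ (deviation c m) (deviation c n))
    w = ℂ.1# ℂ.+ fixedPoint
    bound : ∀ n → ∣ dist (approx (w ^ℂ d) n) (approx c n) ∣ ℚ.≤
      ‖ d ·G G.1# ‖ ℚ.* ‖ iterate n G.- rootStep d k (deviation c n) (iterate n) ‖
    bound n = begin
      ∣ dist (approx (w ^ℂ d) n) (approx c n) ∣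
        ≡⟨ ℚₚ.0≤p⇒∣p∣≡p (0≤‖x‖ (approx (w ^ℂ d) n G.- approx c n)) ⟩
      dist (approx (w ^ℂ d) n) (approx c n)
        ≡⟨ ≡.cong (λ z → dist z (approx c n)) (approx-^ w d n) ⟩
      dist (approx w n ^G d) (approx c n)
        ≤⟨ rootStep-residual d {k} dk≈1 (approx c n) (approx w n) (iterate n) (≡.refl , ≡.refl) ⟩
      ‖ d ·G G.1# ‖ ℚ.* ‖ iterate n G.- rootStep d k (deviation c n) (iterate n) ‖ ∎
      where open ℚₚ.≤-Reasoning

n·q≡[n·1]*q : ∀ n q → n ·ℚ q ≡ (n ·ℚ 1ℚ) ℚ.* q
n·q≡[n·1]*q n q = ≡.trans (≡.cong (n ·ℚ_) (≡.sym (ℚₚ.*-identityˡ q))) (≡.sym (·ℚ-assoc-* n 1ℚ q))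

infixr 7 _⊙_

_⊙_ : ℚ → G.Carrier → G.Carrier
r ⊙ (a ℚ[i].+i b) = (r ℚ.* a) ℚ[i].+i (r ℚ.* b)

‖r⊙z‖≡r*‖z‖ : ∀ {r} → 0ℚ ℚ.≤ r → ∀ z → ‖ r ⊙ z ‖ ≡ r ℚ.* ‖ z ‖
‖r⊙z‖≡r*‖z‖ {r} 0≤r z@(a ℚ[i].+i b) = begin
  ‖ r ⊙ z ‖                            ≡⟨ ‖z‖≡∣re∣+∣im∣ (r ⊙ z) ⟩
  ∣ r ℚ.* a ∣ ℚ.+ ∣ r ℚ.* b ∣          ≡⟨ ≡.cong₂ ℚ._+_ (∣r*x∣≡ a) (∣r*x∣≡ b) ⟩
  r ℚ.* ∣ a ∣ ℚ.+ r ℚ.* ∣ b ∣          ≡⟨ ℚₚ.*-distribˡ-+ r ∣ a ∣ ∣ b ∣ ⟨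
  r ℚ.* (∣ a ∣ ℚ.+ ∣ b ∣)              ≡⟨ ≡.cong (r ℚ.*_) (‖z‖≡∣re∣+∣im∣ z) ⟨
  r ℚ.* ‖ z ‖                          ∎
  where
  open ≡.≡-Reasoning
  ∣r*x∣≡ : ∀ x → ∣ r ℚ.* x ∣ ≡ r ℚ.* ∣ x ∣
  ∣r*x∣≡ x = ≡.trans (ℚₚ.∣p*q∣≡∣p∣*∣q∣ r x) (≡.cong (ℚ._* ∣ x ∣) (ℚₚ.0≤p⇒∣p∣≡p 0≤r))

n·r⊙z≈z : ∀ n {r} → (n ·ℚ 1ℚ) ℚ.* r ≡ 1ℚ → ∀ z → n ·G (r ⊙ z) G.≈ z
n·r⊙z≈z n {r} nr≡1 z@(a ℚ[i].+i b) =
  ≡.trans (re-· n (r ⊙ z)) (cancel a) , ≡.trans (im-· n (r ⊙ z)) (cancel b)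
  where
  cancel : ∀ x → n ·ℚ (r ℚ.* x) ≡ x
  cancel x = ≡.trans (n·q≡[n·1]*q n (r ℚ.* x)) (≡.trans (≡.sym (ℚₚ.*-assoc (n ·ℚ 1ℚ) r x))
    (≡.trans (≡.cong (ℚ._* x) nr≡1) (ℚₚ.*-identityˡ x)))

-- d-th roots of nonzero Gaussian rationals, for d = suc e: those with real
-- part at least 1 are reached from 1 along a straight line in small steps,
-- and the others are obtained from these by scaling and rotating.
module GaussianRoots (e : ℕ) where
  private
    d = suc e
  open Powers ℚ[i].R[i]-commutativeRing ℂ-commutativeRing ι
    (λ {p} {q} → ι-cong {p} {q}) (ℂ.refl {ι G.1#}) ι-* e public

  root-radius : Radius (restBound d)
  root-radius = radius (0≤restBound d)

  open Radius root-radius using (δ; 0<δ; δ≤1) public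

  near-one⇒power : ∀ c → (∀ n → ‖ deviation c n ‖ ℚ.≤ δ) → IsPower c
  near-one⇒power = let k , dk≈1 , k≤2 = nat-invertible e in near-one⇒root d {k} dk≈1 k≤2 root-radius

  ιPower-near-one : ∀ {x} → ‖ x ‖ ℚ.≤ δ → ιPower (G.1# G.+ x)
  ιPower-near-one {x} x≤δ = near-one⇒power (ι (G.1# G.+ x))
    (λ n → ℚₚ.≤-trans (ℚₚ.≤-reflexive (dist-1+x x)) x≤δ)

  -- Consecutive points have the ratio 1 + h/(1 + kh). As Re (1 + kh) ≥ 1, it differs from 1 by at
  -- most twice the norm of h.
  ιPower-path : ∀ {h} → 0ℚ ℚ.≤ ℚ[i].re h → ‖ h ‖ ℚ.+ ‖ h ‖ ℚ.≤ δ → ∀ k → ιPower (G.1# G.+ k ·G h)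
  ιPower-path {h} 0≤re 2h≤δ zero    = ιPower-near-one {G.0#}
    (ℚₚ.≤-trans (ℚₚ.≤-reflexive ‖0‖≈0) (ℚₚ.<⇒≤ 0<δ))
  ιPower-path {h} 0≤re 2h≤δ (suc k) =
    let w , pw≈1 , w≤2 = right-invertible (G.1# G.+ k ·G h) 1≤re in
    ιPower-step {k ·G h} {w} {h} (ιPower-path {h} 0≤re 2h≤δ k) pw≈1 (ιPower-near-one {h G.* w} (hw≤δ w≤2))
    where
    1≤re : 1ℚ ℚ.≤ 1ℚ ℚ.+ ℚ[i].re (k ·G h)
    1≤re = x≤x+y (ℚₚ.≤-trans (0≤n·q k 0≤re) (ℚₚ.≤-reflexive (≡.sym (re-· k h))))
    hw≤δ : ∀ {w} → ‖ w ‖ ℚ.≤ 1ℚ ℚ.+ 1ℚ → ‖ h G.* w ‖ ℚ.≤ δ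
    hw≤δ {w} w≤2 = ℚₚ.≤-trans (‖*‖-mono {h} {w} ℚₚ.≤-refl w≤2)
      (ℚₚ.≤-trans (ℚₚ.≤-reflexive (2x≈ ‖ h ‖)) 2h≤δ)

  ιPower-1≤re : ∀ q → 1ℚ ℚ.≤ ℚ[i].re q → ιPower q
  ιPower-1≤re q 1≤re = subdivide (archimedean (‖ x ‖ ℚ.+ ‖ x ‖) 0<δ)
    where
    x = q G.- G.1#
    0≤re-x : 0ℚ ℚ.≤ ℚ[i].re x
    0≤re-x = ℚₚ.+-monoˡ-≤ (ℚ.- 1ℚ) 1≤re
    subdivide : ∃[ n ] ‖ x ‖ ℚ.+ ‖ x ‖ ℚ.≤ n ·ℚ δ → ιPower q
    subdivide (n , 2x≤nδ) =
      -- The step is 1/(n + 1) of the way, because n may be 0.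
      let r , nr≡1 , 0<r = reciprocal {suc n ·ℚ 1ℚ} (ℚₚ.<-≤-trans (ℚₚ.positive⁻¹ 1ℚ) (1≤[1+n]·1 n)) in
      steps r nr≡1 (ℚₚ.<⇒≤ 0<r)
      where
      steps : ∀ r → (suc n ·ℚ 1ℚ) ℚ.* r ≡ 1ℚ → 0ℚ ℚ.≤ r → ιPower q
      steps r nr≡1 0≤r = ιPower-cong {G.1# G.+ suc n ·G (r ⊙ x)} {q}
        (G.trans {G.1# G.+ suc n ·G (r ⊙ x)} {G.1# G.+ x} {q}
          (G.+-congˡ {G.1#} {suc n ·G (r ⊙ x)} {x} (n·r⊙z≈z (suc n) nr≡1 x))
          (G.sym {q} {G.1# G.+ x} (≈+difference q G.1#)))
        (ιPower-path {r ⊙ x} (0≤x*y 0≤r 0≤re-x) 2rx≤δ (suc n))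
        where
        2rx≤δ : ‖ r ⊙ x ‖ ℚ.+ ‖ r ⊙ x ‖ ℚ.≤ δ
        2rx≤δ = begin
          ‖ r ⊙ x ‖ ℚ.+ ‖ r ⊙ x ‖            ≡⟨ ≡.cong₂ ℚ._+_ (‖r⊙z‖≡r*‖z‖ 0≤r x) (‖r⊙z‖≡r*‖z‖ 0≤r x) ⟩
          r ℚ.* ‖ x ‖ ℚ.+ r ℚ.* ‖ x ‖        ≡⟨ ℚₚ.*-distribˡ-+ r ‖ x ‖ ‖ x ‖ ⟨
          r ℚ.* (‖ x ‖ ℚ.+ ‖ x ‖)
            ≤⟨ *-monoˡ-≤ {r} 0≤r (ℚₚ.≤-trans 2x≤nδ (x≤y+x {n ·ℚ δ} {δ} (ℚₚ.<⇒≤ 0<δ))) ⟩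
          r ℚ.* (suc n ·ℚ δ)                 ≡⟨ ≡.cong (r ℚ.*_) (n·q≡[n·1]*q (suc n) δ) ⟩
          r ℚ.* ((suc n ·ℚ 1ℚ) ℚ.* δ)        ≡⟨ ℚₚ.*-assoc r (suc n ·ℚ 1ℚ) δ ⟨
          r ℚ.* (suc n ·ℚ 1ℚ) ℚ.* δ
            ≡⟨ ≡.cong (ℚ._* δ) (≡.trans (ℚₚ.*-comm r (suc n ·ℚ 1ℚ)) nr≡1) ⟩
          1ℚ ℚ.* δ                           ≡⟨ ℚₚ.*-identityˡ δ ⟩
          δ                                  ∎
          where open ℚₚ.≤-Reasoning

  -- For large n, both nq and n have real part at least 1, and q is their quotient.
  ιPower-0<re : ∀ q → 0ℚ ℚ.< ℚ[i].re q → ιPower q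
  ιPower-0<re q 0<re = scale-up (archimedean 1ℚ 0<re)
    where
    scale-up : ∃[ n ] 1ℚ ℚ.≤ n ·ℚ ℚ[i].re q → ιPower q
    scale-up (zero  , 1≤0)  = contradiction (ℚₚ.<-≤-trans (ℚₚ.positive⁻¹ 1ℚ) 1≤0) (ℚₚ.<-irrefl ≡.refl)
    scale-up (suc n , 1≤nq) =
      let w , nw≈1 , _ = nat-invertible n in
      ιPower-divide {q} {N} {w}
        (ιPower-1≤re N (ℚₚ.≤-trans (1≤[1+n]·1 n) (ℚₚ.≤-reflexive (≡.sym (re-· (suc n) G.1#)))))
        nw≈1
        (ιPower-cong {suc n ·G q} {q G.* N} q*N≈
          (ιPower-1≤re (suc n ·G q) (ℚₚ.≤-trans 1≤nq (ℚₚ.≤-reflexive (≡.sym (re-· (suc n) q))))))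
      where
      N = suc n ·G G.1#
      q*N≈ : suc n ·G q G.≈ q G.* N
      q*N≈ = G.sym {q G.* N} {suc n ·G q} (G.trans {q G.* N} {suc n ·G (q G.* G.1#)} {suc n ·G q}
        (·G-comm-* (suc n) q G.1#) (·G-congʳ (suc n) {q G.* G.1#} {q} (G.*-identityʳ q)))

  𝕚 : G.Carrier
  𝕚 = 0ℚ ℚ[i].+i 1ℚ

  -- The real part of i is 0, but i = ½(1 + i)² and both ½ and 1 + i have positive real part.
  ιPower-𝕚 : ιPower 𝕚
  ιPower-𝕚 = ιPower-cong {½+0i G.* (1+i G.* 1+i)} {𝕚} (≡.refl , ≡.refl)
    (ιPower-* {½+0i} {1+i G.* 1+i} (ιPower-0<re ½+0i (ℚₚ.positive⁻¹ ½))
      (ιPower-* {1+i} {1+i} p p))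
    where
    ½+0i = ½ ℚ[i].+i 0ℚ
    1+i = 1ℚ ℚ[i].+i 1ℚ
    p : ιPower 1+i
    p = ιPower-0<re 1+i (ℚₚ.positive⁻¹ 1ℚ)

  rotate : ∀ q → ιPower (𝕚 G.* q) → ιPower q
  rotate q = ιPower-rotate {𝕚} {q} (≡.refl , ≡.refl) ιPower-𝕚

  re-𝕚* : ∀ q → ℚ[i].re (𝕚 G.* q) ≡ ℚ.- ℚ[i].im q
  re-𝕚* (a ℚ[i].+i b) = ≡.trans (≡.cong₂ (λ x y → x ℚ.+ ℚ.- y) (ℚₚ.*-zeroˡ a) (ℚₚ.*-identityˡ b))
    (ℚₚ.+-identityˡ (ℚ.- b))

  im-𝕚* : ∀ q → ℚ[i].im (𝕚 G.* q) ≡ ℚ[i].re q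
  im-𝕚* (a ℚ[i].+i b) = ≡.trans (≡.cong₂ ℚ._+_ (ℚₚ.*-zeroˡ b) (ℚₚ.*-identityˡ a)) (ℚₚ.+-identityˡ a)

  -- Multiplication by i takes Im < 0 to Re > 0, then Re < 0 to Im < 0, and Im > 0 to Re < 0: after
  -- three quarter turns only 0 is left out.
  ιPower-im<0 : ∀ q → ℚ[i].im q ℚ.< 0ℚ → ιPower q
  ιPower-im<0 q im<0 = rotate q (ιPower-0<re (𝕚 G.* q)
    (≡.subst (0ℚ ℚ.<_) (≡.sym (re-𝕚* q)) (ℚₚ.neg-antimono-< im<0)))

  ιPower-re<0 : ∀ q → ℚ[i].re q ℚ.< 0ℚ → ιPower q
  ιPower-re<0 q re<0 = rotate q (ιPower-im<0 (𝕚 G.* q) (≡.subst (ℚ._< 0ℚ) (≡.sym (im-𝕚* q)) re<0))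

  ιPower-0<im : ∀ q → 0ℚ ℚ.< ℚ[i].im q → ιPower q
  ιPower-0<im q 0<im = rotate q (ιPower-re<0 (𝕚 G.* q)
    (≡.subst (ℚ._< 0ℚ) (≡.sym (re-𝕚* q)) (ℚₚ.neg-antimono-< 0<im)))

  ιPower-nonzero : ∀ q → 0ℚ ℚ.< ‖ q ‖ → ιPower q
  ιPower-nonzero q 0<q = split (ℚₚ.<-cmp (ℚ[i].re q) 0ℚ) (ℚₚ.<-cmp (ℚ[i].im q) 0ℚ)
    where
    split : Tri (ℚ[i].re q ℚ.< 0ℚ) (ℚ[i].re q ≡ 0ℚ) (0ℚ ℚ.< ℚ[i].re q) →
            Tri (ℚ[i].im q ℚ.< 0ℚ) (ℚ[i].im q ≡ 0ℚ) (0ℚ ℚ.< ℚ[i].im q) → ιPower q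
    split (tri< re<0 _ _) _               = ιPower-re<0 q re<0
    split (tri> _ _ 0<re) _               = ιPower-0<re q 0<re
    split (tri≈ _ _ _)    (tri< im<0 _ _) = ιPower-im<0 q im<0
    split (tri≈ _ _ _)    (tri> _ _ 0<im) = ιPower-0<im q 0<im
    split (tri≈ _ re≡0 _) (tri≈ _ im≡0 _) = contradiction 0<q
      (ℚₚ.<-irrefl (≡.sym (≡.trans (‖‖-cong {q} {G.0#} (re≡0 , im≡0)) ‖0‖≈0)))

-- Complex numbers

-- The results near 1 constrain every term of a sequence, not just the late ones. Dropping early
-- terms provides such a representative of the same number.
shift : ℕ → ℂ.Carrier → ℂ.Carrier
shift N z = tail (ℝ[i].re z) ℝ[i].+i tail (ℝ[i].im z)
  where
  tail : ℝ → ℝ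
  tail x = mkℝ (λ n → seq x (N ℕ.+ n)) (Vanishing-reindex (λ (m , n) → N ℕ.+ m , N ℕ.+ n)
    (λ (m , n) → ℕₚ.⊓-mono-≤ (ℕₚ.m≤n+m m N) (ℕₚ.m≤n+m n N)) (cauchy x))

shift-≈ : ∀ N z → shift N z ℂ.≈ z
shift-≈ N z = dist-approx→0⇒≈ (shift N z) z (Vanishing-reindex (λ n → N ℕ.+ n , n)
  (λ n → ℕₚ.⊓-glb (ℕₚ.m≤n+m n N) ℕₚ.≤-refl) (approx-cauchy z))

-- Some q ≠ 0 and N such that the terms of the sequence c from N on are q
-- up to a relative error δ.
record Approximation (δ : ℚ) (c : ℂ.Carrier) : Set where
  field
    q q⁻¹   : G.Carrier
    0<q     : 0ℚ ℚ.< ‖ q ‖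
    qq⁻¹≈1  : q G.* q⁻¹ G.≈ G.1#
    N       : ℕ
    close   : ∀ n → dist (approx c (N ℕ.+ n) G.* q⁻¹) G.1# ℚ.≤ δ

  quotient : ℂ.Carrier
  quotient = shift N (c ℂ.* ι q⁻¹)

  quotient-near-one : ∀ n → ‖ deviation quotient n ‖ ℚ.≤ δ
  quotient-near-one = close

  quotient≈ : quotient ℂ.≈ c ℂ.* ι q⁻¹
  quotient≈ = shift-≈ N (c ℂ.* ι q⁻¹)

  ≈quotient*q : quotient ℂ.* ι q ℂ.≈ c
  ≈quotient*q = begin
    quotient ℂ.* ι q
      ≈⟨ ℂ.*-cong {quotient} {c ℂ.* ι q⁻¹} {ι q} {ι q} quotient≈ (ℂ.refl {ι q}) ⟩
    c ℂ.* ι q⁻¹ ℂ.* ι q        ≈⟨ ℂ.*-assoc c (ι q⁻¹) (ι q) ⟩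
    c ℂ.* (ι q⁻¹ ℂ.* ι q)      ≈⟨ ℂ.*-congˡ {c} {ι q⁻¹ ℂ.* ι q} {ℂ.1#} (begin
      ι q⁻¹ ℂ.* ι q              ≈⟨ ℂ.*-comm (ι q⁻¹) (ι q) ⟩
      ι q ℂ.* ι q⁻¹              ≈⟨ ι-* q q⁻¹ ⟨
      ι (q G.* q⁻¹)              ≈⟨ ι-cong {q G.* q⁻¹} {G.1#} qq⁻¹≈1 ⟩
      ι G.1#                     ∎) ⟩
    c ℂ.* ℂ.1#                 ≈⟨ ℂ.*-identityʳ c ⟩
    c                          ∎
    where open SetoidReasoning ℂ.setoid

-- If all tails get close to 0 then c = 0; otherwise some term q has ‖ q ‖ ≥ 2η
-- while the later ones differ from it by less than δη.
zero-or-approximation : ∀ {δ} → 0ℚ ℚ.< δ → δ ℚ.≤ 1ℚ → ∀ c → ¬ ¬ (c ℂ.≈ ℂ.0# ⊎ Approximation δ c)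
zero-or-approximation {δ} 0<δ δ≤1 c k = k (inj₁ (dist-approx→0⇒≈ c ℂ.0# c→0))
  where
  no-approximation : ¬ Approximation δ c
  no-approximation a = k (inj₂ a)

  0≤δ : 0ℚ ℚ.≤ δ
  0≤δ = ℚₚ.<⇒≤ 0<δ

  module _ {ε η} (0<η : 0ℚ ℚ.< η) (4η≡ε : η ℚ.+ η ℚ.+ (η ℚ.+ η) ≡ ε)
           {N} (close : ∀ i → N ≤ uncurry _⊓_ i →
             ∣ dist (approx c (proj₁ i)) (approx c (proj₂ i)) ∣ ℚ.< δ ℚ.* η)
           where
    open ℚₚ.≤-Reasoning
    0≤η : 0ℚ ℚ.≤ η
    0≤η = ℚₚ.<⇒≤ 0<η
    q = approx c N

    dist≤ : ∀ n → N ≤ n → dist (approx c n) q ℚ.≤ δ ℚ.* η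
    dist≤ n N≤n = ℚₚ.≤-trans (p≤∣p∣ (dist (approx c n) q)) (ℚₚ.<⇒≤ (close (n , N) (ℕₚ.⊓-glb N≤n ℕₚ.≤-refl)))

    small-term : ‖ q ‖ ℚ.< η ℚ.+ η → ∀ n → N ≤ n → ∣ dist (approx c n) G.0# ∣ ℚ.< ε
    small-term q<2η n N≤n = begin-strict
      ∣ dist (approx c n) G.0# ∣             ≡⟨ ℚₚ.0≤p⇒∣p∣≡p (0≤‖x‖ (approx c n G.- G.0#)) ⟩
      dist (approx c n) G.0#                 ≤⟨ dist-triangle (approx c n) q ⟩
      dist (approx c n) q ℚ.+ ‖ q ‖          <⟨ ℚₚ.+-mono-≤-< (dist≤ n N≤n) q<2η ⟩
      δ ℚ.* η ℚ.+ (η ℚ.+ η)                  ≤⟨ ℚₚ.+-monoˡ-≤ (η ℚ.+ η) (*-monoʳ-≤ {η} 0≤η δ≤1) ⟩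
      1ℚ ℚ.* η ℚ.+ (η ℚ.+ η)                 ≡⟨ ≡.cong (ℚ._+ (η ℚ.+ η)) (ℚₚ.*-identityˡ η) ⟩
      η ℚ.+ (η ℚ.+ η)                        ≤⟨ ℚₚ.+-monoˡ-≤ (η ℚ.+ η) (x≤x+y {η} {η} 0≤η) ⟩
      η ℚ.+ η ℚ.+ (η ℚ.+ η)                  ≡⟨ 4η≡ε ⟩
      ε                                      ∎

    large-term : η ℚ.+ η ℚ.≤ ‖ q ‖ → Approximation δ c
    large-term 2η≤q = let q⁻¹ , qq⁻¹≈1 , bound = invertible q 0<q in record
      { q = q ; q⁻¹ = q⁻¹ ; 0<q = 0<q ; qq⁻¹≈1 = qq⁻¹≈1 ; N = N
      ; close = λ n → relative q⁻¹ qq⁻¹≈1 bound (N ℕ.+ n) (ℕₚ.m≤m+n N n) }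
      where
      0<q : 0ℚ ℚ.< ‖ q ‖
      0<q = ℚₚ.<-≤-trans 0<η (ℚₚ.≤-trans (x≤x+y {η} {η} 0≤η) 2η≤q)
      relative : ∀ q⁻¹ → q G.* q⁻¹ G.≈ G.1# → ‖ q ‖ ℚ.* ‖ q⁻¹ ‖ ℚ.≤ 1ℚ ℚ.+ 1ℚ →
                 ∀ n → N ≤ n → dist (approx c n G.* q⁻¹) G.1# ℚ.≤ δ
      relative q⁻¹ qq⁻¹≈1 bound n N≤n = begin
        dist (approx c n G.* q⁻¹) G.1#           ≤⟨ dist-quotient (approx c n) qq⁻¹≈1 ⟩
        dist (approx c n) q ℚ.* ‖ q⁻¹ ‖          ≤⟨ *-monoʳ-≤ {‖ q⁻¹ ‖} (0≤‖x‖ q⁻¹) (dist≤ n N≤n) ⟩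
        δ ℚ.* η ℚ.* ‖ q⁻¹ ‖                      ≡⟨ ℚₚ.*-assoc δ η ‖ q⁻¹ ‖ ⟩
        -- The threshold 2η for large terms makes up for the factor 2 in the norm of an inverse: 2η‖
        -- q⁻¹ ‖ ≤ ‖ q ‖‖ q⁻¹ ‖ ≤ 2.
        δ ℚ.* (η ℚ.* ‖ q⁻¹ ‖)                    ≤⟨ *-monoˡ-≤ {δ} 0≤δ (halve (begin
          η ℚ.* ‖ q⁻¹ ‖ ℚ.+ η ℚ.* ‖ q⁻¹ ‖          ≡⟨ ℚₚ.*-distribʳ-+ ‖ q⁻¹ ‖ η η ⟨
          (η ℚ.+ η) ℚ.* ‖ q⁻¹ ‖                    ≤⟨ *-monoʳ-≤ {‖ q⁻¹ ‖} (0≤‖x‖ q⁻¹) 2η≤q ⟩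
          ‖ q ‖ ℚ.* ‖ q⁻¹ ‖                        ≤⟨ bound ⟩
          1ℚ ℚ.+ 1ℚ                                ∎)) ⟩
        δ ℚ.* 1ℚ                                 ≡⟨ ℚₚ.*-identityʳ δ ⟩
        δ                                        ∎

  c→0 : Vanishing id (λ n → dist (approx c n) G.0#)
  small c→0 ε 0<ε =
    let η , 0<η , 4η≡ε = quarter ε 0<ε
        N , close      = small (approx-cauchy c) (δ ℚ.* η) (0<x*y 0<δ 0<η)
    in N , decide 0<η 4η≡ε close (ℚₚ._<?_ _ _)
    where
    decide : ∀ {η} (0<η : 0ℚ ℚ.< η) (4η≡ε : η ℚ.+ η ℚ.+ (η ℚ.+ η) ≡ ε) {N}
      (close : ∀ i → N ≤ uncurry _⊓_ i → ∣ dist (approx c (proj₁ i)) (approx c (proj₂ i)) ∣ ℚ.< δ ℚ.* η) →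
      Dec (‖ approx c N ‖ ℚ.< η ℚ.+ η) → ∀ n → N ≤ n → ∣ dist (approx c n) G.0# ∣ ℚ.< ε
    decide 0<η 4η≡ε close (yes q<2η) = small-term 0<η 4η≡ε close q<2η
    decide 0<η 4η≡ε close (no q≮2η)  =
      contradiction (large-term 0<η 4η≡ε close (ℚₚ.≮⇒≥ q≮2η)) no-approximation

open QueryComplexity ℂ-commutativeRing using (Unit; module LowerBound; sumOfPowers⇒algorithm)
open FormProperties ℂ-commutativeRing using (nat)

ℂ-zero-or-unit : ∀ c → ¬ ¬ (c ℂ.≈ ℂ.0# ⊎ Unit c)
-- The precision ½ is the `h` with 2h ≤ 1 for which `inverseStep` contracts.
ℂ-zero-or-unit c = zero-or-approximation {½} (ℚₚ.positive⁻¹ ½) (toWitness {a? = ½ ℚₚ.≤? 1ℚ} _) c >>= λ where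
    (inj₁ c≈0) → pure (inj₁ c≈0)
    (inj₂ a)   → pure (inj₂ (unit a))
  where
  unit : Approximation ½ c → Unit c
  unit a = let w , w≈ = near-one⇒unit quotient quotient-near-one in ι q⁻¹ ℂ.* w , (begin
      c ℂ.* (ι q⁻¹ ℂ.* w)     ≈⟨ ℂ.*-assoc c (ι q⁻¹) w ⟨
      c ℂ.* ι q⁻¹ ℂ.* w
        ≈⟨ ℂ.*-cong {c ℂ.* ι q⁻¹} {quotient} {w} {w} (ℂ.sym {quotient} {c ℂ.* ι q⁻¹} quotient≈) (ℂ.refl {w}) ⟩
      quotient ℂ.* w          ≈⟨ w≈ ⟩
      ℂ.1#                    ∎)
    where
    open Approximation a
    open SetoidReasoning ℂ.setoid

ℂ-root : ∀ e c → ¬ ¬ (∃[ w ] w ^ℂ suc e ℂ.≈ c)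
ℂ-root e c = zero-or-approximation 0<δ δ≤1 c >>= λ where
    -- The exponent is positive, so 0 is a root of 0.
    (inj₁ c≈0) → pure (ℂ.0# , ℂ.trans {ℂ.0# ^ℂ suc e} {ℂ.0#} {c} (ℂ.zeroˡ (ℂ.0# ^ℂ e)) (ℂ.sym {c} {ℂ.0#} c≈0))
    (inj₂ a)   → pure (root a)
  where
  open GaussianRoots e
  root : Approximation δ c → IsPower c
  root a = IsPower-cong {quotient ℂ.* ι q} {c} ≈quotient*q
    (IsPower-* {quotient} {ι q} (near-one⇒power quotient quotient-near-one) (ιPower-nonzero q 0<q))
    where open Approximation a

ℂ-nat-unit : ∀ n → Unit (nat (suc n))
ℂ-nat-unit n = let k , nk≈1 , _ = nat-invertible n in ι k , (begin
    nat (suc n) ℂ.* ι k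
      ≈⟨ ℂ.*-cong {ι (suc n ·G G.1#)} {nat (suc n)} {ι k} {ι k} (ι-nat (suc n)) (ℂ.refl {ι k}) ⟨
    ι (suc n ·G G.1#) ℂ.* ι k        ≈⟨ ι-* (suc n ·G G.1#) k ⟨
    ι ((suc n ·G G.1#) G.* k)        ≈⟨ ι-cong {(suc n ·G G.1#) G.* k} {G.1#} nk≈1 ⟩
    ι G.1#                           ∎)
  where
  open SetoidReasoning ℂ.setoid
  ι-nat : ∀ n → ι (n ·G G.1#) ℂ.≈ nat n
  ι-nat zero    = ℂ.refl {ℂ.0#}
  ι-nat (suc n) = ℂ.trans {ι (suc n ·G G.1#)} {ι G.1# ℂ.+ ι (n ·G G.1#)} {nat (suc n)} (ι-+ G.1# (n ·G G.1#))
    (ℂ.+-congˡ {ℂ.1#} {ι (n ·G G.1#)} {nat n} (ι-nat n))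

theorem6 : ∀ {n d : ℕ} → 1 ≤ d → (g : Form n d) → ∀ r → IsWaringRank g r →
    (∃[ A ] (Computes A g × (∀ (f : Form n d) → queries A f ≡ r)))
    × (∀ (A : Algorithm n) → Computes A g → ∀ (f : Form n d) → r ≤ queries A f)
theorem6 {d = suc e} _ g r (sumOfPowers , minimal) =
    sumOfPowers⇒algorithm g r sumOfPowers
  , LowerBound.waringRank≤queries ℂ-nat-unit ℂ-zero-or-unit (suc e) (ℂ-root e) g r minimal
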